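{- There exists a deterministic algorithm that, given a $\Gamma$-labeled graph $G=(V,E)$ with nonnegative edge lengths $\ell\in\mathbb{R}_{\ge 0}^{E}$, finds a shortest non-zero cycle in $G$ (i.e. a cycle $C$ minimizing $\ell(C)$ subject to $\psi_G(C)\neq 1_\Gamma$), or reports that none exists, and requires $O(n(m+n\log n))$ elementary operations, where $n=|V|$ and $m=|E|$.
   Context: $\Gamma$ is a fixed group (possibly non-abelian or infinite), written multiplicatively with identity $1_\Gamma$. A $\Gamma$-labeled graph is a finite directed graph $\vec G=(V,\vec E)$ with a map $\psi:\vec E\to\Gamma$; it is treated as its underlying undirected graph $G=(V,E)$ (no loops, parallel edges allowed), where for an edge $e=\{u,v\}$ coming from the arc $\vec e=uv$ one sets $\psi_G(e,uv)=\psi(\vec e)$ and $\psi_G(e,vu)=\psi(\vec e)^{ -1}$. A walk is an alternating sequence $W=(v_0,e_1,v_1,\dots,e_k,v_k)$ with $e_i=\{v_{i-1},v_i\}\in E$; it is a path if all $v_i$ are distinct, and a cycle if $v_0=v_k$, the subwalk from $v_1$ to $v_k$ is a path, and $e_1$ is not an edge of that subwalk (so two parallel edges form a cycle). The label is $\psi_G(W)=\psi_G(e_1,v_0v_1)\cdots\psi_G(e_k,v_{k-1}v_k)$ and the length is $\ell(W)=\sum_{i=1}^k\ell(e_i)$. $W$ is non-zero if $\psi_G(W)\ne 1_\Gamma$; for cycles this does not depend on the choice of direction or end vertex. Computational model: basic operations on $\Gamma$ (the group operation, testing equality of two elements, taking inverses) and arithmetic operations and comparisons on edge lengths (e.g.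 reals) are elementary, i.e. each is performed in constant time. -}

module Defs where

open import Level using (Level; _⊔_; 0ℓ) renaming (suc to lsuc)
open import Algebra.Bundles using (Group; CommutativeRing)
open import Data.Bool using (Bool; true; false)
open import Data.Empty using (⊥)
open import Data.Fin using (Fin; toℕ; fromℕ<)
open import Data.List using (List; []; _∷_; length; lookup)
open import Data.List.Membership.Propositional using (_∉_)
open import Data.List.Relation.Unary.Unique.Propositional using (Unique)
open import Data.Product using (_×_)
open import Data.Sum using (_⊎_; inj₁; inj₂)
open import Function using (_∘_)
open import Relation.Binary using (Rel; Decidable; IsDecTotalOrder)
open import Relation.Binary.PropositionalEquality using (_≡_; _≢_; refl)
open import Relation.Nullary using (¬_; yes; no; does)

-- Edge lengths.  The real numbers, with comparison available as an operation,
-- are an instance.  The inverse is a total function whose value at zero is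
-- unconstrained.

record OrderedField c ℓ₁ ℓ₂ : Set (lsuc (c ⊔ ℓ₁ ⊔ ℓ₂)) where
  infix  4 _≤_
  infix  8 _⁻¹
  field
    commutativeRing : CommutativeRing c ℓ₁
  open CommutativeRing commutativeRing public hiding (_-_)
  field
    _≤_             : Rel Carrier ℓ₂
    _⁻¹             : Carrier → Carrier
    isDecTotalOrder : IsDecTotalOrder _≈_ _≤_
    0≉1             : ¬ (0# ≈ 1#)
    *-inverseʳ      : ∀ x → ¬ (x ≈ 0#) → x * x ⁻¹ ≈ 1#
    +-monoˡ-≤       : ∀ x y z → x ≤ y → x + z ≤ y + z
    *-nonNeg        : ∀ x y → 0# ≤ x → 0# ≤ y → 0# ≤ x * y
  open IsDecTotalOrder isDecTotalOrder public using (_≤?_)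

open import Data.Nat using (ℕ; suc; _+_; _∸_; _≟_; _≤?_; _<?_)

-- An edge e stands for the arc from tail e to head e.

record LabeledGraph {a b} (Γ : Group a b) : Set a where
  field
    n m     : ℕ
    tail    : Fin m → Fin n
    head    : Fin m → Fin n
    no-loop : ∀ e → tail e ≢ head e
    label   : Fin m → Group.Carrier Γ

module Walks {a b} {Γ : Group a b} (G : LabeledGraph Γ) where
  open Group Γ using (Carrier; _≈_; _∙_; ε; _⁻¹)
  open LabeledGraph G

  Vertex Edge : Set
  Vertex = Fin n
  Edge   = Fin m

  -- e = {u , v}; the injection records the direction of traversal from u to v,
  -- which is determined by u and v as there are no loops.

  Joins : Edge → Vertex → Vertex → Set
  Joins e u v = (tail e ≡ u × head e ≡ v) ⊎ (tail e ≡ v × head e ≡ u)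

  ψₑ : ∀ e {u v} → Joins e u v → Carrier
  ψₑ e (inj₁ _) = label e
  ψₑ e (inj₂ _) = label e ⁻¹

  data Walk : Vertex → Vertex → Set where
    stop : ∀ v → Walk v v
    step : ∀ u e {v w} → Joins e u v → Walk v w → Walk u w

  vertices : ∀ {u v} → Walk u v → List Vertex
  vertices (stop v)       = v ∷ []
  vertices (step u _ _ W) = u ∷ vertices W

  edges : ∀ {u v} → Walk u v → List Edge
  edges (stop _)       = []
  edges (step _ e _ W) = e ∷ edges W

  ψ : ∀ {u v} → Walk u v → Carrier
  ψ (stop _)       = ε
  ψ (step _ e j W) = ψₑ e j ∙ ψ W

  NonZero : ∀ {u v} → Walk u v → Set b
  NonZero W = ¬ (ψ W ≈ ε)

  IsPath : ∀ {u v} → Walk u v → Set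
  IsPath W = Unique (vertices W)

  IsCycle : ∀ {u v} → Walk u v → Set
  IsCycle (stop _)               = ⊥
  IsCycle (step u e {w = v} _ W) = u ≡ v × IsPath W × e ∉ edges W

  module _ {c ℓ₁ ℓ₂} (L : OrderedField c ℓ₁ ℓ₂)
           (ℓ : Edge → OrderedField.Carrier L) where
    private module L = OrderedField L

    walkLength : ∀ {u v} → Walk u v → L.Carrier
    walkLength (stop _)       = L.0#
    walkLength (step _ e _ W) = ℓ e L.+ walkLength W

    IsShortestNonZeroCycle : ∀ {v} → Walk v v → Set (b ⊔ ℓ₂)
    IsShortestNonZeroCycle C = IsCycle C × NonZero C ×
      (∀ {w} (D : Walk w w) → IsCycle D → NonZero D → walkLength C L.≤ walkLength D)

-- Programs for a unit-cost random access machine whose memory consists of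
-- arrays of naturals, of group elements and of lengths.  Group elements and
-- lengths can be handled only through the operations below.  There is no
-- multiplication of naturals, as is usual when their size is not bounded.

data Sort : Set where
  nat grp len : Sort

infixl 6 _+ⁿ_ _∸ⁿ_ _+ˡ_
infixl 7 _∙ᵍ_ _*ˡ_
infix  8 -ˡ_ _⁻¹ᵍ _⁻¹ˡ
infix  9 _[_]

data Expr : Sort → Set where
  _[_]      : ∀ {s} → ℕ → Expr nat → Expr s
  lit       : ℕ → Expr nat
  _+ⁿ_ _∸ⁿ_ : Expr nat → Expr nat → Expr nat
  εᵍ        : Expr grp
  _∙ᵍ_      : Expr grp → Expr grp → Expr grp
  _⁻¹ᵍ      : Expr grp → Expr grp
  0ˡ 1ˡ     : Expr len
  _+ˡ_ _*ˡ_ : Expr len → Expr len → Expr len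
  -ˡ_ _⁻¹ˡ  : Expr len → Expr len

infix 5 _≤ⁿ_ _≈ᵍ_ _≤ˡ_

data Test : Set where
  _≤ⁿ_ : Expr nat → Expr nat → Test
  _≈ᵍ_ : Expr grp → Expr grp → Test
  _≤ˡ_ : Expr len → Expr len → Test

infix  4 _[_]≔_
infix  3 if_then_else_ while_loop_
infixr 2 _⨾_

data Program : Set where
  skip          : Program
  _[_]≔_        : ∀ {s} → ℕ → Expr nat → Expr s → Program
  _⨾_           : Program → Program → Program
  if_then_else_ : Test → Program → Program → Program
  while_loop_   : Test → Program → Program

exprCost : ∀ {s} → Expr s → ℕ
exprCost (_ [ i ]) = suc (exprCost i)
exprCost (lit _)   = 1
exprCost (x +ⁿ y)  = suc (exprCost x + exprCost y)
exprCost (x ∸ⁿ y)  = suc (exprCost x + exprCost y)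
exprCost εᵍ        = 1
exprCost (x ∙ᵍ y)  = suc (exprCost x + exprCost y)
exprCost (x ⁻¹ᵍ)   = suc (exprCost x)
exprCost 0ˡ        = 1
exprCost 1ˡ        = 1
exprCost (x +ˡ y)  = suc (exprCost x + exprCost y)
exprCost (x *ˡ y)  = suc (exprCost x + exprCost y)
exprCost (-ˡ x)    = suc (exprCost x)
exprCost (x ⁻¹ˡ)   = suc (exprCost x)

testCost : Test → ℕ
testCost (x ≤ⁿ y) = suc (exprCost x + exprCost y)
testCost (x ≈ᵍ y) = suc (exprCost x + exprCost y)
testCost (x ≤ˡ y) = suc (exprCost x + exprCost y)

override : ∀ {a} {A : Set a} → ℕ → ℕ → A → (ℕ → ℕ → A) → ℕ → ℕ → A
override a i v f a′ i′ with a ≟ a′ | i ≟ i′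
... | yes _ | yes _ = v
... | _     | _     = f a′ i′

-- The first k entries are given by f and the remaining ones are d.

table : ∀ {a} {A : Set a} {k} → A → (Fin k → A) → ℕ → A
table {k = k} d f i with i <? k
... | yes i<k = f (fromℕ< i<k)
... | no  _   = d

module Machine {a b c ℓ₁ ℓ₂} (Γ : Group a b) (_≟ᵍ_ : Decidable (Group._≈_ Γ))
               (L : OrderedField c ℓ₁ ℓ₂) where
  private
    module Γ = Group Γ
    module L = OrderedField L

  sortLevel : Sort → Level
  sortLevel nat = 0ℓ
  sortLevel grp = a
  sortLevel len = c

  Value : (s : Sort) → Set (sortLevel s)
  Value nat = ℕ
  Value grp = Γ.Carrier
  Value len = L.Carrier

  -- The value at i of array number k is given by applying a field to k and i.

  record Store : Set (a ⊔ c) where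
    constructor store
    field
      nats : ℕ → ℕ → ℕ
      grps : ℕ → ℕ → Γ.Carrier
      lens : ℕ → ℕ → L.Carrier
  open Store public

  read : ∀ s → Store → ℕ → ℕ → Value s
  read nat = nats
  read grp = grps
  read len = lens

  write : ∀ s → ℕ → ℕ → Value s → Store → Store
  write nat k i v σ = record σ { nats = override k i v (nats σ) }
  write grp k i v σ = record σ { grps = override k i v (grps σ) }
  write len k i v σ = record σ { lens = override k i v (lens σ) }

  eval : ∀ {s} → Expr s → Store → Value s
  eval {s} (k [ i ]) σ = read s σ k (eval i σ)
  eval (lit x)  σ = x
  eval (x +ⁿ y) σ = eval x σ + eval y σ
  eval (x ∸ⁿ y) σ = eval x σ ∸ eval y σ
  eval εᵍ       σ = Γ.ε
  eval (x ∙ᵍ y) σ = eval x σ Γ.∙ eval y σ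
  eval (x ⁻¹ᵍ)  σ = eval x σ Γ.⁻¹
  eval 0ˡ       σ = L.0#
  eval 1ˡ       σ = L.1#
  eval (x +ˡ y) σ = eval x σ L.+ eval y σ
  eval (x *ˡ y) σ = eval x σ L.* eval y σ
  eval (-ˡ x)   σ = L.- eval x σ
  eval (x ⁻¹ˡ)  σ = eval x σ L.⁻¹

  test : Test → Store → Bool
  test (x ≤ⁿ y) σ = does (eval x σ ≤? eval y σ)
  test (x ≈ᵍ y) σ = does (eval x σ ≟ᵍ eval y σ)
  test (x ≤ˡ y) σ = does (eval x σ L.≤? eval y σ)

  -- ⟨ P , σ ⟩⇓⟨ t , τ ⟩ : started in σ, the program P halts in τ after t
  -- elementary operations.

  data ⟨_,_⟩⇓⟨_,_⟩ : Program → Store → ℕ → Store → Set (a ⊔ c) where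
    skip⇓   : ∀ {σ} → ⟨ skip , σ ⟩⇓⟨ 0 , σ ⟩
    assign⇓ : ∀ {s k i σ} {e : Expr s} →
              ⟨ k [ i ]≔ e , σ ⟩⇓⟨ suc (exprCost i + exprCost e)
                                 , write s k (eval i σ) (eval e σ) σ ⟩
    seq⇓    : ∀ {P Q σ τ υ t u} →
              ⟨ P , σ ⟩⇓⟨ t , τ ⟩ → ⟨ Q , τ ⟩⇓⟨ u , υ ⟩ →
              ⟨ P ⨾ Q , σ ⟩⇓⟨ t + u , υ ⟩
    then⇓   : ∀ {B P Q σ τ t} → test B σ ≡ true → ⟨ P , σ ⟩⇓⟨ t , τ ⟩ →
              ⟨ if B then P else Q , σ ⟩⇓⟨ testCost B + t , τ ⟩
    else⇓   : ∀ {B P Q σ τ t} → test B σ ≡ false → ⟨ Q , σ ⟩⇓⟨ t , τ ⟩ →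
              ⟨ if B then P else Q , σ ⟩⇓⟨ testCost B + t , τ ⟩
    loop⇓   : ∀ {B P σ τ υ t u} → test B σ ≡ true →
              ⟨ P , σ ⟩⇓⟨ t , τ ⟩ → ⟨ while B loop P , τ ⟩⇓⟨ u , υ ⟩ →
              ⟨ while B loop P , σ ⟩⇓⟨ testCost B + (t + u) , υ ⟩
    exit⇓   : ∀ {B P σ} → test B σ ≡ false →
              ⟨ while B loop P , σ ⟩⇓⟨ testCost B , σ ⟩

  module _ (G : LabeledGraph Γ)
           (ℓ : Fin (LabeledGraph.m G) → L.Carrier) where
    open LabeledGraph G
    open Walks G

    -- The graph is given as a list of edges; all other cells hold 0 or ε.

    input : Store
    input = store natInput grpInput lenInput
      where
      natInput : ℕ → ℕ → ℕ
      natInput 0 0 = n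
      natInput 0 1 = m
      natInput 1 i = table 0 (toℕ ∘ tail) i
      natInput 2 i = table 0 (toℕ ∘ head) i
      natInput _ _ = 0

      grpInput : ℕ → ℕ → Γ.Carrier
      grpInput 0 i = table Γ.ε label i
      grpInput _ _ = Γ.ε

      lenInput : ℕ → ℕ → L.Carrier
      lenInput 0 i = table L.0# ℓ i
      lenInput _ _ = L.0#

    Lists : ∀ {k} → (ℕ → ℕ) → List (Fin k) → Set
    Lists f xs = ∀ i → f (toℕ i) ≡ toℕ (lookup xs i)

    -- The number of edges of the cycle found is to be left in cell 0 of array 3,
    -- its vertices v₀, …, vₖ in array 4 and its edges e₁, …, eₖ in array 5.
    -- As a cycle has at least one edge, 0 is free to report that there is none.

    data CorrectOutput (τ : Store) : Set (b ⊔ ℓ₂) where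
      none  : nats τ 3 0 ≡ 0 →
              (∀ {v} (C : Walk v v) → IsCycle C → ¬ NonZero C) →
              CorrectOutput τ
      found : ∀ {v} (C : Walk v v) → IsShortestNonZeroCycle L ℓ C →
              nats τ 3 0 ≡ length (edges C) →
              Lists (nats τ 4) (vertices C) →
              Lists (nats τ 5) (edges C) →
              CorrectOutput τ

{-# OPTIONS --safe #-}

-- Fix a vertex s.  A tree of shortest paths from s gives each vertex v that it
-- reaches a distance d v and a label g v.  Call an arc b from u to v bad if
-- g u · ψ b ≠ g v.  Its fundamental cycle is then non-zero, and not longer than
-- d u + ℓ b + d v, because the paths from s to u and to v are only needed below
-- the vertex at which they part.  Conversely, the labels of the arcs on a closed
-- walk from s telescope unless one of them is bad, and for an arc b of the walk
-- d u + ℓ b + d v is at most the length of the walk.  Hence the fundamental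
-- cycle of a bad arc that minimises this sum over all s is a shortest non-zero
-- cycle.
--
-- The trees are found by Dijkstra's algorithm with a hollow heap (Hansen,
-- Kaplan, Tarjan and Zwick): decreasing a key creates a new node which takes
-- over all but the first two children of the old one, and the latter stays in
-- its place without an item.  So nodes need not be cut from their parents, and
-- decreasing a key takes constant time.  A node of rank r retains children of
-- ranks r - 1 and r - 2, hence has at least 2^⌊r/2⌋ descendants.  As at most
-- 2 + 2m nodes are created, all ranks are O(log n + m/n), and the n extractions
-- of a minimum, which take time proportional to the largest rank, take
-- O(m + n log n) altogether.

module Submission where

open import Level using (Lift; _⊔_)
open import Algebra.Bundles using (Group)
import Algebra.Properties.Group as GroupProperties
open import Data.Bool using (Bool; true; false; T; _∧_; not)
open import Data.Empty using (⊥; ⊥-elim)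
open import Data.Fin using (Fin; toℕ; fromℕ<) renaming (zero to fzero; suc to fsuc)
open import Data.Fin.Properties using (toℕ-injective; toℕ<n; fromℕ<-toℕ; toℕ-fromℕ<)
open import Data.List using (List; []; _∷_; length; _++_; lookup)
open import Data.List.Membership.Propositional using (_∈_; _∉_)
open import Data.List.Properties using (++-assoc; ++-identityʳ; length-++)
open import Data.List.Relation.Unary.All as All using (All; []; _∷_)
import Data.List.Relation.Unary.All.Properties as All
open import Data.List.Relation.Unary.AllPairs using ([]; _∷_)
open import Data.List.Relation.Unary.Any using (here; there)
open import Data.List.Relation.Unary.Unique.Propositional using (Unique)
open import Data.Nat using (ℕ; zero; suc; pred; _+_; _*_; _∸_; _^_; _⊓_; ⌈_/2⌉; _≤_; _<_; z≤n; s≤s; _≟_; _≤?_; _<?_; _≤ᵇ_; _≡ᵇ_)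
open import Data.Nat.DivMod using (_/_; _%_; m≡m%n+[m/n]*n; m%n<n; m/n*n≤m)
open import Data.Nat.Induction using (<-rec)
open import Data.Nat.Logarithm using (⌈log₂_⌉; ⌈log₂⌉-mono-≤; ⌈log₂⌈n/2⌉⌉≡⌈log₂n⌉∸1)
open import Data.Nat.Properties
open import Data.Nat.Tactic.RingSolver using (solve-∀)
open import Data.Product using (Σ-syntax; ∃-syntax; _×_; _,_; proj₁; proj₂)
open import Data.Sum using (_⊎_; inj₁; inj₂)
open import Data.Unit.Polymorphic using (⊤; tt)
open import Function using (_⟨_⟩_)
open import Relation.Binary using (Decidable; IsDecTotalOrder; Rel; Transitive)
open import Relation.Binary.PropositionalEquality hiding ([_])
open import Relation.Nullary using (¬_; Dec; does; yes; no)
open import Defs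

-- Lengths may be 0, edges may be parallel and distances may tie. Of the search the correctness
-- proof uses essentially that arcs out of reached vertices are relaxed and that tree arcs are tight
-- in distance and label; depth in the tree, not distance, directs the climb to the vertex at which
-- two branches part. Parallel edges leave m unbounded in n, so that log m is not O(log n): this is
-- where the summand m/n in the bound on ranks comes from.
--
-- Each loop invariant carries a budget of ticks. A tick stands for at most `tick` elementary
-- operations; 200 is enough for every loop-free block and every loop test of the program. The
-- amortised values are 10 for a root of the heap, 4 for an occupied slot and 12 for a child of a
-- hollow node.
--
-- Separation of the data structures in memory is expressed by counting. A forest is weighed by
-- functions of its nodes, and the statement that each node number has weight at most 1 replaces all
-- disjointness conditions. The same sums, with other weights, give the number of nodes, the
-- whereabouts of items and the potential.

tick : ℕ
tick = 200

-- Updates of arrays and a syntactic frame condition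

override-elim : ∀ {a p} {A : Set a} (P : A → Set p) k i {v f} j →
                (i ≡ j → P v) → (i ≢ j → P (f k j)) → P (override k i v f k j)
override-elim P k i j same other with k ≟ k | i ≟ j
... | yes _ | yes i≡j = same i≡j
... | yes _ | no i≢j  = other i≢j
... | no k≢k | _      = ⊥-elim (k≢k refl)

-- An equality of functions that needs no extensionality: once the array numbers are known to
-- differ, `override` reduces without looking at the index, and the rest is eta.
override-array : ∀ {a} {A : Set a} k i {v : A} {f} k′ → k ≢ k′ → override k i v f k′ ≡ f k′
override-array k i {v} {f} k′ k≢k′ = go
  where
  go : (λ j → override k i v f k′ j) ≡ f k′
  go with k ≟ k′
  ... | yes k≡k′ = ⊥-elim (k≢k′ k≡k′)
  ... | no _     = refl

same-sort : Sort → Sort → Bool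
same-sort nat nat = true
same-sort grp grp = true
same-sort len len = true
same-sort _   _   = false

-- Being a Boolean that computes on concrete programs, this turns frame conditions into implicit
-- arguments that are found by evaluation.
keeps : Sort → ℕ → Program → Bool
keeps s k skip                   = true
keeps s k (_[_]≔_ {s′} k′ _ _)   = not (same-sort s s′ ∧ (k′ ≡ᵇ k))
keeps s k (P ⨾ Q)                = keeps s k P ∧ keeps s k Q
keeps s k (if _ then P else Q)   = keeps s k P ∧ keeps s k Q
keeps s k (while _ loop P)       = keeps s k P

T-∧ˡ : ∀ {x y} → T (x ∧ y) → T x
T-∧ˡ {true} _ = _

T-∧ʳ : ∀ {x y} → T (x ∧ y) → T y
T-∧ʳ {true} p = p

≢ᵇ⇒≢ : ∀ k k′ → T (not (k ≡ᵇ k′)) → k ≢ k′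
≢ᵇ⇒≢ k k′ p refl with k ≡ᵇ k | ≡⇒≡ᵇ k k refl
... | true | _ = p

does-true : ∀ {p} {P : Set p} (d : Dec P) → does d ≡ true → P
does-true (yes p) _ = p

does-false : ∀ {p} {P : Set p} (d : Dec P) → does d ≡ false → ¬ P
does-false (no ¬p) _ = ¬p

-- Defined by recursion rather than by `_≟_` so that it computes on constructors: `δ (suc v) 0` is 0
-- and `δ (suc v) (suc w)` is `δ v w`, which is how items are compared with vertices.
δ : ℕ → ℕ → ℕ
δ zero    zero    = 1
δ zero    (suc y) = 0
δ (suc x) zero    = 0
δ (suc x) (suc y) = δ x y

δ-refl : ∀ x → δ x x ≡ 1
δ-refl zero    = refl
δ-refl (suc x) = δ-refl x

δ-≢ : ∀ {x y} → x ≢ y → δ x y ≡ 0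
δ-≢ {zero}  {zero}  x≢y = ⊥-elim (x≢y refl)
δ-≢ {zero}  {suc y} x≢y = refl
δ-≢ {suc x} {zero}  x≢y = refl
δ-≢ {suc x} {suc y} x≢y = δ-≢ (λ eq → x≢y (cong suc eq))

upd : ∀ {a} {A : Set a} → (ℕ → A) → ℕ → A → ℕ → A
upd f i v = override 0 i v (λ _ → f) 0

upd-elim : ∀ {a p} {A : Set a} (P : A → Set p) i {v f} j →
           (i ≡ j → P v) → (i ≢ j → P (f j)) → P (upd f i v j)
upd-elim P i j = override-elim P 0 i j

-- Finite sums

sumTo : ℕ → (ℕ → ℕ) → ℕ
sumTo zero    f = 0
sumTo (suc n) f = f n + sumTo n f

sumTo-cong : ∀ n {f g} → (∀ i → i < n → f i ≡ g i) → sumTo n f ≡ sumTo n g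
sumTo-cong zero    eq = refl
sumTo-cong (suc n) eq = cong₂ _+_ (eq n ≤-refl) (sumTo-cong n (λ i i<n → eq i (m<n⇒m<1+n i<n)))

sumTo-const : ∀ n k → sumTo n (λ _ → k) ≡ n * k
sumTo-const zero    k = refl
sumTo-const (suc n) k = cong (k +_) (sumTo-const n k)

sumTo-zero : ∀ n {f} → (∀ i → i < n → f i ≡ 0) → sumTo n f ≡ 0
sumTo-zero n eq = trans (sumTo-cong n eq) (trans (sumTo-const n 0) (*-zeroʳ n))

+-interchange : ∀ a b c d → (a + b) + (c + d) ≡ (a + c) + (b + d)
+-interchange a b c d = begin
  (a + b) + (c + d) ≡⟨ +-assoc a b (c + d) ⟩
  a + (b + (c + d)) ≡⟨ cong (a +_) (+-assoc b c d) ⟨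
  a + ((b + c) + d) ≡⟨ cong (λ z → a + (z + d)) (+-comm b c) ⟩
  a + ((c + b) + d) ≡⟨ cong (a +_) (+-assoc c b d) ⟩
  a + (c + (b + d)) ≡⟨ +-assoc a c (b + d) ⟨
  (a + c) + (b + d) ∎
  where open ≡-Reasoning

sumTo-+ : ∀ n f g → sumTo n (λ i → f i + g i) ≡ sumTo n f + sumTo n g
sumTo-+ zero    f g = refl
sumTo-+ (suc n) f g =
  trans (cong ((f n + g n) +_) (sumTo-+ n f g)) (+-interchange (f n) (g n) _ _)

-- Both sides are moved so that no subtraction occurs.
sumTo-change : ∀ n {f g} i → i < n → (∀ j → i ≢ j → f j ≡ g j) →
               sumTo n f + g i ≡ sumTo n g + f i
sumTo-change (suc n) {f} {g} i i<n same with n ≟ i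
... | yes refl = begin
  (f n + sumTo n f) + g n ≡⟨ cong (_+ g n) (+-comm (f n) _) ⟩
  (sumTo n f + f n) + g n ≡⟨ +-assoc (sumTo n f) _ _ ⟩
  sumTo n f + (f n + g n) ≡⟨ cong₂ _+_ (sumTo-cong n (λ j j<n → same j (λ eq → <-irrefl (sym eq) j<n))) (+-comm (f n) (g n)) ⟩
  sumTo n g + (g n + f n) ≡⟨ +-assoc (sumTo n g) _ _ ⟨
  (sumTo n g + g n) + f n ≡⟨ cong (_+ f n) (+-comm _ (g n)) ⟩
  (g n + sumTo n g) + f n ∎
  where open ≡-Reasoning
... | no n≢i = begin
  (f n + sumTo n f) + g i ≡⟨ +-assoc (f n) _ _ ⟩
  f n + (sumTo n f + g i) ≡⟨ cong₂ _+_ (same n (λ eq → n≢i (sym eq)))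
                               (sumTo-change n i (≤∧≢⇒< (≤-pred i<n) (λ eq → n≢i (sym eq))) same) ⟩
  g n + (sumTo n g + f i) ≡⟨ +-assoc (g n) _ _ ⟨
  (g n + sumTo n g) + f i ∎
  where open ≡-Reasoning

term≤sumTo : ∀ n {f} i → i < n → f i ≤ sumTo n f
term≤sumTo (suc n) {f} i i<n with n ≟ i
... | yes refl = m≤m+n (f n) _
... | no n≢i   = ≤-trans (term≤sumTo n i (≤∧≢⇒< (≤-pred i<n) (λ eq → n≢i (sym eq)))) (m≤n+m _ (f n))

-- Bounds on ranks and on the total time

-- This is 2^⌊r/2⌋, a lower bound for the size of a tree of rank r. The recursion by two fits the
-- two children that every node of larger rank retains.
pow : ℕ → ℕ
pow 0             = 1
pow 1             = 1
pow (suc (suc r)) = pow r + pow r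

pow-mono : ∀ r → pow r ≤ pow (suc r)
pow-mono 0             = ≤-refl
pow-mono 1             = s≤s z≤n
pow-mono (suc (suc r)) = +-mono-≤ (pow-mono r) (pow-mono r)

n≤2⌈n/2⌉ : ∀ n → n ≤ 2 * ⌈ n /2⌉
n≤2⌈n/2⌉ zero          = z≤n
n≤2⌈n/2⌉ (suc zero)    = s≤s z≤n
n≤2⌈n/2⌉ (suc (suc n)) = ≤-trans (s≤s (s≤s (n≤2⌈n/2⌉ n))) (≤-reflexive (sym (*-suc 2 ⌈ n /2⌉)))

1≤⌈log₂⌉ : ∀ n → 1 ≤ ⌈log₂ suc (suc n) ⌉
1≤⌈log₂⌉ n = ⌈log₂⌉-mono-≤ {2} {suc (suc n)} (s≤s (s≤s z≤n))

n≤2^⌈log₂n⌉ : ∀ n → n ≤ 2 ^ ⌈log₂ n ⌉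
n≤2^⌈log₂n⌉ = <-rec _ go
  where
  go : ∀ n → (∀ {k} → k < n → k ≤ 2 ^ ⌈log₂ k ⌉) → n ≤ 2 ^ ⌈log₂ n ⌉
  go zero rec = z≤n
  go (suc zero) rec = s≤s z≤n
  go n@(suc (suc k)) rec = begin
    n                              ≤⟨ n≤2⌈n/2⌉ n ⟩
    2 * ⌈ n /2⌉                    ≤⟨ *-monoʳ-≤ 2 (rec (⌈n/2⌉<n k)) ⟩
    2 * 2 ^ ⌈log₂ ⌈ n /2⌉ ⌉        ≡⟨ cong (λ l → 2 * 2 ^ l) (⌈log₂⌈n/2⌉⌉≡⌈log₂n⌉∸1 n) ⟩
    2 ^ suc (⌈log₂ n ⌉ ∸ 1)        ≡⟨ cong (2 ^_) (m+[n∸m]≡n (1≤⌈log₂⌉ k)) ⟩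
    2 ^ ⌈log₂ n ⌉                  ∎
    where open ≤-Reasoning

pow-mono-≤ : ∀ {r r′} → r ≤ r′ → pow r ≤ pow r′
pow-mono-≤ {r} {r′} r≤r′ = subst (λ k → pow r ≤ pow k) (m∸n+n≡m r≤r′) (go (r′ ∸ r))
  where
  go : ∀ k → pow r ≤ pow (k + r)
  go zero    = ≤-refl
  go (suc k) = ≤-trans (go k) (pow-mono (k + r))

pow-double : ∀ k → pow (k * 2) ≡ 2 ^ k
pow-double zero    = refl
pow-double (suc k) = trans (cong₂ _+_ (pow-double k) (pow-double k)) (cong (2 ^ k +_) (sym (+-identityʳ (2 ^ k))))

suc≤2^ : ∀ k → suc k ≤ 2 ^ k
suc≤2^ zero    = ≤-refl
suc≤2^ (suc k) = +-mono-≤ (≤-trans (s≤s z≤n) (suc≤2^ k)) (≤-trans (suc≤2^ k) (≤-reflexive (sym (+-identityʳ _))))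

-- `suc (pred n)` is n, or 1 if n is 0, which makes the division total. The sum replaces a logarithm
-- of `size`, since log of `size` is at most about log n + `size`/n.
maxRank : ℕ → ℕ → ℕ
maxRank n size = suc ((⌈log₂ suc (pred n) ⌉ + size / suc (pred n)) * 2)

-- A larger rank would give `pow r` ≥ 2^l · 2^q ≥ n′ (q + 1), where q is the quotient of `size` by
-- n′, and division with remainder makes this exceed `size`.
rank-bounded : ∀ n size r → pow r ≤ size → r ≤ maxRank n size
rank-bounded n size r pow≤ with r ≤? maxRank n size
... | yes r≤ = r≤
... | no r≰ = ⊥-elim (<-irrefl refl (begin-strict
    size                       ≡⟨ m≡m%n+[m/n]*n size n′ ⟩
    size % n′ + q * n′         <⟨ +-monoˡ-< (q * n′) (m%n<n size n′) ⟩
    suc q * n′                 ≡⟨ *-comm (suc q) n′ ⟩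
    n′ * suc q                 ≤⟨ *-mono-≤ (n≤2^⌈log₂n⌉ n′) (suc≤2^ q) ⟩
    2 ^ l * 2 ^ q              ≡⟨ ^-distribˡ-+-* 2 l q ⟨
    2 ^ (l + q)                ≤⟨ ^-monoʳ-≤ 2 (n≤1+n (l + q)) ⟩
    2 ^ suc (l + q)            ≡⟨ pow-double (suc (l + q)) ⟨
    pow (suc (l + q) * 2)      ≤⟨ pow-mono-≤ (≰⇒> r≰) ⟩
    pow r                      ≤⟨ pow≤ ⟩
    size                       ∎))
  where
  open ≤-Reasoning
  n′ = suc (pred n)
  l = ⌈log₂ n′ ⌉
  q = size / n′

-- Absorbs lone terms n and n² into the bound n² log n. The additional 1 is for n = 1, where the
-- logarithm vanishes.
n≤1+nlog : ∀ n → n ≤ suc (n * ⌈log₂ n ⌉)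
n≤1+nlog zero          = z≤n
n≤1+nlog (suc zero)    = s≤s z≤n
n≤1+nlog n@(suc (suc k)) = ≤-trans (≤-trans (≤-reflexive (sym (*-identityʳ n))) (*-monoʳ-≤ n (1≤⌈log₂⌉ k))) (n≤1+n _)

sourceTime : ℕ → ℕ → ℕ → ℕ
sourceTime n m r = 50 + 10 * r + (60 * n + 30 * (n * r) + 110 * m)

-- Multiplication by n cancels the quotient in `maxRank`, so that over n extractions it amounts to
-- O(m), whatever the relation of m and n.
n*maxRank≤ : ∀ n m → n * maxRank n (2 + 2 * m) ≤ n + (2 * (n * ⌈log₂ n ⌉) + (4 + 4 * m))
n*maxRank≤ zero m = z≤n
n*maxRank≤ n@(suc _) m = begin
  n * suc ((l + q) * 2)                        ≡⟨ solved n l q ⟩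
  n + (2 * (n * l) + 2 * (q * n))              ≤⟨ +-monoʳ-≤ n (+-monoʳ-≤ (2 * (n * l)) (*-monoʳ-≤ 2 (m/n*n≤m (2 + 2 * m) n))) ⟩
  n + (2 * (n * l) + 2 * (2 + 2 * m))          ≡⟨ solved′ n (n * l) m ⟩
  n + (2 * (n * l) + (4 + 4 * m))              ∎
  where
  open ≤-Reasoning
  l = ⌈log₂ n ⌉
  q = (2 + 2 * m) / n
  solved : ∀ n l q → n * suc ((l + q) * 2) ≡ n + (2 * (n * l) + 2 * (q * n))
  solved = solve-∀
  solved′ : ∀ n k m → n + (2 * k + 2 * (2 + 2 * m)) ≡ n + (2 * k + (4 + 4 * m))
  solved′ = solve-∀

time-bound : ∀ n m → (n ≡ 0 → m ≡ 0) → 2 + 6 * m + n * sourceTime n m (maxRank n (2 + 2 * m)) ≤ 440 * suc (n * (m + n * ⌈log₂ n ⌉))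
time-bound zero m m≡0 rewrite m≡0 refl = s≤s (s≤s z≤n)
time-bound n@(suc k) m _ = begin
  2 + 6 * m + n * sourceTime n m r
    ≡⟨ solved n m r ⟩
  2 + 6 * m + (50 * n + (10 * (n * r) + (60 * (n * n) + (30 * (n * (n * r)) + 110 * P))))
    ≤⟨ +-mono-≤ (+-monoʳ-≤ 2 (*-monoʳ-≤ 6 m≤P)) (+-mono-≤ (*-monoʳ-≤ 50 n≤) (+-mono-≤ (*-monoʳ-≤ 10 nr≤) (+-mono-≤ (*-monoʳ-≤ 60 nn≤)
         (+-monoˡ-≤ (110 * P) (*-monoʳ-≤ 30 nnr≤))))) ⟩
  2 + 6 * P + (50 * (1 + Q) + (10 * (5 + 3 * Q + 4 * P) + (60 * (1 + 2 * Q) + (30 * (5 + 8 * Q + 4 * P) + 110 * P))))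
    -- The left side is 312 + 276 P + 440 Q. The coefficient of Q is the largest; the slack raises
    -- the other two to it.
    ≤⟨ m≤m+n _ (128 + 164 * P) ⟩
  2 + 6 * P + (50 * (1 + Q) + (10 * (5 + 3 * Q + 4 * P) + (60 * (1 + 2 * Q) + (30 * (5 + 8 * Q + 4 * P) + 110 * P)))) + (128 + 164 * P)
    ≡⟨ solved′ P Q ⟩
  440 * suc (P + Q)
    ≡⟨ cong (λ z → 440 * suc z) (*-distribˡ-+ n m (n * l)) ⟨
  440 * suc (n * (m + n * l)) ∎
  where
  open ≤-Reasoning
  l = ⌈log₂ n ⌉
  r = maxRank n (2 + 2 * m)
  P = n * m
  Q = n * (n * l)
  m≤P : m ≤ P
  m≤P = m≤m+n m (k * m)
  nl≤Q : n * l ≤ Q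
  nl≤Q = m≤m+n (n * l) (k * (n * l))
  n≤ : n ≤ 1 + Q
  n≤ = ≤-trans (n≤1+nlog n) (s≤s nl≤Q)
  nn≤ : n * n ≤ 1 + 2 * Q
  nn≤ = begin
    n * n         ≤⟨ *-monoʳ-≤ n (n≤1+nlog n) ⟩
    n * suc (n * l) ≡⟨ *-suc n (n * l) ⟩
    n + Q         ≤⟨ +-monoˡ-≤ Q n≤ ⟩
    1 + Q + Q     ≡⟨ cong (λ z → suc (Q + z)) (+-identityʳ Q) ⟨
    1 + 2 * Q     ∎
  nr≤ : n * r ≤ 5 + 3 * Q + 4 * P
  nr≤ = begin
    n * r ≤⟨ n*maxRank≤ n m ⟩
    n + (2 * (n * l) + (4 + 4 * m)) ≤⟨ +-mono-≤ n≤ (+-mono-≤ (*-monoʳ-≤ 2 nl≤Q) (+-monoʳ-≤ 4 (*-monoʳ-≤ 4 m≤P))) ⟩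
    1 + Q + (2 * Q + (4 + 4 * P)) ≡⟨ sol P Q ⟩
    5 + 3 * Q + 4 * P ∎
    where
    sol : ∀ P Q → 1 + Q + (2 * Q + (4 + 4 * P)) ≡ 5 + 3 * Q + 4 * P
    sol = solve-∀
  nnr≤ : n * (n * r) ≤ 5 + 8 * Q + 4 * P
  nnr≤ = begin
    n * (n * r) ≤⟨ *-monoʳ-≤ n (n*maxRank≤ n m) ⟩
    n * (n + (2 * (n * l) + (4 + 4 * m))) ≡⟨ sol n m (n * l) ⟩
    n * n + (2 * Q + (4 * n + 4 * P)) ≤⟨ +-mono-≤ nn≤ (+-monoʳ-≤ (2 * Q) (+-monoˡ-≤ (4 * P) (*-monoʳ-≤ 4 n≤))) ⟩
    1 + 2 * Q + (2 * Q + (4 * (1 + Q) + 4 * P)) ≡⟨ sol′ P Q ⟩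
    5 + 8 * Q + 4 * P ∎
    where
    sol : ∀ n m k → n * (n + (2 * k + (4 + 4 * m))) ≡ n * n + (2 * (n * k) + (4 * n + 4 * (n * m)))
    sol = solve-∀
    sol′ : ∀ P Q → 1 + 2 * Q + (2 * Q + (4 * (1 + Q) + 4 * P)) ≡ 5 + 8 * Q + 4 * P
    sol′ = solve-∀
  solved : ∀ n m r → 2 + 6 * m + n * (50 + 10 * r + (60 * n + 30 * (n * r) + 110 * m)) ≡
           2 + 6 * m + (50 * n + (10 * (n * r) + (60 * (n * n) + (30 * (n * (n * r)) + 110 * (n * m)))))
  solved = solve-∀
  solved′ : ∀ P Q → 2 + 6 * P + (50 * (1 + Q) + (10 * (5 + 3 * Q + 4 * P) + (60 * (1 + 2 * Q) + (30 * (5 + 8 * Q + 4 * P) + 110 * P)))) + (128 + 164 * P) ≡ 440 * suc (P + Q)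
  solved′ = solve-∀

-- The program

infix 9 _‼_ _‼ᵍ_ _‼ˡ_
_‼_ : ℕ → Expr nat → Expr nat
_‼ᵍ_ : ℕ → Expr nat → Expr grp
_‼ˡ_ : ℕ → Expr nat → Expr len
k ‼ i = k [ i ]
k ‼ᵍ i = k [ i ]
k ‼ˡ i = k [ i ]

var : ℕ → Expr nat
var k = k ‼ lit 0

infix 4 _≔_
_≔_ : ∀ {s} → ℕ → Expr s → Program
k ≔ e = k [ lit 0 ]≔ e

-- Arrays are numbered separately for each sort.  Names in V are variables,
-- kept in cell 0 of an array, and names in O are arrays of the output.
-- The nodes of the heap are described by itemA, cntA, childA and sibA; nodeA
-- holds the current node of a vertex, stackA the roots, and slotA at r the
-- root of rank r during an extraction.

tailA  = 1
headA  = 2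
countO = 3
vertO  = 4
edgeO  = 5
fromA  = 7
toA    = 8
edgeA  = 9
nextA  = 10
firstA = 11
markA  = 12
depA   = 13
parA   = 14
itemA  = 20
cntA   = 21
childA = 22
sibA   = 23
nodeA  = 24
slotA  = 25
stackA = 26
tmpV   = 27
tmpE   = 28

spV    = 30
freshV = 31
maxrV  = 32
bestV  = 33
xV     = 34
yV     = 35
zV     = 36
rV     = 37
jV     = 38
uV     = 39
aV     = 40
vV     = 41
sV     = 42
naV    = 43
eV     = 44
foundV = 45
barcV  = 46
goV    = 47
bV     = 48
tV     = 49

labelA = 0
labA   = 1
gA     = 2
lengthA = 0
lenA   = 1
distA  = 2
minV   = 3
candV  = 4

nN mN one : Expr nat
nN = 0 ‼ lit 0
mN = 0 ‼ lit 1
one = lit 1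

fillArc : ℕ → ℕ → Expr grp → Program
fillArc src dst lab =
  fromA [ var naV ]≔ src ‼ var eV ⨾
  toA [ var naV ]≔ dst ‼ var eV ⨾
  edgeA [ var naV ]≔ var eV ⨾
  labA [ var naV ]≔ lab ⨾
  lenA [ var naV ]≔ lengthA ‼ˡ var eV

-- The counter is raised between the two writes, so that links hold the successors of arc numbers
-- and 0 ends a list.
chainArc : ℕ → Program
chainArc src =
  nextA [ var naV ]≔ firstA ‼ (src ‼ var eV) ⨾
  naV ≔ var naV +ⁿ one ⨾
  firstA [ src ‼ var eV ]≔ var naV

addArc : ℕ → ℕ → Expr grp → Program
addArc src dst lab = fillArc src dst lab ⨾ chainArc src

buildBody build : Program
buildBody =
  addArc tailA headA (labelA ‼ᵍ var eV) ⨾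
  addArc headA tailA (labelA ‼ᵍ var eV ⁻¹ᵍ) ⨾
  eV ≔ var eV +ⁿ one
build = while one +ⁿ var eV ≤ⁿ mN loop buildBody

key : ℕ → Expr len
key k = distA ‼ˡ (itemA ‼ var k ∸ⁿ one)

push : ℕ → Program
push k = stackA [ var spV ]≔ var k ⨾ spV ≔ var spV +ⁿ one

swap : ℕ → ℕ → Program
swap k k′ = zV ≔ var k ⨾ k ≔ var k′ ⨾ k′ ≔ var zV

pop : Program
pop = spV ≔ var spV ∸ⁿ one ⨾ xV ≔ stackA ‼ var spV

releaseInit releaseBody release : Program
releaseInit = jV ≔ cntA ‼ var xV ⨾ yV ≔ childA ‼ var xV
releaseBody = push yV ⨾ yV ≔ sibA ‼ var yV ⨾ jV ≔ var jV ∸ⁿ one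
release = releaseInit ⨾ while one ≤ⁿ var jV loop releaseBody

linkFetch linkCompare linkJoin linkBody placeEnd place : Program
linkFetch = yV ≔ slotA ‼ var rV ⨾ slotA [ var rV ]≔ lit 0
linkCompare = if key xV ≤ˡ key yV then skip else swap xV yV
linkJoin =
  sibA [ var yV ]≔ childA ‼ var xV ⨾
  childA [ var xV ]≔ var yV ⨾
  rV ≔ var rV +ⁿ one ⨾
  cntA [ var xV ]≔ var rV
linkBody = linkFetch ⨾ linkCompare ⨾ linkJoin
placeEnd =
  slotA [ var rV ]≔ var xV ⨾
  if var maxrV ≤ⁿ var rV then maxrV ≔ var rV else skip
place =
  -- Ranks are not stored: a node with an item has as many children as its rank.
  rV ≔ cntA ‼ var xV ⨾
  (while one ≤ⁿ slotA ‼ var rV loop linkBody) ⨾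
  placeEnd

consolidateBody consolidate : Program
consolidateBody = pop ⨾ (if itemA ‼ var xV ≤ⁿ lit 0 then release else place)
consolidate = maxrV ≔ lit 0 ⨾ while one ≤ⁿ var spV loop consolidateBody

collectFetch collectCompare collectTake collectBody collect : Program
collectFetch = xV ≔ slotA ‼ var rV ⨾ slotA [ var rV ]≔ lit 0
collectCompare = if key bestV ≤ˡ key xV then skip else swap bestV xV
collectTake =
  collectFetch ⨾
  (if var bestV ≤ⁿ lit 0 then bestV ≔ var xV else (collectCompare ⨾ push xV))
collectBody =
  (if slotA ‼ var rV ≤ⁿ lit 0 then skip else collectTake) ⨾
  rV ≔ var rV +ⁿ one
collect =
  (bestV ≔ lit 0 ⨾ rV ≔ lit 0) ⨾ while var rV ≤ⁿ var maxrV loop collectBody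

-- In `markA`, 0 stands for an unreached vertex, 1 for one whose item is in the heap and 2 for a
-- settled one.
attachLabel attachNode attach steal relaxInit relaxCase relax : Program
attachLabel =
  markA [ var vV ]≔ one ⨾
  distA [ var vV ]≔ candV ‼ˡ lit 0 ⨾
  gA [ var vV ]≔ gA ‼ᵍ var uV ∙ᵍ labA ‼ᵍ var bV ⨾
  depA [ var vV ]≔ depA ‼ var uV +ⁿ one ⨾
  parA [ var vV ]≔ var bV
attachNode =
  itemA [ var freshV ]≔ var vV +ⁿ one ⨾
  nodeA [ var vV ]≔ var freshV ⨾
  push freshV ⨾
  freshV ≔ var freshV +ⁿ one
attach = attachLabel ⨾ attachNode
steal =
  xV ≔ nodeA ‼ var vV ⨾
  itemA [ var xV ]≔ lit 0 ⨾
  (if lit 2 ≤ⁿ cntA ‼ var xV then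
    -- The sibling chain is not cut. The new node points into the middle of it, and the old node
    -- ends it by its count of 2.
    (cntA [ var freshV ]≔ cntA ‼ var xV ∸ⁿ lit 2 ⨾
     childA [ var freshV ]≔ sibA ‼ (sibA ‼ (childA ‼ var xV)) ⨾
     cntA [ var xV ]≔ lit 2)
   else cntA [ var freshV ]≔ lit 0)
relaxInit =
  bV ≔ var aV ∸ⁿ one ⨾
  vV ≔ toA ‼ var bV ⨾
  candV ≔ distA ‼ˡ var uV +ˡ lenA ‼ˡ var bV ⨾
  aV ≔ nextA ‼ var bV
relaxCase =
  if markA ‼ var vV ≤ⁿ lit 0 then (cntA [ var freshV ]≔ lit 0 ⨾ attach) else
  -- A settled head passes this test, as its distance is at most that of `uV` and lengths are
  -- nonnegative; so `steal` meets only vertices with an item.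
  if distA ‼ˡ var vV ≤ˡ candV ‼ˡ lit 0 then skip else (steal ⨾ attach)
relax = relaxInit ⨾ relaxCase

-- The extracted root is not removed. It goes back to the stack as a hollow root, and the next
-- `consolidate` replaces it by its children.
settle settleInit : Program
settleInit =
  uV ≔ itemA ‼ var bestV ∸ⁿ one ⨾
  itemA [ var bestV ]≔ lit 0 ⨾
  push bestV ⨾
  markA [ var uV ]≔ lit 2 ⨾
  aV ≔ firstA ‼ var uV
settle = settleInit ⨾ while one ≤ⁿ var aV loop relax

clear sourceLabel sourceNode dijkstraInit dijkstraBody dijkstra : Program
clear =
  vV ≔ lit 0 ⨾
  while one +ⁿ var vV ≤ⁿ nN loop (markA [ var vV ]≔ lit 0 ⨾ vV ≔ var vV +ⁿ one)
sourceLabel =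
  markA [ var sV ]≔ one ⨾
  distA [ var sV ]≔ 0ˡ ⨾
  gA [ var sV ]≔ εᵍ ⨾
  depA [ var sV ]≔ lit 0 ⨾
  goV ≔ one
sourceNode =
  nodeA [ var sV ]≔ one ⨾
  itemA [ one ]≔ var sV +ⁿ one ⨾
  cntA [ one ]≔ lit 0 ⨾
  stackA [ lit 0 ]≔ one ⨾
  spV ≔ one ⨾
  freshV ≔ lit 2
dijkstraInit = clear ⨾ sourceLabel ⨾ sourceNode
dijkstraBody =
  consolidate ⨾ collect ⨾
  (if var bestV ≤ⁿ lit 0 then goV ≔ lit 0 else settle)
dijkstra = dijkstraInit ⨾ while one ≤ⁿ var goV loop dijkstraBody

-- `foundV` and `minV` persist from one source to the next, whereas `barcV` is reset by each scan;
-- it is 0 or the successor of the last arc taken, and a cycle is written only in the latter case.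
take scanFetch scanTest scanCase scanBody scan : Program
take = foundV ≔ one ⨾ minV ≔ candV ‼ˡ lit 0 ⨾ barcV ≔ var bV +ⁿ one
scanFetch = uV ≔ fromA ‼ var bV ⨾ vV ≔ toA ‼ var bV
scanTest =
  if var foundV ≤ⁿ lit 0 then take else
  if minV ‼ˡ lit 0 ≤ˡ candV ‼ˡ lit 0 then skip else take
scanCase =
  if markA ‼ var uV ≤ⁿ lit 0 then skip else
  if gA ‼ᵍ var uV ∙ᵍ labA ‼ᵍ var bV ≈ᵍ gA ‼ᵍ var vV then skip else
    (candV ≔ lenA ‼ˡ var bV +ˡ (distA ‼ˡ var vV +ˡ distA ‼ˡ var uV) ⨾ scanTest)
scanBody = scanFetch ⨾ scanCase ⨾ bV ≔ var bV +ⁿ one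
scan =
  (bV ≔ lit 0 ⨾ barcV ≔ lit 0) ⨾ while one +ⁿ var bV ≤ⁿ var naV loop scanBody

-- The deeper end climbs. Depth is used since tree edges of length 0 do not change the distance. The
-- cycle runs from `xV` over the arc to `yV`, so the branch above `yV` is met in the order of the
-- output, while that above `xV` is met backwards and is kept in `tmpV` and `tmpE` until the
-- branches meet.
climbBody unwindBody extractInit extract : Program
climbBody =
  if depA ‼ var xV ≤ⁿ depA ‼ var yV then
    (vertO [ var jV ]≔ var yV ⨾
     edgeO [ var jV ]≔ edgeA ‼ (parA ‼ var yV) ⨾
     jV ≔ var jV +ⁿ one ⨾
     yV ≔ fromA ‼ (parA ‼ var yV))
  else
    (tmpV [ var tV ]≔ var xV ⨾
     tmpE [ var tV ]≔ edgeA ‼ (parA ‼ var xV) ⨾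
     tV ≔ var tV +ⁿ one ⨾
     xV ≔ fromA ‼ (parA ‼ var xV))
unwindBody =
  tV ≔ var tV ∸ⁿ one ⨾
  edgeO [ var jV ]≔ tmpE ‼ var tV ⨾
  jV ≔ var jV +ⁿ one ⨾
  vertO [ var jV ]≔ tmpV ‼ var tV
extractInit =
  bV ≔ var barcV ∸ⁿ one ⨾
  xV ≔ fromA ‼ var bV ⨾
  yV ≔ toA ‼ var bV ⨾
  vertO [ lit 0 ]≔ var xV ⨾
  edgeO [ lit 0 ]≔ edgeA ‼ var bV ⨾
  jV ≔ one ⨾
  tV ≔ lit 0
extract =
  if var barcV ≤ⁿ lit 0 then skip else
    (extractInit ⨾
     -- The sum of both truncated differences is positive just when the vertices differ.
     (while one ≤ⁿ (var xV ∸ⁿ var yV) +ⁿ (var yV ∸ⁿ var xV) loop climbBody) ⨾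
     vertO [ var jV ]≔ var yV ⨾
     (while one ≤ⁿ var tV loop unwindBody) ⨾
     countO ≔ var jV)

sourceBody program : Program
sourceBody = dijkstra ⨾ scan ⨾ extract ⨾ sV ≔ var sV +ⁿ one
program = build ⨾ while one +ⁿ var sV ≤ⁿ nN loop sourceBody

-- Hollow heaps

-- tree x it r C S is a tree with root x followed by its siblings S.  The item
-- it is 0 for hollow nodes and suc v for nodes that hold v.

data Forest : Set where
  ∅    : Forest
  tree : (x it r : ℕ) (C S : Forest) → Forest

count : Forest → ℕ
count ∅                = 0
count (tree x it r C S) = suc (count S)

-- The arguments are the number of a node, its item and the number of its children. The last one
-- matters for `pot` only.
Weight : Set
Weight = ℕ → ℕ → ℕ → ℕ

sum : Weight → Forest → ℕ
sum f ∅                 = 0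
sum f (tree x it r C S) = f x it (count C) + (sum f C + sum f S)

-- The potential of a hollow node pays for the release of its children: each
-- takes two ticks and becomes a root, which is worth ten.

occ has : ℕ → Weight
size pot : Weight
occ y x it k = δ y x
has v x it k = δ (suc v) it
size x it k = 1
pot x zero    k = 12 * k
pot x (suc _) k = 0

kids≤ : ∀ f {x it r} C S → sum f C ≤ sum f (tree x it r C S)
kids≤ f {x} {it} C S = ≤-trans (m≤m+n (sum f C) (sum f S)) (m≤n+m _ (f x it (count C)))

sibs≤ : ∀ f {x it r} C S → sum f S ≤ sum f (tree x it r C S)
sibs≤ f {x} {it} C S = ≤-trans (m≤n+m (sum f S) (sum f C)) (m≤n+m _ (f x it (count C)))

root∈ : ∀ {x it r} C S → 0 < sum (occ x) (tree x it r C S)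
root∈ {x} C S = ≤-trans (≤-reflexive (sym (δ-refl x))) (m≤m+n _ _)

-- The ranks descend from r - 1 without gaps but need not reach 0: a hollow node has lost the tail
-- of its list and still counts as a node of rank r.
data Ranks : ℕ → Forest → Set where
  []  : ∀ {r} → Ranks r ∅
  _∷_ : ∀ {r x it r′ C S} → r ≡ r′ → Ranks r S → Ranks (suc r) (tree x it r′ C S)

ranks-count : ∀ {r C} → Ranks r C → count C ≤ r
ranks-count []       = z≤n
ranks-count (_ ∷ rs) = s≤s (ranks-count rs)

AllN : ∀ {p} → (ℕ → ℕ → ℕ → Forest → Set p) → Forest → Set p
AllN P ∅                 = ⊤
AllN P (tree x it r C S) = P x it r C × AllN P C × AllN P S

AllN-map : ∀ {p q} {P : ℕ → ℕ → ℕ → Forest → Set p} {Q : ℕ → ℕ → ℕ → Forest → Set q} F →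
           (∀ {x it r C} → P x it r C → Q x it r C) → AllN P F → AllN Q F
AllN-map ∅ f _                              = tt
AllN-map (tree x it r C S) f (p , pC , pS) = f p , AllN-map C f pC , AllN-map S f pS

take₂ drop₂ : Forest → Forest
take₂ (tree x it r C (tree x′ it′ r′ C′ S)) = tree x it r C (tree x′ it′ r′ C′ ∅)
take₂ F                                     = F
drop₂ (tree x it r C (tree x′ it′ r′ C′ S)) = S
drop₂ F                                     = ∅

sum-split : ∀ f F → sum f (take₂ F) + sum f (drop₂ F) ≡ sum f F
sum-split f ∅ = refl
sum-split f (tree x it r C ∅) = +-identityʳ _
sum-split f (tree x it r C (tree x′ it′ r′ C′ S)) = begin
  (A + (B + (A′ + (B′ + 0)))) + s ≡⟨ +-assoc A _ s ⟩
  A + ((B + (A′ + (B′ + 0))) + s) ≡⟨ cong (A +_) (+-assoc B _ s) ⟩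
  A + (B + ((A′ + (B′ + 0)) + s)) ≡⟨ cong (λ z → A + (B + z)) (+-assoc A′ _ s) ⟩
  A + (B + (A′ + ((B′ + 0) + s))) ≡⟨ cong (λ z → A + (B + (A′ + (z + s)))) (+-identityʳ B′) ⟩
  A + (B + (A′ + (B′ + s)))       ∎
  where
  open ≡-Reasoning
  A = f x it (count C)
  B = sum f C
  A′ = f x′ it′ (count C′)
  B′ = sum f C′
  s = sum f S

count-take₂ : ∀ F → count (take₂ F) ≤ 2
count-take₂ ∅                                     = z≤n
count-take₂ (tree _ _ _ _ ∅)                      = s≤s z≤n
count-take₂ (tree _ _ _ _ (tree _ _ _ _ _))       = ≤-refl

-- `two` is what a hollow node retains and all that the size bound needs; `whole` makes the stored
-- count of a node with an item equal to its rank.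
record Shape (it r : ℕ) (C : Forest) : Set where
  field
    ranks : Ranks r C
    two   : 2 ⊓ r ≤ count C
    whole : it ≢ 0 → r ≤ count C

-- Even when hollow, a node of rank r + 2 has its children of ranks r + 1 and r. The weaker bound
-- `pow r` for each of them already gives `pow r + pow r`.
pow≤size : ∀ {it r} C → Shape it r C → AllN (λ _ → Shape) C → pow r ≤ suc (sum size C)
pow≤size {r = 0} C _ _ = s≤s z≤n
pow≤size {r = 1} C _ _ = s≤s z≤n
pow≤size {r = suc (suc r)} ∅ s _ with () ← Shape.two s
pow≤size {r = suc (suc r)} (tree _ _ _ _ ∅) s _ with s≤s () ← Shape.two s
pow≤size {r = suc (suc r)} (tree _ _ _ C (tree _ _ _ C′ S)) s (c , cs , c′ , cs′ , _)
  with refl ∷ (refl ∷ _) ← Shape.ranks s = begin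
    pow r + pow r ≤⟨ +-mono-≤ (≤-trans (pow-mono r) (pow≤size C c cs)) (pow≤size C′ c′ cs′) ⟩
    suc (sum size C) + suc (sum size C′)
      ≤⟨ s≤s (+-monoʳ-≤ (sum size C) (s≤s (m≤m+n _ _))) ⟩
    suc (sum size C + suc (sum size C′ + sum size S)) ≤⟨ n≤1+n _ ⟩
    suc (suc (sum size C + suc (sum size C′ + sum size S))) ∎
  where open ≤-Reasoning

record Cells : Set where
  constructor cells
  field item cnt child sib : ℕ → ℕ

record SameCell (A A′ : Cells) (y : ℕ) : Set where
  constructor same
  private
    module A = Cells A
    module A′ = Cells A′
  field
    item  : A.item y ≡ A′.item y
    cnt   : A.cnt y ≡ A′.cnt y
    child : A.child y ≡ A′.child y
    sib   : A.sib y ≡ A′.sib y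

-- Nothing is asked of the link behind the last tree, because the length of the list is known from
-- `cnt`. Hence both parts of a split list are linked without a write to `sib`.
Links : (ℕ → ℕ) → ℕ → Forest → Set
Links sib p ∅                 = ⊤
Links sib p (tree x it r C S) = p ≡ x × Links sib (sib x) S

Links-cong : ∀ {sib sib′ p} C → (∀ y → 0 < sum (occ y) C → sib y ≡ sib′ y) → Links sib p C → Links sib′ p C
Links-cong ∅ eq _ = tt
Links-cong {sib} {sib′} (tree x it r C S) eq (refl , l) = refl ,
  subst (λ q → Links sib′ q S) (eq x (root∈ {x} {it} {r} C S))
    (Links-cong S (λ y y∈S → eq y (≤-trans y∈S (sibs≤ (occ y) {x} {it} {r} C S))) l)

Links-take₂ : ∀ {sib p} C → Links sib p C → Links sib p (take₂ C)
Links-take₂ ∅ l = tt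
Links-take₂ (tree _ _ _ _ ∅) l = l
Links-take₂ (tree _ _ _ _ (tree _ _ _ _ S)) (p , q , l) = p , q , tt

Links-drop₂ : ∀ {sib p} C → 2 ≤ count C → Links sib p C → Links sib (sib (sib p)) (drop₂ C)
Links-drop₂ (tree _ _ _ _ ∅) (s≤s ()) l
Links-drop₂ (tree _ _ _ _ (tree _ _ _ _ S)) _ (refl , refl , l) = l

Ranks-take₂ : ∀ {r} C → Ranks r C → Ranks r (take₂ C)
Ranks-take₂ ∅ rs = rs
Ranks-take₂ (tree _ _ _ _ ∅) rs = rs
Ranks-take₂ (tree _ _ _ _ (tree _ _ _ _ S)) (e ∷ (e′ ∷ rs)) = e ∷ (e′ ∷ [])

Ranks-drop₂ : ∀ {r} C → Ranks r C → Ranks (r ∸ 2) (drop₂ C)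
Ranks-drop₂ ∅ rs = []
Ranks-drop₂ (tree _ _ _ _ ∅) rs = []
Ranks-drop₂ (tree _ _ _ _ (tree _ _ _ _ S)) (e ∷ (e′ ∷ rs)) = rs

count-drop₂ : ∀ C → count (drop₂ C) ≡ count C ∸ 2
count-drop₂ ∅ = refl
count-drop₂ (tree _ _ _ _ ∅) = refl
count-drop₂ (tree _ _ _ _ (tree _ _ _ _ S)) = refl

two-take₂ : ∀ r C → 2 ⊓ r ≤ count C → 2 ⊓ r ≤ count (take₂ C)
two-take₂ r ∅ p = p
two-take₂ r (tree _ _ _ _ ∅) p = p
two-take₂ r (tree _ _ _ _ (tree _ _ _ _ S)) p = m⊓n≤m 2 r

AllN-take₂ : ∀ {p} {P : ℕ → ℕ → ℕ → Forest → Set p} C → AllN P C → AllN P (take₂ C)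
AllN-take₂ ∅ a = a
AllN-take₂ (tree _ _ _ _ ∅) a = a
AllN-take₂ (tree _ _ _ _ (tree _ _ _ _ S)) (p , pC , p′ , pC′ , _) = p , pC , p′ , pC′ , tt

AllN-drop₂ : ∀ {p} {P : ℕ → ℕ → ℕ → Forest → Set p} C → AllN P C → AllN P (drop₂ C)
AllN-drop₂ ∅ a = tt
AllN-drop₂ (tree _ _ _ _ ∅) a = tt
AllN-drop₂ (tree _ _ _ _ (tree _ _ _ _ S)) (p , pC , p′ , pC′ , pS) = pS

-- Decreasing the key of v turns its node x into a hollow one, which keeps two
-- of its children C.

data Cut (v : ℕ) : Forest → ℕ → ℕ → Forest → Forest → Set where
  here : ∀ {x r C S} → Cut v (tree x (suc v) r C S) x r C (tree x 0 r (take₂ C) S)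
  down : ∀ {y it r′ D D′ S x r C} → Cut v D x r C D′ → Cut v (tree y it r′ D S) x r C (tree y it r′ D′ S)
  side : ∀ {y it r′ D S S′ x r C} → Cut v S x r C S′ → Cut v (tree y it r′ D S) x r C (tree y it r′ D S′)

cut : ∀ v F → 0 < sum (has v) F → ∃[ x ] ∃[ r ] ∃[ C ] ∃[ F′ ] Cut v F x r C F′
cut v (tree x it r C S) p with suc v ≟ it
... | yes refl = _ , _ , _ , _ , here
... | no neq with 0 <? sum (has v) C
... | yes q = let _ , _ , _ , _ , c = cut v C q in _ , _ , _ , _ , down c
... | no ¬q = let _ , _ , _ , _ , c = cut v S q in _ , _ , _ , _ , side c
  where
  q : 0 < sum (has v) S
  q = subst (0 <_) (trans (cong (_+ (sum (has v) C + sum (has v) S)) (δ-≢ neq))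
                          (cong (_+ sum (has v) S) (n≤0⇒n≡0 (≮⇒≥ ¬q)))) p

module _ {v : ℕ} where

  cut-count : ∀ {F x r C F′} → Cut v F x r C F′ → count F′ ≡ count F
  cut-count here     = refl
  cut-count (down c) = refl
  cut-count (side c) = cong suc (cut-count c)

  -- The cut takes `drop₂ C` out of the forest and changes the weight of the node x; nothing else
  -- moves. For `occ` and `has` this is conservation of nodes and items, for `pot` it is the cost of
  -- hollowing a node.
  cut-sum : ∀ {F x r C F′} f → Cut v F x r C F′ →
            sum f F′ + (f x (suc v) (count C) + sum f (drop₂ C)) ≡ sum f F + f x 0 (count (take₂ C))
  cut-sum {tree x _ r C S} f here = begin
    (h + (t + s)) + (g + d) ≡⟨ cong (_+ (g + d)) (+-comm h (t + s)) ⟩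
    ((t + s) + h) + (g + d) ≡⟨ cong₂ _+_ (cong (_+ h) (+-comm t s)) (+-comm g d) ⟩
    ((s + t) + h) + (d + g) ≡⟨ +-interchange (s + t) h d g ⟩
    ((s + t) + d) + (h + g) ≡⟨ cong₂ _+_ (+-assoc s t d) (+-comm h g) ⟩
    (s + (t + d)) + (g + h) ≡⟨ cong (λ z → (s + z) + (g + h)) (sum-split f C) ⟩
    (s + c) + (g + h)       ≡⟨ +-assoc (s + c) g h ⟨
    ((s + c) + g) + h       ≡⟨ cong (_+ h) (+-comm (s + c) g) ⟩
    (g + (s + c)) + h       ≡⟨ cong (λ z → (g + z) + h) (+-comm s c) ⟩
    (g + (c + s)) + h       ∎
    where
    open ≡-Reasoning
    h = f x 0 (count (take₂ C))
    t = sum f (take₂ C)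
    s = sum f S
    g = f x (suc v) (count C)
    d = sum f (drop₂ C)
    c = sum f C
  cut-sum {tree y it _ D S} {x} {C = C} {F′ = tree _ _ _ D′ _} f (down c) = begin
    (f y it (count D′) + (sum f D′ + s)) + q ≡⟨ cong (λ z → (f y it z + (sum f D′ + s)) + q) (cut-count c) ⟩
    (a + (sum f D′ + s)) + q ≡⟨ +-assoc a _ q ⟩
    a + ((sum f D′ + s) + q) ≡⟨ cong (λ z → a + (z + q)) (+-comm (sum f D′) s) ⟩
    a + ((s + sum f D′) + q) ≡⟨ cong (a +_) (+-assoc s _ q) ⟩
    a + (s + (sum f D′ + q)) ≡⟨ cong (λ z → a + (s + z)) (cut-sum f c) ⟩
    a + (s + (sum f D + h))  ≡⟨ cong (a +_) (+-assoc s _ h) ⟨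
    a + ((s + sum f D) + h)  ≡⟨ cong (λ z → a + (z + h)) (+-comm s (sum f D)) ⟩
    a + ((sum f D + s) + h)  ≡⟨ +-assoc a _ h ⟨
    (a + (sum f D + s)) + h  ∎
    where
    open ≡-Reasoning
    a = f y it (count D)
    s = sum f S
    q = f x (suc v) (count C) + sum f (drop₂ C)
    h = f x 0 (count (take₂ C))
  cut-sum {tree y it _ D S} {x} {C = C} {F′ = tree _ _ _ _ S′} f (side c) = begin
    (a + (d + sum f S′)) + q ≡⟨ +-assoc a _ q ⟩
    a + ((d + sum f S′) + q) ≡⟨ cong (a +_) (+-assoc d _ q) ⟩
    a + (d + (sum f S′ + q)) ≡⟨ cong (λ z → a + (d + z)) (cut-sum f c) ⟩
    a + (d + (sum f S + h))  ≡⟨ cong (a +_) (+-assoc d _ h) ⟨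
    a + ((d + sum f S) + h)  ≡⟨ +-assoc a _ h ⟨
    (a + (d + sum f S)) + h  ∎
    where
    open ≡-Reasoning
    a = f y it (count D)
    d = sum f D
    q = f x (suc v) (count C) + sum f (drop₂ C)
    h = f x 0 (count (take₂ C))

  cut-ranks : ∀ {F x r C F′ k} → Cut v F x r C F′ → Ranks k F → Ranks k F′
  cut-ranks here     (e ∷ rs) = e ∷ rs
  cut-ranks (down c) (e ∷ rs) = e ∷ rs
  cut-ranks (side c) (e ∷ rs) = e ∷ cut-ranks c rs

  cut-links : ∀ {F x r C F′ sib p} → Cut v F x r C F′ → Links sib p F → Links sib p F′
  cut-links here     (e , l) = e , l
  cut-links (down c) (e , l) = e , l
  cut-links (side c) (e , l) = e , cut-links c l

  cut-occ : ∀ {F x r C F′} → Cut v F x r C F′ → 0 < sum (occ x) F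
  cut-occ (here {x} {r} {C} {S}) = root∈ {x} {suc v} {r} C S
  cut-occ (down {y} {it} {r} {D} {S = S} {x = x} c) = ≤-trans (cut-occ c) (kids≤ (occ x) {y} {it} {r} D S)
  cut-occ (side {y} {it} {r} {D} {S} {x = x} c) = ≤-trans (cut-occ c) (sibs≤ (occ x) {y} {it} {r} D S)

  cut-node : ∀ {p} {P : ℕ → ℕ → ℕ → Forest → Set p} {F x r C F′} → Cut v F x r C F′ →
             AllN P F → P x (suc v) r C × AllN P C
  cut-node here     (p , pC , _) = p , pC
  cut-node (down c) (_ , pC , _) = cut-node c pC
  cut-node (side c) (_ , _ , pS) = cut-node c pS

module Nodes {c ℓ} {D : Set c} (_≼_ : Rel D ℓ) (≼-trans : Transitive _≼_) (n : ℕ) where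

  record Keys : Set c where
    constructor keys
    field
      node mark : ℕ → ℕ
      dist      : ℕ → D

  record SameKey (K K′ : Keys) (v : ℕ) : Set c where
    constructor same
    private
      module K = Keys K
      module K′ = Keys K′
    field
      node : K.node v ≡ K′.node v
      mark : K.mark v ≡ K′.mark v
      dist : K.dist v ≡ K′.dist v

  -- Heap order cannot relate a node to its parent, since hollow nodes have no key. It is therefore
  -- a bound on all items below a node, across hollow ones.
  LB : (ℕ → D) → D → Forest → Set ℓ
  LB dist b = AllN (λ x it r C → ∀ v → it ≡ suc v → b ≼ dist v)

  LB-trans : ∀ {dist b b′} F → b ≼ b′ → LB dist b′ F → LB dist b F
  LB-trans F b≼b′ = AllN-map F (λ p v eq → ≼-trans b≼b′ (p v eq))

  LB-lookup : ∀ {dist b v} F → 0 < sum (has v) F → LB dist b F → b ≼ dist v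
  LB-lookup {v = v} F v∈F lb =
    let _ , _ , _ , _ , c = cut v F v∈F in proj₁ (cut-node c lb) v refl

  LB-cut : ∀ {dist b v F x r C F′} → Cut v F x r C F′ → LB dist b F → LB dist b F′
  LB-cut (here {C = C}) (p , pC , pS) = (λ _ ()) , AllN-take₂ C pC , pS
  LB-cut (down c) (p , pC , pS) = p , LB-cut c pC , pS
  LB-cut (side c) (p , pC , pS) = p , pC , LB-cut c pS

  LB-cong : ∀ {dist dist′ b} F → (∀ w → 0 < sum (has w) F → dist w ≡ dist′ w) → LB dist b F → LB dist′ b F
  LB-cong ∅ eq _ = tt
  LB-cong {b = b} (tree x it r C S) eq (p , pC , pS) =
    (λ { v refl → subst (b ≼_) (eq v (≤-trans (≤-reflexive (sym (δ-refl v))) (m≤m+n _ _))) (p v refl) }) ,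
    LB-cong C (λ w w∈C → eq w (≤-trans w∈C (kids≤ (has w) {x} {it} {r} C S))) pC ,
    LB-cong S (λ w w∈S → eq w (≤-trans w∈S (sibs≤ (has w) {x} {it} {r} C S))) pS

  record Node (A : Cells) (K : Keys) (x it r : ℕ) (C : Forest) : Set ℓ where
    open Cells A
    open Keys K
    field
      item≡ : item x ≡ it
      cnt≡  : cnt x ≡ count C
      links : Links sib (child x) C
      shape : Shape it r C
      order : ∀ v → it ≡ suc v → LB dist (dist v) C
      full  : ∀ v → it ≡ suc v → v < n × mark v ≡ 1 × node v ≡ x

  nodes-cells : ∀ {A A′ K} F → (∀ y → 0 < sum (occ y) F → SameCell A A′ y) →
                AllN (Node A K) F → AllN (Node A′ K) F
  nodes-cells ∅ eq _ = tt
  nodes-cells {A} {A′} (tree x it r C S) eq (p , pC , pS) =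
    record
      { item≡ = trans (sym (SameCell.item x≡)) (Node.item≡ p)
      ; cnt≡  = trans (sym (SameCell.cnt x≡)) (Node.cnt≡ p)
      ; links = subst (λ q → Links (Cells.sib A′) q C) (SameCell.child x≡)
                  (Links-cong C (λ y y∈C → SameCell.sib (eqC y y∈C)) (Node.links p))
      ; shape = Node.shape p
      ; order = Node.order p
      ; full  = Node.full p
      } ,
    nodes-cells C eqC pC ,
    nodes-cells S (λ y y∈S → eq y (≤-trans y∈S (sibs≤ (occ y) {x} {it} {r} C S))) pS
    where
    x≡ = eq x (root∈ {x} {it} {r} C S)
    eqC : ∀ y → 0 < sum (occ y) C → SameCell A A′ y
    eqC y y∈C = eq y (≤-trans y∈C (kids≤ (occ y) {x} {it} {r} C S))

  nodes-keys : ∀ {A K K′} F → (∀ w → 0 < sum (has w) F → SameKey K K′ w) →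
               AllN (Node A K) F → AllN (Node A K′) F
  nodes-keys ∅ eq _ = tt
  nodes-keys {A} {K} {K′} (tree x it r C S) eq (p , pC , pS) =
    record
      { item≡ = Node.item≡ p
      ; cnt≡  = Node.cnt≡ p
      ; links = Node.links p
      ; shape = Node.shape p
      ; order = λ { v refl → LB-cong C (λ w w∈C → SameKey.dist (eqC w w∈C))
                      (subst (λ b → LB (Keys.dist K) b C) (SameKey.dist (v≡ v refl)) (Node.order p v refl)) }
      ; full  = λ v it≡ → let v<n , mark≡ , node≡ = Node.full p v it≡ in
                  v<n , trans (sym (SameKey.mark (v≡ v it≡))) mark≡ , trans (sym (SameKey.node (v≡ v it≡))) node≡
      } ,
    nodes-keys C eqC pC ,
    nodes-keys S (λ w w∈S → eq w (≤-trans w∈S (sibs≤ (has w) {x} {it} {r} C S))) pS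
    where
    v≡ : ∀ v → it ≡ suc v → SameKey K K′ v
    v≡ v refl = eq v (≤-trans (≤-reflexive (sym (δ-refl v))) (m≤m+n _ _))
    eqC : ∀ w → 0 < sum (has w) C → SameKey K K′ w
    eqC w w∈C = eq w (≤-trans w∈C (kids≤ (has w) {x} {it} {r} C S))

  -- The node x occurs once, at the place of the cut, so the altered cells of x belong to no other
  -- node: in each case a second occurrence would raise the count above 1.
  nodes-cut : ∀ {A A′ K v F x r C F′} → Cut v F x r C F′ → sum (occ x) F ≤ 1 →
              (∀ y → 0 < sum (occ y) F → y ≢ x → SameCell A A′ y) →
              Cells.item A′ x ≡ 0 → Cells.cnt A′ x ≡ count (take₂ C) →
              Cells.child A x ≡ Cells.child A′ x → Cells.sib A ≡ Cells.sib A′ →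
              AllN (Node A K) F → AllN (Node A′ K) F′
  nodes-cut {A} {A′} {K} {v} {x = x} {r} {C} (here {S = S}) once eq item≡ cnt≡ child≡ refl (p , pC , pS) =
    record
      { item≡ = item≡
      ; cnt≡  = cnt≡
      ; links = Links-take₂ C (subst (λ q → Links (Cells.sib A′) q C) child≡ (Node.links p))
      ; shape = record
          { ranks = Ranks-take₂ C (Shape.ranks (Node.shape p))
          ; two   = two-take₂ r C (Shape.two (Node.shape p))
          ; whole = λ 0≢0 → ⊥-elim (0≢0 refl)
          }
      ; order = λ _ ()
      ; full  = λ _ ()
      } ,
    AllN-take₂ C (nodes-cells C (λ y y∈C →
      eq y (≤-trans y∈C (kids≤ (occ y) {x} {suc v} {r} C S))
           (λ { refl → <-irrefl refl (<-≤-trans (≤-trans y∈C (m≤m+n _ _)) rest) })) pC) ,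
    nodes-cells S (λ y y∈S →
      eq y (≤-trans y∈S (sibs≤ (occ y) {x} {suc v} {r} C S))
           (λ { refl → <-irrefl refl (<-≤-trans (≤-trans y∈S (m≤n+m _ (sum (occ x) C))) rest) })) pS
    where
    rest : sum (occ x) C + sum (occ x) S ≤ 0
    rest = ≤-pred (subst (λ d → d + (sum (occ x) C + sum (occ x) S) ≤ 1) (δ-refl x) once)
  nodes-cut {A} {A′} {K} {v} {x = x} (down {y} {it} {r′} {D} {D′} {S} c) once eq item≡ cnt≡ child≡ refl (p , pD , pS) =
    record
      { item≡ = trans (sym (SameCell.item y≡)) (Node.item≡ p)
      ; cnt≡  = trans (sym (SameCell.cnt y≡)) (trans (Node.cnt≡ p) (sym (cut-count c)))
      ; links = cut-links c (subst (λ q → Links (Cells.sib A′) q D) (SameCell.child y≡) (Node.links p))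
      ; shape = record
          { ranks = cut-ranks c (Shape.ranks (Node.shape p))
          ; two   = subst (_ ≤_) (sym (cut-count c)) (Shape.two (Node.shape p))
          ; whole = λ f → subst (_ ≤_) (sym (cut-count c)) (Shape.whole (Node.shape p) f)
          }
      ; order = λ w it≡ → LB-cut c (Node.order p w it≡)
      ; full  = Node.full p
      } ,
    nodes-cut c (≤-trans (kids≤ (occ x) {y} {it} {r′} D S) once)
      (λ z z∈D → eq z (≤-trans z∈D (kids≤ (occ z) {y} {it} {r′} D S))) item≡ cnt≡ child≡ refl pD ,
    nodes-cells S (λ z z∈S →
      eq z (≤-trans z∈S (sibs≤ (occ z) {y} {it} {r′} D S))
           (λ { refl → <⇒≱ (<-≤-trans (+-mono-≤ (cut-occ c) z∈S) (m≤n+m _ (δ x y))) once })) pS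
    where
    y≢x : y ≢ x
    y≢x refl = <⇒≱ (+-mono-≤ (≤-reflexive (sym (δ-refl x))) (≤-trans (cut-occ c) (m≤m+n _ (sum (occ x) S)))) once
    y≡ = eq y (root∈ {y} {it} {r′} D S) y≢x
  nodes-cut {A} {A′} {K} {v} {x = x} (side {y} {it} {r′} {D} {S} {S′} c) once eq item≡ cnt≡ child≡ refl (p , pD , pS) =
    proj₁ kept , proj₁ (proj₂ kept) ,
    nodes-cut c (≤-trans (sibs≤ (occ x) {y} {it} {r′} D S) once)
      (λ z z∈S → eq z (≤-trans z∈S (sibs≤ (occ z) {y} {it} {r′} D S))) item≡ cnt≡ child≡ refl pS
    where
    kept = nodes-cells {A} {A′} {K} (tree y it r′ D ∅) (λ z z∈ →
      eq z (≤-trans z∈ (+-monoʳ-≤ (δ z y) (+-monoʳ-≤ (sum (occ z) D) z≤n)))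
        (λ { refl → <⇒≱ (≤-trans (+-mono-≤ z∈ (cut-occ c)) (≤-reflexive (assoc (δ z y) _ _))) once }))
      (p , pD , tt)
      where
      assoc : ∀ a b c → (a + (b + 0)) + c ≡ a + (b + c)
      assoc a b c = trans (+-assoc a (b + 0) c) (cong (λ z → a + (z + c)) (+-identityʳ b))

  -- Both roots have rank r, so the one with the larger key, put before the children of ranks r - 1,
  -- r - 2, ..., makes the other a node of rank r + 1.
  node-link : ∀ {A A′ K x v r C y w D} → Node A K x (suc v) r C → Node A K y (suc w) r D →
              Keys.dist K v ≼ Keys.dist K w →
              Links (Cells.sib A′) (Cells.sib A′ y) C →
              Cells.item A x ≡ Cells.item A′ x → Cells.cnt A′ x ≡ suc r → Cells.child A′ x ≡ y →
              Node A′ K x (suc v) (suc r) (tree y (suc w) r D C)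
  node-link {v = v} {C = C} {w = w} {D} p q v≼w links item≡ cnt≡ child≡ = record
    { item≡ = trans (sym item≡) (Node.item≡ p)
    ; cnt≡  = trans cnt≡ (cong suc (≤-antisym (Shape.whole (Node.shape p) (λ ()))
                                              (ranks-count (Shape.ranks (Node.shape p)))))
    ; links = child≡ , links
    ; shape = record
        { ranks = refl ∷ Shape.ranks (Node.shape p)
        ; two   = ≤-trans (m⊓n≤n 2 _) (s≤s (Shape.whole (Node.shape p) (λ ())))
        ; whole = λ _ → s≤s (Shape.whole (Node.shape p) (λ ()))
        }
    ; order = λ { _ refl → (λ { _ refl → v≼w }) , LB-trans D v≼w (Node.order q w refl) , Node.order p v refl }
    ; full  = Node.full p
    }

-- Stacks, lists and unsettled vertices in memory

flat : (ℕ → ℕ → ℕ) → Weight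
flat g x it _ = g x it

override-same : ∀ {a} {A : Set a} k i {v : A} {f} → override k i v f k i ≡ v
override-same k i {v} = override-elim (_≡ v) k i i (λ _ → refl) (λ i≢i → ⊥-elim (i≢i refl))

override-at : ∀ {a} {A : Set a} k {i j} {v : A} {f} → i ≡ j → override k i v f k j ≡ v
override-at k {i} refl = override-same k i

override-other : ∀ {a} {A : Set a} k i {v : A} {f} j → j ≢ i → override k i v f k j ≡ f k j
override-other k i {f = f} j j≢i = override-elim (_≡ f k j) k i j (λ i≡j → ⊥-elim (j≢i (sym i≡j))) (λ _ → refl)

Stack : (ℕ → ℕ) → ℕ → Forest → Set
Stack st p ∅                 = p ≡ 0
Stack st p (tree x it r C S) = ∃[ q ] (p ≡ suc q × st q ≡ x × Stack st q S)

stack-cong : ∀ {st st′ p} F → (∀ i → i < p → st′ i ≡ st i) → Stack st p F → Stack st′ p F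
stack-cong ∅ eq s = s
stack-cong (tree x it r C S) eq (q , refl , x≡ , s) =
  q , refl , trans (eq q ≤-refl) x≡ , stack-cong S (λ i i<q → eq i (m<n⇒m<1+n i<q)) s

-- A slot holds only a root with an item: hollow roots are dissolved into their children before they
-- could be placed.
data Slot (s r : ℕ) : Forest → Set where
  empty : s ≡ 0 → Slot s r ∅
  holds : ∀ {x v C} → s ≡ x → 0 < x → Slot s r (tree x (suc v) r C ∅)

slot-empty : ∀ {s r F} → s ≡ 0 → Slot s r F → F ≡ ∅
slot-empty s≡0 (empty _) = refl
slot-empty refl (holds refl ())

Chained : (ℕ → ℕ) → ℕ → List ℕ → Set
Chained next p []       = p ≡ 0
Chained next p (a ∷ as) = p ≡ suc a × Chained next (next a) as

-- The indicator of the marks 0 and 1, that is of vertices not yet settled. Each is settled at most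
-- once in the future, so `openSum n w` bounds what is still to come if settling v costs w v.
open₀ : ℕ → ℕ
open₀ 0             = 1
open₀ 1             = 1
open₀ (suc (suc _)) = 0

openSum : ℕ → (ℕ → ℕ) → (ℕ → ℕ) → ℕ
openSum n w mark = sumTo n (λ v → open₀ (mark v) * w v)

openSum-settle : ∀ n w {mark mark′} u → u < n → mark u ≡ 1 → mark′ u ≡ 2 → (∀ v → v ≢ u → mark′ v ≡ mark v) →
                 openSum n w mark′ + w u ≡ openSum n w mark
openSum-settle n w {mark} {mark′} u u<n mark≡ mark′≡ unchanged = begin
  openSum n w mark′ + w u ≡⟨ cong (openSum n w mark′ +_) (trans (cong (λ k → open₀ k * w u) mark≡) (+-identityʳ (w u))) ⟨
  openSum n w mark′ + open₀ (mark u) * w u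
    ≡⟨ sumTo-change n u u<n (λ v u≢v → cong (λ k → open₀ k * w v) (unchanged v (λ eq → u≢v (sym eq)))) ⟩
  openSum n w mark + open₀ (mark′ u) * w u ≡⟨ cong (λ k → openSum n w mark + open₀ k * w u) mark′≡ ⟩
  openSum n w mark + 0 ≡⟨ +-identityʳ _ ⟩
  openSum n w mark ∎
  where open ≡-Reasoning

count-small : ∀ C → count C < 2 → take₂ C ≡ C × drop₂ C ≡ ∅
count-small ∅ _ = refl , refl
count-small (tree _ _ _ _ ∅) _ = refl , refl
count-small (tree _ _ _ _ (tree _ _ _ _ _)) (s≤s (s≤s ()))

count-take₂≡2 : ∀ C → 2 ≤ count C → count (take₂ C) ≡ 2
count-take₂≡2 (tree _ _ _ _ ∅) (s≤s ())
count-take₂≡2 (tree _ _ _ _ (tree _ _ _ _ _)) _ = refl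

openSum-≤ : ∀ n w mark → openSum n w mark ≤ sumTo n w
openSum-≤ zero    w mark = z≤n
openSum-≤ (suc n) w mark = +-mono-≤ (≤-trans (*-monoˡ-≤ (w n) (open₀≤1 (mark n))) (≤-reflexive (+-identityʳ (w n)))) (openSum-≤ n w mark)
  where
  open₀≤1 : ∀ k → open₀ k ≤ 1
  open₀≤1 0             = ≤-refl
  open₀≤1 1             = ≤-refl
  open₀≤1 (suc (suc k)) = z≤n

sumTo-* : ∀ n k f → sumTo n (λ i → k * f i) ≡ k * sumTo n f
sumTo-* zero    k f = sym (*-zeroʳ k)
sumTo-* (suc n) k f = trans (cong (k * f n +_) (sumTo-* n k f)) (sym (*-distribˡ-+ k (f n) (sumTo n f)))

unique-insert : ∀ {a} {A : Set a} {z : A} xs {ys} → Unique (xs ++ ys) → z ∉ xs → z ∉ ys → Unique (xs ++ z ∷ ys)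
unique-insert [] u _ z∉ys = All.tabulate (λ { z∈ refl → z∉ys z∈ }) ∷ u
unique-insert {z = z} (x ∷ xs) (x∉ ∷ u) z∉xs z∉ys =
  All.++⁺ (All.++⁻ˡ xs x∉) ((λ { refl → z∉xs (here refl) }) ∷ All.++⁻ʳ xs x∉) ∷
  unique-insert xs u (λ z∈ → z∉xs (there z∈)) z∉ys

Prefix : ∀ {k} → (ℕ → ℕ) → ℕ → List (Fin k) → Set
Prefix f i []       = ⊤
Prefix f i (x ∷ xs) = f i ≡ toℕ x × Prefix f (suc i) xs

prefix-cong : ∀ {k f f′} i (xs : List (Fin k)) → (∀ j → j < i + length xs → f′ j ≡ f j) → Prefix f i xs → Prefix f′ i xs
prefix-cong i []       eq p        = tt
prefix-cong i (x ∷ xs) eq (p , ps) = trans (eq i (m<m+n i (s≤s z≤n))) p ,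
  prefix-cong (suc i) xs (λ j j< → eq j (subst (j <_) (sym (+-suc i (length xs))) j<)) ps

prefix-snoc : ∀ {k f} i (xs : List (Fin k)) {v} → f (i + length xs) ≡ toℕ v → Prefix f i xs → Prefix f i (xs ++ v ∷ [])
prefix-snoc {f = f} i []       {v} eq p        = trans (cong f (sym (+-identityʳ i))) eq , tt
prefix-snoc {f = f} i (x ∷ xs) {v} eq (p , ps) = p , prefix-snoc (suc i) xs (trans (cong f (sym (+-suc i (length xs)))) eq) ps

prefix-write : ∀ {k} a {f : ℕ → ℕ → ℕ} {v} (xs : List (Fin k)) {x} {i} → i ≡ length xs → v ≡ toℕ x → Prefix (f a) 0 xs →
               Prefix (override a i v f a) 0 (xs ++ x ∷ [])
prefix-write a {f} {v} xs {i = i} refl v≡ p = prefix-snoc 0 xs (trans (override-same a i) v≡)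
  (prefix-cong 0 xs (λ j j< → override-other a i j (<⇒≢ j<)) p)

prefix-lookup : ∀ {k f} i (xs : List (Fin k)) → Prefix f i xs → ∀ j → f (i + toℕ j) ≡ toℕ (lookup xs j)
prefix-lookup {f = f} i (x ∷ xs) (p , ps) fzero    = trans (cong f (+-identityʳ i)) p
prefix-lookup {f = f} i (x ∷ xs) (p , ps) (fsuc j) = trans (cong f (+-suc i (toℕ j))) (prefix-lookup (suc i) xs ps j)

-- The head of the list is the cell written last, so climbing a tree path, which prepends a vertex
-- to the path below it, is a push.
Pile : ∀ {k} → (ℕ → ℕ) → ℕ → List (Fin k) → Set
Pile f t []       = t ≡ 0
Pile f t (x ∷ xs) = ∃[ t′ ] (t ≡ suc t′ × f t′ ≡ toℕ x × Pile f t′ xs)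

pile-cong : ∀ {k f f′ t} (xs : List (Fin k)) → (∀ i → i < t → f′ i ≡ f i) → Pile f t xs → Pile f′ t xs
pile-cong []       eq p = p
pile-cong (x ∷ xs) eq (t , refl , x≡ , p) = t , refl , trans (eq t ≤-refl) x≡ , pile-cong xs (λ i i<t → eq i (m<n⇒m<1+n i<t)) p

pile-write : ∀ {k} a {f : ℕ → ℕ → ℕ} {v} (xs : List (Fin k)) {x} {t} → v ≡ toℕ x → Pile (f a) t xs →
             Pile (override a t v f a) (t + 1) (x ∷ xs)
pile-write a xs {t = t} v≡ p = t , +-comm t 1 , trans (override-same a t) v≡ , pile-cong xs (λ i i<t → override-other a t i (<⇒≢ i<t)) p

table-toℕ : ∀ {a} {A : Set a} {k} (d : A) (f : Fin k → A) i → table d f (toℕ i) ≡ f i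
table-toℕ {k = k} d f i with toℕ i <? k
... | yes p = cong f (fromℕ<-toℕ i p)
... | no ¬p = ⊥-elim (¬p (toℕ<n i))

chained-cong : ∀ {next next′ p} as → (∀ {a} → a ∈ as → next′ a ≡ next a) → Chained next p as → Chained next′ p as
chained-cong []       eq p≡ = p≡
chained-cong {next′ = next′} (a ∷ as) eq (p≡ , c) = p≡ ,
  subst (λ p → Chained next′ p as) (sym (eq (here refl))) (chained-cong as (λ a∈ → eq (there a∈)) c)

module _ {a₁ a₂ ℓ₀ ℓ₁ ℓ₂} (Γ : Group a₁ a₂) (_≟ᵍ_ : Decidable (Group._≈_ Γ)) (L : OrderedField ℓ₀ ℓ₁ ℓ₂) where
  open Machine Γ _≟ᵍ_ L
  private
    module Γ = Group Γ
    module L = OrderedField L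
    module LO = IsDecTotalOrder L.isDecTotalOrder
    open GroupProperties Γ using (∙-cancelʳ; identityʳ-unique)

  -- Executions

  frame : ∀ {P σ τ t} s k → ⟨ P , σ ⟩⇓⟨ t , τ ⟩ → T (keeps s k P) → read s τ k ≡ read s σ k
  frame s k skip⇓ _ = refl
  frame nat k (assign⇓ {nat} {k′}) p = override-array k′ _ k (≢ᵇ⇒≢ k′ k p)
  frame nat k (assign⇓ {grp})      p = refl
  frame nat k (assign⇓ {len})      p = refl
  frame grp k (assign⇓ {nat})      p = refl
  frame grp k (assign⇓ {grp} {k′}) p = override-array k′ _ k (≢ᵇ⇒≢ k′ k p)
  frame grp k (assign⇓ {len})      p = refl
  frame len k (assign⇓ {nat})      p = refl
  frame len k (assign⇓ {grp})      p = refl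
  frame len k (assign⇓ {len} {k′}) p = override-array k′ _ k (≢ᵇ⇒≢ k′ k p)
  frame s k (seq⇓ x y) p = trans (frame s k y (T-∧ʳ p)) (frame s k x (T-∧ˡ p))
  frame s k (then⇓ _ x) p = frame s k x (T-∧ˡ p)
  frame s k (else⇓ {P = P} _ x) p = frame s k x (T-∧ʳ {keeps s k P} p)
  frame s k (loop⇓ _ x y) p = trans (frame s k y p) (frame s k x p)
  frame s k (exit⇓ _) p = refl

  -- The index of the postcondition is the time in ticks, up to rounding.

  record Run {q} (P : Program) (σ : Store) (Q : ℕ → Store → Set q) : Set (a₁ ⊔ ℓ₀ ⊔ q) where
    constructor run
    field
      {time}  : ℕ
      {final} : Store
      ticks   : ℕ
      exec    : ⟨ P , σ ⟩⇓⟨ time , final ⟩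
      bound   : time ≤ tick * ticks
      post    : Q ticks final

  record Framed (P : Program) (σ τ : Store) : Set (a₁ ⊔ ℓ₀) where
    field
      nats≡ : ∀ k → {T (keeps nat k P)} → nats τ k ≡ nats σ k
      grps≡ : ∀ k → {T (keeps grp k P)} → grps τ k ≡ grps σ k
      lens≡ : ∀ k → {T (keeps len k P)} → lens τ k ≡ lens σ k

  run-framed : ∀ {q P σ} {Q : ℕ → Store → Set q} → Run P σ Q → Run P σ (λ j τ → Q j τ × Framed P σ τ)
  run-framed (run j x bnd p) = run j x bnd (p , record
    { nats≡ = λ k {u} → frame nat k x u
    ; grps≡ = λ k {u} → frame grp k x u
    ; lens≡ = λ k {u} → frame len k x u })

  run-map : ∀ {q r P σ} {Q : ℕ → Store → Set q} {R : ℕ → Store → Set r} →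
            (∀ {j τ} → Q j τ → R j τ) → Run P σ Q → Run P σ R
  run-map f (run j x bnd p) = run j x bnd (f p)

  run-seq : ∀ {q P P′ σ} {Q : ℕ → Store → Set q} →
            Run P σ (λ j τ → Run P′ τ (λ j′ → Q (j + j′))) → Run (P ⨾ P′) σ Q
  run-seq (run j x bnd (run j′ y bnd′ p)) =
    run (j + j′) (seq⇓ x y) (≤-trans (+-mono-≤ bnd bnd′) (≤-reflexive (sym (*-distribˡ-+ tick j j′)))) p

  tick-suc : ∀ {c t j} → T (c ≤ᵇ tick) → t ≤ tick * j → c + t ≤ tick * suc j
  tick-suc {c} {t} {j} p q = ≤-trans (+-mono-≤ (≤ᵇ⇒≤ c tick p) q) (≤-reflexive (sym (*-suc tick j)))

  run-if : ∀ {q B P P′ σ} {Q : ℕ → Store → Set q} → {T (testCost B ≤ᵇ tick)} →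
           (test B σ ≡ true → Run P σ (λ j → Q (suc j))) →
           (test B σ ≡ false → Run P′ σ (λ j → Q (suc j))) →
           Run (if B then P else P′) σ Q
  run-if {B = B} {σ = σ} {_} {cost} f g with test B σ in eq
  ... | true  = let run j x bnd p = f refl in run (suc j) (then⇓ eq x) (tick-suc {testCost B} cost bnd) p
  ... | false = let run j x bnd p = g refl in run (suc j) (else⇓ eq x) (tick-suc {testCost B} cost bnd) p

  -- The index of the invariant is the number of ticks that the remaining
  -- iterations may take.

  run-while : ∀ {q B P σ} (Inv : ℕ → Store → Set q) {k} → {T (testCost B ≤ᵇ tick)} →
              (∀ {k τ} → test B τ ≡ true → Inv k τ →
                 Run P τ (λ j υ → ∃[ k′ ] (Inv k′ υ × suc (j + k′) ≤ k))) →
              Inv k σ →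
              Run (while B loop P) σ
                  (λ j τ → ∃[ k′ ] (Inv k′ τ × test B τ ≡ false × j + k′ ≤ suc k))
  run-while {B = B} {P} Inv {k} {cost} body inv = go k ≤-refl inv
    where
    -- Termination and the time bound have the same source: an iteration lowers the budget by at
    -- least the tick of its test, so recursion on a bound n of the budget is structural.
    go : ∀ {k σ} n → k ≤ n → Inv k σ → Run (while B loop P) σ
           (λ j τ → ∃[ k′ ] (Inv k′ τ × test B τ ≡ false × j + k′ ≤ suc k))
    go {k} {σ} n k≤n inv with test B σ in eq
    ... | false = run 1 (exit⇓ eq) (≤ᵇ⇒≤ (testCost B) _ cost) (k , inv , eq , ≤-refl)
    go {k} {σ} n k≤n inv | true with body eq inv
    go {k} zero k≤n inv | true | run j x bnd (k′ , inv′ , le) =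
      ⊥-elim (n≮0 (≤-trans le k≤n))
    go {k} (suc n) k≤n inv | true | run j x bnd (k′ , inv′ , le)
      with go n (≤-pred (≤-trans (≤-trans (s≤s (m≤n+m k′ j)) le) k≤n)) inv′
    ... | run j′ y bnd′ (k″ , inv″ , eq′ , le′) =
      run (suc (j + j′)) (loop⇓ eq x y)
          (tick-suc {testCost B} cost (≤-trans (+-mono-≤ bnd bnd′) (≤-reflexive (sym (*-distribˡ-+ tick j j′)))))
          (k″ , inv″ , eq′ , s≤s (begin
            (j + j′) + k″ ≡⟨ +-assoc j j′ k″ ⟩
            j + (j′ + k″) ≤⟨ +-monoʳ-≤ j le′ ⟩
            j + suc k′    ≡⟨ +-suc j k′ ⟩
            suc (j + k′)  ≤⟨ le ⟩
            k ∎))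
      where open ≤-Reasoning

  -- As it mentions the store only once, the goals below stay small while it
  -- is not unfolded.

  assign : ∀ {s} → ℕ → Expr nat → Expr s → Store → Store
  assign {s} k i e σ = write s k (eval i σ) (eval e σ) σ

  -- Weakest preconditions of programs without loops; here the index of the
  -- postcondition is the exact time.

  wp : ∀ {q} → Program → (ℕ → Store → Set q) → Store → Set q
  wp skip                     Q σ = Q 0 σ
  wp (k [ i ]≔ e)             Q σ = Q (suc (exprCost i + exprCost e)) (assign k i e σ)
  wp (P ⨾ P′)                 Q σ = wp P (λ t → wp P′ (λ u → Q (t + u))) σ
  wp (if B then P else P′)    Q σ = (test B σ ≡ true → wp P (λ t → Q (testCost B + t)) σ)
                                  × (test B σ ≡ false → wp P′ (λ t → Q (testCost B + t)) σ)
  wp {q} (while _ loop _)     Q σ = Lift q ⊥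

  wp-sound : ∀ {q} P {Q : ℕ → Store → Set q} {σ} → wp P Q σ →
             ∃[ t ] ∃[ τ ] (⟨ P , σ ⟩⇓⟨ t , τ ⟩ × Q t τ)
  wp-sound skip p = _ , _ , skip⇓ , p
  wp-sound (_[_]≔_ k i e) p = _ , _ , assign⇓ , p
  wp-sound (P ⨾ P′) p =
    let _ , _ , x , p′ = wp-sound P p
        _ , _ , y , p″ = wp-sound P′ p′
    in _ , _ , seq⇓ x y , p″
  wp-sound (if B then P else P′) {σ = σ} (p , p′) with test B σ in eq
  ... | true  = let _ , _ , x , q = wp-sound P (p refl) in _ , _ , then⇓ eq x , q
  ... | false = let _ , _ , x , q = wp-sound P′ (p′ refl) in _ , _ , else⇓ eq x , q

  -- On each branch the exact time of a loop-free program computes to a numeral, so the comparison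
  -- with `tick` is settled by evaluation and the block counts as one tick.
  block : ∀ {q} P {Q : ℕ → Store → Set q} {σ} → wp P (λ t τ → T (t ≤ᵇ tick) × Q 1 τ) σ → Run P σ Q
  block P p = let t , _ , x , cost , q = wp-sound P p in run 1 x (≤ᵇ⇒≤ t (tick * 1) cost) q

  -- Ordered lengths, networks and vertex labels

  open IsDecTotalOrder L.isDecTotalOrder using () renaming (trans to ≤ˡ-trans; reflexive to ≤ˡ-reflexive; refl to ≤ˡ-refl)

  +-monoʳ : ∀ z {x y} → x L.≤ y → z L.+ x L.≤ z L.+ y
  +-monoʳ z {x} {y} x≤y = ≤ˡ-trans (≤ˡ-reflexive (L.+-comm z x)) (≤ˡ-trans (L.+-monoˡ-≤ x y z x≤y) (≤ˡ-reflexive (L.+-comm y z)))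

  +-mono : ∀ {x y z w} → x L.≤ y → z L.≤ w → x L.+ z L.≤ y L.+ w
  +-mono {x} {y} {z} x≤y z≤w = ≤ˡ-trans (L.+-monoˡ-≤ x y z x≤y) (+-monoʳ y z≤w)

  ≤-+ʳ : ∀ x {z} → L.0# L.≤ z → x L.≤ x L.+ z
  ≤-+ʳ x 0≤z = ≤ˡ-trans (≤ˡ-reflexive (L.sym (L.+-identityʳ x))) (+-monoʳ x 0≤z)

  -- The search sees arcs only; that they come in opposite pairs from edges enters later, through
  -- `Represents`. `adj` is not stored: it is the list spelt out by `first` and `next`, and
  -- `adj-total` lets costs per arc be added up over vertices.
  record Network : Set (a₁ ⊔ ℓ₀ ⊔ ℓ₂) where
    field
      n na             : ℕ
      from to          : ℕ → ℕ
      next first       : ℕ → ℕ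
      lab              : ℕ → Γ.Carrier
      wgt              : ℕ → L.Carrier
      adj              : ℕ → List ℕ
      from<            : ∀ {b} → b < na → from b < n
      to<              : ∀ {b} → b < na → to b < n
      wgt≥0            : ∀ {b} → b < na → L.0# L.≤ wgt b
      chained          : ∀ {v} → v < n → Chained next (first v) (adj v)
      adj-sound        : ∀ {v b} → v < n → b ∈ adj v → b < na × from b ≡ v
      adj-complete     : ∀ {b} → b < na → b ∈ adj (from b)
      adj-total        : sumTo n (λ v → length (adj v)) ≡ na

  record Labels : Set (a₁ ⊔ ℓ₀) where
    constructor labels
    field
      mark dep par : ℕ → ℕ
      dist         : ℕ → L.Carrier
      val          : ℕ → Γ.Carrier

  record SameLabel (Λ Λ′ : Labels) (v : ℕ) : Set (a₁ ⊔ ℓ₀) where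
    constructor same
    private
      module Λ = Labels Λ
      module Λ′ = Labels Λ′
    field
      mark : Λ.mark v ≡ Λ′.mark v
      dep  : Λ.dep v ≡ Λ′.dep v
      par  : Λ.par v ≡ Λ′.par v
      dist : Λ.dist v ≡ Λ′.dist v
      val  : Λ.val v ≡ Λ′.val v

  labelsOf : Store → Labels
  labelsOf σ = labels (nats σ markA) (nats σ depA) (nats σ parA) (lens σ distA) (grps σ gA)

  record Static (N : Network) (σ : Store) : Set (a₁ ⊔ ℓ₀) where
    open Network N
    field
      n≡     : nats σ 0 0 ≡ n
      na≡    : nats σ naV 0 ≡ na
      from≡  : nats σ fromA ≡ from
      to≡    : nats σ toA ≡ to
      next≡  : nats σ nextA ≡ next
      first≡ : nats σ firstA ≡ first
      lab≡   : grps σ labA ≡ lab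
      wgt≡   : lens σ lenA ≡ wgt

  keeps-static : Program → Bool
  keeps-static P = keeps nat 0 P ∧ keeps nat naV P ∧ keeps nat fromA P ∧ keeps nat toA P ∧
                   keeps nat nextA P ∧ keeps nat firstA P ∧ keeps grp labA P ∧ keeps len lenA P

  static-frame : ∀ {N P σ τ} → {k : T (keeps-static P)} → Framed P σ τ → Static N σ → Static N τ
  static-frame {P = P} {k = k} fr S = record
    { n≡     = trans (cong-app (Framed.nats≡ fr 0 {T-∧ˡ k₀}) 0) (Static.n≡ S)
    ; na≡    = trans (cong-app (Framed.nats≡ fr naV {T-∧ˡ k₁}) 0) (Static.na≡ S)
    ; from≡  = trans (Framed.nats≡ fr fromA {T-∧ˡ k₂}) (Static.from≡ S)
    ; to≡    = trans (Framed.nats≡ fr toA {T-∧ˡ k₃}) (Static.to≡ S)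
    ; next≡  = trans (Framed.nats≡ fr nextA {T-∧ˡ k₄}) (Static.next≡ S)
    ; first≡ = trans (Framed.nats≡ fr firstA {T-∧ˡ k₅}) (Static.first≡ S)
    ; lab≡   = trans (Framed.grps≡ fr labA {T-∧ˡ k₆}) (Static.lab≡ S)
    ; wgt≡   = trans (Framed.lens≡ fr lenA {T-∧ʳ {keeps grp labA P} k₆}) (Static.wgt≡ S)
    }
    where
    k₀ = k
    k₁ = T-∧ʳ {keeps nat 0 P} k₀
    k₂ = T-∧ʳ {keeps nat naV P} k₁
    k₃ = T-∧ʳ {keeps nat fromA P} k₂
    k₄ = T-∧ʳ {keeps nat toA P} k₃
    k₅ = T-∧ʳ {keeps nat nextA P} k₄
    k₆ = T-∧ʳ {keeps nat firstA P} k₅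

  labels-frame : ∀ {P σ τ} → {T (keeps nat markA P ∧ keeps nat depA P ∧ keeps nat parA P ∧ keeps len distA P ∧ keeps grp gA P)} →
            Framed P σ τ → labelsOf τ ≡ labelsOf σ
  labels-frame {P} {_} {_} {k₀} fr = go (Framed.nats≡ fr markA {T-∧ˡ k₀}) (Framed.nats≡ fr depA {T-∧ˡ k₁})
      (Framed.nats≡ fr parA {T-∧ˡ k₂}) (Framed.lens≡ fr distA {T-∧ˡ k₃}) (Framed.grps≡ fr gA {T-∧ʳ {keeps len distA P} k₃})
    where
    k₁ = T-∧ʳ {keeps nat markA P} k₀
    k₂ = T-∧ʳ {keeps nat depA P} k₁
    k₃ = T-∧ʳ {keeps nat parA P} k₂
    go : ∀ {m m′ d d′ p p′ δ δ′ v v′} → m ≡ m′ → d ≡ d′ → p ≡ p′ → δ ≡ δ′ → v ≡ v′ →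
         labels m d p δ v ≡ labels m′ d′ p′ δ′ v′
    go refl refl refl refl refl = refl

  -- Consolidation of the heap

  module Heaps (n size≤ rank≤ : ℕ) (rank-bound : ∀ r → pow r ≤ size≤ → r ≤ rank≤) where
    open Nodes L._≤_ LO.trans n public

    -- Invariants of the heap speak of this part of the store, so that an assignment to any other
    -- array leaves them unchanged by computation.
    record View : Set ℓ₀ where
      field
        cellsᵛ : Cells
        keysᵛ  : Keys
        stackᵛ slotᵛ : ℕ → ℕ
        spᵛ maxrᵛ    : ℕ

    view : Store → View
    view σ = record
      { cellsᵛ = cells (nats σ itemA) (nats σ cntA) (nats σ childA) (nats σ sibA)
      ; keysᵛ  = keys (nats σ nodeA) (nats σ markA) (lens σ distA)
      ; stackᵛ = nats σ stackA
      ; slotᵛ  = nats σ slotA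
      ; spᵛ    = nats σ spV 0
      ; maxrᵛ  = nats σ maxrV 0
      }

    -- A link changes the number of children of a node with an item, and of no other node, so it
    -- preserves exactly the totals of interest. `pot` is such a weight, being 0 on nodes with an
    -- item.
    Uniform : Weight → Set
    Uniform f = ∀ x v k k′ → f x (suc v) k ≡ f x (suc v) k′

    total : Weight → Forest → Forest → (ℕ → Forest) → ℕ
    total f D F B = sum f D + (sum f F + sumTo (suc rank≤) (λ r → sum f (B r)))

    trees : (ℕ → Forest) → ℕ
    trees B = sumTo (suc rank≤) (λ r → count (B r))

    module Consolidation (K : Keys) (F₀ : Forest) (once : ∀ y → sum (occ y) F₀ ≤ 1)
                         (zero∉ : sum (occ 0) F₀ ≡ 0) (small : sum size F₀ ≤ size≤) where

      -- The forest is divided into a part D that is being processed, the stack F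
      -- and the slots B.

      record State (V : View) (D F : Forest) (B : ℕ → Forest) : Set (ℓ₀ ⊔ ℓ₂) where
        open View V
        field
          keys≡  : keysᵛ ≡ K
          stack  : Stack stackᵛ spᵛ F
          slots  : ∀ r → Slot (slotᵛ r) r (B r)
          nodesD : AllN (Node (cellsᵛ) K) D
          nodesF : AllN (Node (cellsᵛ) K) F
          nodesB : ∀ r → AllN (Node (cellsᵛ) K) (B r)
          large  : ∀ r → maxrᵛ < r → B r ≡ ∅
          maxr≤  : maxrᵛ ≤ rank≤
          -- An inequality because `free-root` discards the hollow root. For `occ` it carries
          -- uniqueness of nodes over from `F₀`, for `size` their number.
          total≤ : ∀ g → total (flat g) D F B ≤ sum (flat g) F₀
          items  : ∀ v → total (has v) D F B ≡ sum (has v) F₀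

      module _ {V D F B} (S : State V D F B) where
        open State S

        beyond : ∀ r → rank≤ < r → B r ≡ ∅
        beyond r p = large r (≤-<-trans maxr≤ p)

        -- A node in both parts would be counted twice. This is what keeps the stack intact while
        -- cells of `D` are rewritten.
        apart-F : ∀ {z} → 0 < sum (occ z) D → ¬ 0 < sum (occ z) F
        apart-F {z} p q = <⇒≱ (≤-trans (+-mono-≤ p q) (+-monoʳ-≤ (sum (occ z) D) (m≤m+n (sum (occ z) F) _)))
                              (≤-trans (total≤ (λ x _ → δ z x)) (once z))

        apart-B : ∀ {z} r → 0 < sum (occ z) D → ¬ 0 < sum (occ z) (B r)
        apart-B {z} r p q with suc rank≤ ≤? r
        ... | yes le = n≮0 (subst (λ T → 0 < sum (occ z) T) (beyond r le) q)
        ... | no ≰ = <⇒≱ (≤-trans (+-mono-≤ p (≤-trans q (term≤sumTo (suc rank≤) {λ r → sum (occ z) (B r)} r (≰⇒> ≰))))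
                            (+-monoʳ-≤ (sum (occ z) D) (m≤n+m _ (sum (occ z) F))))
                         (≤-trans (total≤ (λ x _ → δ z x)) (once z))

        -- A root of rank r has at least `pow r` nodes in its tree, and these are among the at most
        -- `size≤` nodes of `F₀`.
        rank-of : ∀ {x it r C D′} → D ≡ tree x it r C D′ → r ≤ rank≤
        rank-of {r = r} {C} {D′} refl = rank-bound r (≤-trans
          (pow≤size C (Node.shape (proj₁ nodesD)) (AllN-map C Node.shape (proj₁ (proj₂ nodesD))))
          (≤-trans (s≤s (m≤m+n _ (sum size D′)))
          (≤-trans (m≤m+n _ (sum size F + _)) (≤-trans (total≤ (λ _ _ → 1)) small))))

        positive : ∀ {x it r C D′} → D ≡ tree x it r C D′ → 0 < x
        positive {suc x} _ = s≤s z≤n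
        positive {zero} refl = ⊥-elim (n≮0 (≤-trans (s≤s z≤n) (≤-trans (total≤ (λ x _ → δ 0 x)) (≤-reflexive zero∉))))

      total-slot : ∀ f {D F B r X} → r ≤ rank≤ →
                   total f D F (upd B r X) + sum f (B r) ≡ total f D F B + sum f X
      total-slot f {D} {F} {B} {r} {X} r≤ = begin
        (sum f D + (sum f F + S′)) + old ≡⟨ cong (_+ old) (+-assoc (sum f D) _ _) ⟨
        ((sum f D + sum f F) + S′) + old ≡⟨ +-assoc (sum f D + sum f F) S′ old ⟩
        (sum f D + sum f F) + (S′ + old) ≡⟨ cong ((sum f D + sum f F) +_) (sumTo-change (suc rank≤) r (s≤s r≤)
           (λ j r≢j → upd-elim (λ T → sum f T ≡ sum f (B j)) r j (λ eq → ⊥-elim (r≢j eq)) (λ _ → refl))) ⟩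
        (sum f D + sum f F) + (S + sum f (upd B r X r)) ≡⟨ cong (λ T → (sum f D + sum f F) + (S + sum f T)) (override-same 0 r) ⟩
        (sum f D + sum f F) + (S + sum f X) ≡⟨ +-assoc (sum f D + sum f F) S _ ⟨
        ((sum f D + sum f F) + S) + sum f X ≡⟨ cong (_+ sum f X) (+-assoc (sum f D) _ _) ⟩
        (sum f D + (sum f F + S)) + sum f X ∎
        where
        open ≡-Reasoning
        old = sum f (B r)
        S = sumTo (suc rank≤) (λ j → sum f (B j))
        S′ = sumTo (suc rank≤) (λ j → sum f (upd B r X j))

      trees-slot : ∀ {B r X} → r ≤ rank≤ → trees (upd B r X) + count (B r) ≡ trees B + count X
      trees-slot {B} {r} {X} r≤ = trans (sumTo-change (suc rank≤) r (s≤s r≤)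
           (λ j r≢j → upd-elim (λ T → count T ≡ count (B j)) r j (λ eq → ⊥-elim (r≢j eq)) (λ _ → refl)))
           (cong (λ T → trees B + count T) (override-same 0 r))

      total-take : ∀ f {D F B x it r C} → r ≤ rank≤ → B r ≡ tree x it r C ∅ →
                   total f (tree x it r C D) F (upd B r ∅) ≡ total f D F B
      total-take f {D} {F} {B} {x} {it} {r} {C} r≤ Br≡ = +-cancelʳ-≡ 0 _ _ (begin
        total f (tree x it r C D) F B′ + 0 ≡⟨ +-identityʳ _ ⟩
        (h + (sum f C + sum f D)) + R ≡⟨ cong (_+ R) (+-assoc h _ _) ⟨
        ((h + sum f C) + sum f D) + R ≡⟨ +-assoc (h + sum f C) _ R ⟩
        (h + sum f C) + (sum f D + R) ≡⟨ cong (λ z → (h + z) + (sum f D + R)) (+-identityʳ (sum f C)) ⟨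
        sum f (tree x it r C ∅) + total f D F B′ ≡⟨ cong (λ T → sum f T + total f D F B′) Br≡ ⟨
        sum f (B r) + total f D F B′ ≡⟨ +-comm (sum f (B r)) _ ⟩
        total f D F B′ + sum f (B r) ≡⟨ total-slot f {D} {F} {B} {r} {∅} r≤ ⟩
        total f D F B + 0 ∎)
        where
        open ≡-Reasoning
        B′ = upd B r ∅
        h = f x it (count C)
        R = sum f F + sumTo (suc rank≤) (λ j → sum f (B′ j))

      take-slot : ∀ {V D F B r x v C} {slot : ℕ → ℕ} → State V D F B → B r ≡ tree x (suc v) r C ∅ →
                  slot r ≡ 0 → (∀ j → j ≢ r → slot j ≡ View.slotᵛ V j) →
                  State (record V { slotᵛ = slot }) (tree x (suc v) r C D) F (upd B r ∅)
      take-slot {V} {D} {F} {B} {r} {x} {v} {C} {slot} S Br≡ slot-r slot-j = record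
        { keys≡  = keys≡
        ; stack  = stack
        ; slots  = λ j → upd-elim (Slot (slot j) j) r j (λ { refl → empty slot-r })
                     (λ r≢j → subst (λ s → Slot s j (B j)) (sym (slot-j j (λ eq → r≢j (sym eq)))) (slots j))
        ; nodesD = let p , pC , _ = subst (AllN _) Br≡ (nodesB r) in p , pC , nodesD
        ; nodesF = nodesF
        ; nodesB = λ j → upd-elim (AllN _) r j (λ _ → tt) (λ _ → nodesB j)
        ; large  = λ j p → upd-elim (_≡ ∅) r j (λ _ → refl) (λ _ → large j p)
        ; maxr≤  = maxr≤
        ; total≤ = λ g → ≤-trans (≤-reflexive (total-take (flat g) {D} {F} {B} r≤ Br≡)) (total≤ g)
        ; items  = λ w → trans (total-take (has w) {D} {F} {B} r≤ Br≡) (items w)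
        }
        where
        open State S
        r≤ : r ≤ rank≤
        r≤ with suc rank≤ ≤? r
        ... | no ≰ = ≤-pred (≰⇒> ≰)
        ... | yes le with () ← trans (sym Br≡) (beyond S r le)

      total-swap : ∀ f {F B x it r C x′ it′ r′ C′} →
                   total f (tree x′ it′ r′ C′ (tree x it r C ∅)) F B ≡ total f (tree x it r C (tree x′ it′ r′ C′ ∅)) F B
      total-swap f {F} {B} {x} {it} {r} {C} {x′} {it′} {r′} {C′} =
        cong (_+ (sum f F + sumTo (suc rank≤) (λ j → sum f (B j)))) (go (f x it (count C)) (sum f C) (f x′ it′ (count C′)) (sum f C′))
        where
        open ≡-Reasoning
        go : ∀ a b c d → c + (d + (a + (b + 0))) ≡ a + (b + (c + (d + 0)))
        go a b c d = begin
          c + (d + (a + (b + 0))) ≡⟨ cong (λ z → c + (d + (a + z))) (+-identityʳ b) ⟩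
          c + (d + (a + b)) ≡⟨ +-assoc c d _ ⟨
          (c + d) + (a + b) ≡⟨ +-comm (c + d) _ ⟩
          (a + b) + (c + d) ≡⟨ +-assoc a b _ ⟩
          a + (b + (c + d)) ≡⟨ cong (λ z → a + (b + (c + z))) (+-identityʳ d) ⟨
          a + (b + (c + (d + 0))) ∎

      swap-first : ∀ {V F B x it r C x′ it′ r′ C′} → State V (tree x it r C (tree x′ it′ r′ C′ ∅)) F B →
                   State V (tree x′ it′ r′ C′ (tree x it r C ∅)) F B
      swap-first {F = F} {B} {x} {it} {r} {C} {x′} {it′} {r′} {C′} S = record
        { keys≡  = keys≡
        ; stack  = stack
        ; slots  = slots
        ; nodesD = let p , pC , p′ , pC′ , _ = nodesD in p′ , pC′ , p , pC , tt
        ; nodesF = nodesF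
        ; nodesB = nodesB
        ; large  = large
        ; maxr≤  = maxr≤
        ; total≤ = λ g → ≤-trans (≤-reflexive (total-swap (flat g) {F} {B} {x} {it} {r} {C} {x′} {it′} {r′} {C′})) (total≤ g)
        ; items  = λ w → trans (total-swap (has w) {F} {B} {x} {it} {r} {C} {x′} {it′} {r′} {C′}) (items w)
        }
        where
        open State S

      total-push : ∀ f {D F B x it r C} → total f D (tree x it r C F) B ≡ total f (tree x it r C D) F B
      total-push f {D} {F} {B} {x} {it} {r} {C} = go (sum f D) (f x it (count C)) (sum f C) (sum f F) (sumTo (suc rank≤) (λ j → sum f (B j)))
        where
        open ≡-Reasoning
        go : ∀ d h c u b → d + ((h + (c + u)) + b) ≡ (h + (c + d)) + (u + b)
        go d h c u b = begin
          d + ((h + (c + u)) + b) ≡⟨ cong (λ z → d + (z + b)) (+-assoc h c u) ⟨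
          d + (((h + c) + u) + b) ≡⟨ cong (d +_) (+-assoc (h + c) u b) ⟩
          d + ((h + c) + (u + b)) ≡⟨ +-assoc d _ _ ⟨
          (d + (h + c)) + (u + b) ≡⟨ cong (_+ (u + b)) (+-comm d _) ⟩
          ((h + c) + d) + (u + b) ≡⟨ cong (_+ (u + b)) (+-assoc h c d) ⟩
          (h + (c + d)) + (u + b) ∎

      push-first : ∀ {V D F B x it r C} {st : ℕ → ℕ} {sp : ℕ} → State V (tree x it r C D) F B →
                   sp ≡ suc (View.spᵛ V) → st (View.spᵛ V) ≡ x → (∀ i → i ≢ View.spᵛ V → st i ≡ View.stackᵛ V i) →
                   State (record V { stackᵛ = st ; spᵛ = sp }) D (tree x it r C F) B
      push-first {V} {D} {F} {B} {x} {it} {r} {C} S sp≡ top rest = record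
        { keys≡  = keys≡
        ; stack  = _ , sp≡ , top , stack-cong F (λ i i< → rest i (<⇒≢ i<)) stack
        ; slots  = slots
        ; nodesD = proj₂ (proj₂ nodesD)
        ; nodesF = proj₁ nodesD , proj₁ (proj₂ nodesD) , nodesF
        ; nodesB = nodesB
        ; large  = large
        ; maxr≤  = maxr≤
        ; total≤ = λ g → ≤-trans (≤-reflexive (total-push (flat g) {D} {F} {B} {x} {it} {r} {C})) (total≤ g)
        ; items  = λ w → trans (total-push (has w) {D} {F} {B} {x} {it} {r} {C}) (items w)
        }
        where
        open State S

      pop-first : ∀ {V F B x it r C} → State V ∅ (tree x it r C F) B → (sp≡ : ∃[ sp ] View.spᵛ V ≡ suc sp) →
                  State (record V { spᵛ = proj₁ sp≡ }) (tree x it r C ∅) F B × View.stackᵛ V (proj₁ sp≡) ≡ x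
      pop-first {V} {F} {B} {x} {it} {r} {C} S (sp , refl) with State.stack S
      ... | _ , refl , top , st = record
        { keys≡  = keys≡
        ; stack  = st
        ; slots  = slots
        ; nodesD = let p , pC , _ = nodesF in p , pC , tt
        ; nodesF = proj₂ (proj₂ nodesF)
        ; nodesB = nodesB
        ; large  = large
        ; maxr≤  = maxr≤
        ; total≤ = λ g → ≤-trans (≤-reflexive (eq (flat g))) (total≤ g)
        ; items  = λ w → trans (eq (has w)) (items w)
        } , top
        where
        open State S
        eq : ∀ f → total f (tree x it r C ∅) F B ≡ total f ∅ (tree x it r C F) B
        eq f = go (f x it (count C)) (sum f C) (sum f F) _
          where
          go : ∀ h c u b → (h + (c + 0)) + (u + b) ≡ (h + (c + u)) + b
          go h c u b = trans (cong (λ z → (h + z) + (u + b)) (+-identityʳ c))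
                      (trans (sym (+-assoc (h + c) u b)) (cong (_+ b) (+-assoc h c u)))

      once-first : ∀ {V x it r C y it′ r′ C′ F B} → State V (tree x it r C (tree y it′ r′ C′ ∅)) F B →
                   ∀ z → 0 < sum (occ z) C ⊎ 0 < sum (occ z) C′ ⊎ z ≡ y → z ≢ x
      once-first {x = x} {C = C} {y} {C′ = C′} S z z∈ refl = <⇒≱ (lower z∈) (≤-pred upper)
        where
        upper : suc (sum (occ z) C + (δ z y + (sum (occ z) C′ + 0))) ≤ 1
        upper = subst (λ d → d + (sum (occ z) C + (δ z y + (sum (occ z) C′ + 0))) ≤ 1) (δ-refl z)
                  (≤-trans (m≤m+n _ _) (≤-trans (State.total≤ S (λ x _ → δ z x)) (once z)))
        lower : 0 < sum (occ z) C ⊎ 0 < sum (occ z) C′ ⊎ z ≡ y → 0 < sum (occ z) C + (δ z y + (sum (occ z) C′ + 0))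
        lower (inj₁ p)           = ≤-trans p (m≤m+n _ _)
        lower (inj₂ (inj₁ p))    = ≤-trans p (≤-trans (m≤m+n _ 0) (≤-trans (m≤n+m _ (δ z y)) (m≤n+m _ (sum (occ z) C))))
        lower (inj₂ (inj₂ refl)) = ≤-trans (≤-reflexive (sym (δ-refl z))) (≤-trans (m≤m+n _ _) (m≤n+m _ (sum (occ z) C)))

      -- Only `cnt` and `child` of x and `sib` of y are written. All other nodes keep their cells as
      -- x and y occur once; the link of y alone joins the old children of x to the new one.
      link-first : ∀ {V F B x v r C y w C′} {cnt child sib : ℕ → ℕ} →
                   State V (tree x (suc v) r C (tree y (suc w) r C′ ∅)) F B →
                   Keys.dist K v L.≤ Keys.dist K w →
                   let open Cells (View.cellsᵛ V) renaming (cnt to cnt₀; child to child₀; sib to sib₀) in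
                   sib y ≡ child₀ x → (∀ j → j ≢ y → sib j ≡ sib₀ j) →
                   child x ≡ y → (∀ j → j ≢ x → child j ≡ child₀ j) →
                   cnt x ≡ suc r → (∀ j → j ≢ x → cnt j ≡ cnt₀ j) →
                   let D = tree x (suc v) (suc r) (tree y (suc w) r C′ C) ∅ in
                   State (record V { cellsᵛ = cells item cnt child sib }) D F B ×
                   (∀ f → Uniform f → total f D F B ≡ total f (tree x (suc v) r C (tree y (suc w) r C′ ∅)) F B)
      link-first {V} {F} {B} {x} {v} {r} {C} {y} {w} {C′} {cnt} {child} {sib} S v≤w sib-y sib-j child-x child-j cnt-x cnt-j =
        record
          { keys≡  = keys≡
          ; stack  = stack
          ; slots  = slots
          ; nodesD = let p , pC , q , pC′ , _ = nodesD
                         C-cells = nodes-cells C (λ z z∈ → keep (inj₁ z∈) (inj₂ (inj₁ z∈)))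
                         l = subst (λ p → Links sib p C) (sym sib-y)
                               (Links-cong C (λ z z∈ → sym (sib-j z (once-first S′ z (inj₂ (inj₁ z∈))))) (Node.links p))
                     in node-link p q v≤w l refl cnt-x child-x ,
                        (record
                           { item≡ = Node.item≡ q
                           ; cnt≡  = trans (cnt-j y (once-first S y (inj₂ (inj₂ refl)))) (Node.cnt≡ q)
                           ; links = subst (λ p → Links sib p C′) (sym (child-j y (once-first S y (inj₂ (inj₂ refl)))))
                               (Links-cong C′ (λ z z∈ → sym (sib-j z (once-first S′ z (inj₁ z∈)))) (Node.links q))
                           ; shape = Node.shape q
                           ; order = Node.order q
                           ; full  = Node.full q
                           } ,
                         nodes-cells C′ (λ z z∈ → keep (inj₂ (inj₁ z∈)) (inj₁ z∈)) pC′ ,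
                         C-cells pC) ,
                        tt
          ; nodesF = nodes-cells F (λ z z∈ → off z (λ { refl → apart-F S {z} x∈ z∈ }) (λ { refl → apart-F S {z} y∈ z∈ })) nodesF
          ; nodesB = λ j → nodes-cells (B j) (λ z z∈ → off z (λ { refl → apart-B S {z} j x∈ z∈ }) (λ { refl → apart-B S {z} j y∈ z∈ })) (nodesB j)
          ; large  = large
          ; maxr≤  = maxr≤
          ; total≤ = λ g → ≤-trans (≤-reflexive (eq (flat g) (λ _ _ _ _ → refl))) (total≤ g)
          ; items  = λ w → trans (eq (has w) (λ _ _ _ _ → refl)) (items w)
          } , eq
        where
        open State S
        S′ = swap-first S
        A  = View.cellsᵛ V
        A′ = cells (Cells.item A) cnt child sib
        off : ∀ z → z ≢ x → z ≢ y → SameCell A A′ z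
        off z z≢x z≢y = same refl (sym (cnt-j z z≢x)) (sym (child-j z z≢x)) (sym (sib-j z z≢y))
        keep : ∀ {z} → 0 < sum (occ z) C ⊎ 0 < sum (occ z) C′ ⊎ z ≡ y → 0 < sum (occ z) C′ ⊎ 0 < sum (occ z) C ⊎ z ≡ x →
               SameCell A A′ z
        keep p q = off _ (once-first S _ p) (once-first S′ _ q)
        D₀ = tree x (suc v) r C (tree y (suc w) r C′ ∅)
        x∈ : 0 < sum (occ x) D₀
        x∈ = root∈ {x} {suc v} {r} C (tree y (suc w) r C′ ∅)
        y∈ : 0 < sum (occ y) D₀
        y∈ = ≤-trans (root∈ {y} {suc w} {r} C′ ∅) (sibs≤ (occ y) {x} {suc v} {r} C (tree y (suc w) r C′ ∅))
        D = tree x (suc v) (suc r) (tree y (suc w) r C′ C) ∅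
        eq : ∀ f → Uniform f → total f D F B ≡ total f D₀ F B
        eq f u = cong (_+ (sum f F + sumTo (suc rank≤) (λ j → sum f (B j)))) (begin
          f x (suc v) (suc (count C)) + ((g + (c′ + c)) + 0) ≡⟨ cong₂ _+_ (u x v _ (count C)) (+-identityʳ _) ⟩
          h + (g + (c′ + c)) ≡⟨ cong (h +_) (+-assoc g c′ c) ⟨
          h + ((g + c′) + c) ≡⟨ cong (h +_) (+-comm (g + c′) c) ⟩
          h + (c + (g + c′)) ≡⟨ cong (λ z → h + (c + (g + z))) (+-identityʳ c′) ⟨
          h + (c + (g + (c′ + 0))) ∎)
          where
          open ≡-Reasoning
          h = f x (suc v) (count C)
          g = f y (suc w) (count C′)
          c′ = sum f C′
          c = sum f C

      put-slot : ∀ {V F B x v r C} {slot : ℕ → ℕ} {maxr : ℕ} → State V (tree x (suc v) r C ∅) F B →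
                 View.slotᵛ V r ≡ 0 → slot r ≡ x → (∀ j → j ≢ r → slot j ≡ View.slotᵛ V j) →
                 r ≤ maxr → View.maxrᵛ V ≤ maxr → maxr ≤ rank≤ →
                 let B′ = upd B r (tree x (suc v) r C ∅) in
                 State (record V { slotᵛ = slot ; maxrᵛ = maxr }) ∅ F B′ ×
                 (∀ f → total f ∅ F B′ ≡ total f (tree x (suc v) r C ∅) F B) × trees B′ ≡ suc (trees B)
      put-slot {V} {F} {B} {x} {v} {r} {C} {slot} {maxr} S slot-0 slot-r slot-j r≤ maxr≤′ ≤rank =
        record
          { keys≡  = keys≡
          ; stack  = stack
          ; slots  = λ j → upd-elim (Slot (slot j) j) r j (λ { refl → holds slot-r (positive S refl) })
                       (λ r≢j → subst (λ s → Slot s j (B j)) (sym (slot-j j (λ eq → r≢j (sym eq)))) (slots j))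
          ; nodesD = tt
          ; nodesF = nodesF
          ; nodesB = λ j → upd-elim (AllN _) r j (λ _ → nodesD) (λ _ → nodesB j)
          ; large  = λ j p → upd-elim (_≡ ∅) r j (λ { refl → ⊥-elim (<⇒≱ p r≤) }) (λ _ → large j (≤-<-trans maxr≤′ p))
          ; maxr≤  = ≤rank
          ; total≤ = λ g → ≤-trans (≤-reflexive (eq (flat g))) (total≤ g)
          ; items  = λ w → trans (eq (has w)) (items w)
          } , eq , trans (sym (+-identityʳ _)) (trans (cong (λ T → trees B′ + count T) (sym B≡∅))
                          (trans (trees-slot {B} {r} {X} (≤-trans r≤ ≤rank)) (+-comm (trees B) 1)))
        where
        open State S
        X = tree x (suc v) r C ∅
        B′ = upd B r X
        B≡∅ : B r ≡ ∅
        B≡∅ = slot-empty slot-0 (slots r)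
        eq : ∀ f → total f ∅ F B′ ≡ total f X F B
        eq f = begin
          total f ∅ F B′                ≡⟨ +-identityʳ _ ⟨
          total f ∅ F B′ + 0            ≡⟨ cong (λ T → total f ∅ F B′ + sum f T) B≡∅ ⟨
          total f ∅ F B′ + sum f (B r)  ≡⟨ total-slot f {∅} {F} {B} {r} {X} (≤-trans r≤ ≤rank) ⟩
          total f ∅ F B + sum f X       ≡⟨ +-comm (total f ∅ F B) _ ⟩
          total f X F B                 ∎
          where open ≡-Reasoning

      free-root : ∀ {V F B x r C} → State V (tree x 0 r C ∅) F B → State V C F B ×
                  total pot (tree x 0 r C ∅) F B ≡ 12 * count C + total pot C F B
      free-root {F = F} {B} {x} {r} {C} S = record
        { keys≡  = keys≡
        ; stack  = stack
        ; slots  = slots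
        ; nodesD = proj₁ (proj₂ nodesD)
        ; nodesF = nodesF
        ; nodesB = nodesB
        ; large  = large
        ; maxr≤  = maxr≤
        ; total≤ = λ g → ≤-trans (m≤n+m _ (g x 0)) (≤-trans (≤-reflexive (sym (eq (flat g)))) (total≤ g))
        ; items  = λ w → trans (sym (eq (has w))) (items w)
        } , eq pot
        where
        open State S
        eq : ∀ f → total f (tree x 0 r C ∅) F B ≡ f x 0 (count C) + total f C F B
        eq f = trans (cong (λ z → (f x 0 (count C) + z) + (sum f F + sumTo (suc rank≤) (λ j → sum f (B j)))) (+-identityʳ (sum f C)))
                     (+-assoc (f x 0 (count C)) _ _)

      run-release : ∀ {σ x r C F B} → State (view σ) (tree x 0 r C ∅) F B → nats σ xV 0 ≡ x →
                    Run release σ (λ j τ → ∃[ F′ ] (State (view τ) ∅ F′ B ×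
                      total pot (tree x 0 r C ∅) F B ≡ 12 * count C + total pot ∅ F′ B ×
                      count F′ ≡ count C + count F × j ≤ 2 + 2 * count C))
      run-release {σ} {x} {r} {C} {F} {B} S refl =
        run-seq (block releaseInit (_ , run-map
          (λ { {j} (_ , (∅ , F′ , S′ , _ , _ , totals , counts , refl) , _ , le) →
               F′ , S′ , trans (proj₂ (free-root S)) (cong (12 * count C +_) (sym (totals pot))) , counts ,
               s≤s (≤-trans (≤-reflexive (sym (+-identityʳ j))) le)
             ; (_ , (tree _ _ _ _ _ , F′ , S′ , _ , j≡ , totals , counts , refl) , done , le) →
               ⊥-elim (does-false (1 ≤? _) done (subst (1 ≤_) (sym j≡) (s≤s z≤n))) })
          (run-while Inv body
            (C , F , proj₁ (free-root S) , Node.links p , Node.cnt≡ p , (λ _ → refl) , refl , refl))))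
        where
        p = proj₁ (State.nodesD S)
        Inv : ℕ → Store → Set _
        Inv k τ = ∃[ D ] ∃[ F′ ] (State (view τ) D F′ B × Links (nats τ sibA) (nats τ yV 0) D × nats τ jV 0 ≡ count D ×
                    (∀ f → total f D F′ B ≡ total f C F B) × count D + count F′ ≡ count C + count F × k ≡ 2 * count D)
        body : ∀ {k τ} → test (one ≤ⁿ var jV) τ ≡ true → Inv k τ →
               Run releaseBody τ (λ j υ → ∃[ k′ ] (Inv k′ υ × suc (j + k′) ≤ k))
        body go (∅ , F′ , S′ , _ , j≡ , _) = ⊥-elim (n≮0 (subst (1 ≤_) j≡ (does-true (1 ≤? _) go)))
        body {τ = τ} go (tree y it r′ E D , F′ , S′ , (refl , l) , j≡ , totals , counts , refl) =
          block releaseBody (_ , 2 * count D ,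
            (D , tree y it r′ E F′ ,
             push-first S′ (+-comm (nats τ spV 0) 1) (override-same stackA (nats τ spV 0)) (λ i → override-other stackA (nats τ spV 0) i) ,
             l , trans (cong (_∸ 1) j≡) refl ,
             (λ f → trans (move f) (totals f)) ,
             trans (+-suc (count D) (count F′)) counts , refl) ,
            ≤-reflexive (sym (*-suc 2 (count D))))
          where
          move : ∀ f → total f D (tree y it r′ E F′) B ≡ total f (tree y it r′ E D) F′ B
          move f = total-push f {D} {F′} {B} {y} {it} {r′} {E}

      key≡ : ∀ {σ D F B x v r C} → State (view σ) D F B → Node (View.cellsᵛ (view σ)) K x (suc v) r C →
             lens σ distA (nats σ itemA x ∸ 1) ≡ Keys.dist K v
      key≡ {σ} {v = v} S p =
        trans (cong (λ i → lens σ distA (i ∸ 1)) (Node.item≡ p)) (cong (λ K → Keys.dist K v) (State.keys≡ S))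

      ≰⇒≥ˡ : ∀ {d e} → ¬ d L.≤ e → e L.≤ d
      ≰⇒≥ˡ {d} {e} d≰e with LO.total d e
      ... | inj₁ d≤e = ⊥-elim (d≰e d≤e)
      ... | inj₂ e≤d = e≤d

      -- Each iteration empties an occupied slot, which pays 4 ticks: the loop test and the blocks
      -- `linkFetch`, `linkCompare` and `linkJoin`.
      record Linking (D₀ F : Forest) (B₀ : ℕ → Forest) (k : ℕ) (τ : Store) : Set (ℓ₀ ⊔ ℓ₂) where
        field
          {v r}  : ℕ
          {C}    : Forest
          {B}    : ℕ → Forest
        D : Forest
        D = tree (nats τ xV 0) (suc v) r C ∅
        field
          state  : State (view τ) D F B
          r≡     : nats τ rV 0 ≡ r
          totals : ∀ f → Uniform f → total f D F B ≡ total f D₀ F B₀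
          k≡     : k ≡ 4 * trees B

      run-link : ∀ {D₀ F B₀ k τ} → 1 ≤ nats τ slotA (nats τ rV 0) → Linking D₀ F B₀ k τ →
                 Run linkBody τ (λ j υ → ∃[ k′ ] (Linking D₀ F B₀ k′ υ × suc (j + k′) ≤ k))
      run-link {D₀} {F} {B₀} {τ = τ} s≥1 record { v = v ; r = r ; C = C ; B = B ; state = S ; r≡ = refl ; totals = totals ; k≡ = refl }
        with B r in Br≡ | State.slots S r
      ... | _ | empty s≡0 = ⊥-elim (n≮0 (subst (1 ≤_) s≡0 s≥1))
      ... | _ | holds {y} {w} {C′} refl 0<y = run-seq (run-map (λ {j} → fetched {j}) fetch)
        where
        x = nats τ xV 0
        B′ = upd B r ∅
        D₁ = tree x (suc v) r C ∅
        r≤ : r ≤ rank≤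
        r≤ = rank-of S refl

        Fetched Compared : ℕ → Store → Set _
        Fetched j υ = State (view υ) (tree y (suc w) r C′ (tree x (suc v) r C ∅)) F B′ ×
                      nats υ xV 0 ≡ x × nats υ yV 0 ≡ y × nats υ rV 0 ≡ r × j ≡ 1
        Compared j υ = ∃[ v ] ∃[ C ] ∃[ w ] ∃[ C′ ]
                       (let D = tree (nats υ xV 0) (suc v) r C (tree (nats υ yV 0) (suc w) r C′ ∅) in
                        State (view υ) D F B′ × Keys.dist K v L.≤ Keys.dist K w × nats υ rV 0 ≡ r ×
                        (∀ f → total f D F B′ ≡ total f D₁ F B) × j ≡ 1)

        fetch : Run linkFetch τ Fetched
        fetch = block linkFetch (_ ,
          take-slot S Br≡ (override-same slotA r) (λ j → override-other slotA r j) , refl , refl , refl , refl)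

        taken : ∀ f → total f (tree y (suc w) r C′ (tree x (suc v) r C ∅)) F B′ ≡ total f (tree x (suc v) r C ∅) F B
        taken f = total-take f {tree x (suc v) r C ∅} {F} {B} r≤ Br≡

        compared : ∀ {j υ} → Fetched j υ → Run linkCompare υ Compared
        compared {υ = υ} (S₁ , x≡ , y≡ , r≡ , _) = block linkCompare
          ( (λ le → _ , v , C , w , C′ ,
               subst₂ (λ x′ y′ → State (view υ) (tree x′ (suc v) r C (tree y′ (suc w) r C′ ∅)) F B′) (sym x≡) (sym y≡) (swap-first S₁) ,
               subst₂ L._≤_ (keyx x≡) (keyy y≡) (does-true (lens υ distA (nats υ itemA (nats υ xV 0) ∸ 1) L.≤? _) le) , r≡ ,
               (λ f → subst₂ (λ x′ y′ → total f (tree x′ (suc v) r C (tree y′ (suc w) r C′ ∅)) F B′ ≡ total f D₁ F B) (sym x≡) (sym y≡)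
                  (trans (total-swap f {F} {B′} {y} {suc w} {r} {C′} {x} {suc v} {r} {C}) (taken f))) , refl)
          , (λ gt → _ , w , C′ , v , C ,
               subst₂ (λ x′ y′ → State (view υ) (tree y′ (suc w) r C′ (tree x′ (suc v) r C ∅)) F B′) (sym x≡) (sym y≡) S₁ ,
               ≰⇒≥ˡ (subst₂ (λ d e → ¬ d L.≤ e) (keyx x≡) (keyy y≡) (does-false (lens υ distA (nats υ itemA (nats υ xV 0) ∸ 1) L.≤? _) gt)) , r≡ ,
               (λ f → subst₂ (λ x′ y′ → total f (tree y′ (suc w) r C′ (tree x′ (suc v) r C ∅)) F B′ ≡ total f D₁ F B) (sym x≡) (sym y≡) (taken f)) , refl) )
          where
          keyx : ∀ {x′} → x′ ≡ x → lens υ distA (nats υ itemA x′ ∸ 1) ≡ Keys.dist K v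
          keyx refl = key≡ {υ} S₁ (proj₁ (proj₂ (proj₂ (State.nodesD S₁))))
          keyy : ∀ {y′} → y′ ≡ y → lens υ distA (nats υ itemA y′ ∸ 1) ≡ Keys.dist K w
          keyy refl = key≡ {υ} S₁ (proj₁ (State.nodesD S₁))

        join : ∀ {j υ} → Compared j υ → Run linkJoin υ (λ j φ → Linking D₀ F B₀ (4 * trees B′) φ × j ≡ 1)
        join {υ = υ} (v , C , w , C′ , S₂ , v≤w , r≡ , eq₂ , _) = block linkJoin (_ ,
          record
            { state  = proj₁ linked
            ; r≡     = trans (cong (_+ 1) r≡) (+-comm r 1)
            ; totals = λ f u → trans (proj₂ linked f u) (trans (eq₂ f) (totals f u))
            ; k≡     = refl
            } , refl)
          where
          linked = link-first S₂ v≤w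
                      (override-same sibA (nats υ yV 0)) (λ j → override-other sibA (nats υ yV 0) j)
                      (override-same childA (nats υ xV 0)) (λ j → override-other childA (nats υ xV 0) j)
                      (trans (override-same cntA (nats υ xV 0)) (trans (cong (_+ 1) r≡) (+-comm r 1)))
                      (λ j → override-other cntA (nats υ xV 0) j)

        cost : 4 + 4 * trees B′ ≤ 4 * trees B
        cost = ≤-reflexive (trans (sym (*-suc 4 (trees B′))) (cong (4 *_)
                 (trans (+-comm 1 (trees B′)) (trans (cong (λ T → trees B′ + count T) (sym Br≡))
                   (trans (trees-slot {B} {r} {∅} r≤) (+-identityʳ _))))))

        fetched : ∀ {j υ} → Fetched j υ → Run (linkCompare ⨾ linkJoin) υ
                    (λ j′ φ → ∃[ k′ ] (Linking D₀ F B₀ k′ φ × suc ((j + j′) + k′) ≤ 4 * trees B))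
        fetched {j} {υ} p@(_ , _ , _ , _ , refl) = run-seq (run-map
          (λ { {j′} q@(_ , _ , _ , _ , _ , _ , _ , _ , refl) → run-map (λ { (l , refl) → _ , l , cost }) (join {j′} q) })
          (compared p))

      -- The 7 are the two blocks around the loop, the last loop test and the 4 deposited in the
      -- slot that is filled. The links themselves are paid by the slots they empty.
      run-place : ∀ {σ v r C F B} → State (view σ) (tree (nats σ xV 0) (suc v) r C ∅) F B →
                  Run place σ (λ j τ → ∃[ B′ ] (State (view τ) ∅ F B′ ×
                    (∀ f → Uniform f → total f ∅ F B′ ≡ total f (tree (nats σ xV 0) (suc v) r C ∅) F B) ×
                    j + 4 * trees B′ ≤ 7 + 4 * trees B))
      run-place {σ} {v} {r} {C} {F} {B} S = run-seq (block _ (_ , run-seq (run-map (λ {j} → finish {j})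
          (run-while (Linking D F B) {k = 4 * trees B} (λ go l → run-link (does-true (1 ≤? _) go) l)
            record { state = S ; r≡ = trans (Node.cnt≡ p) count≡ ; totals = λ _ _ → refl ; k≡ = refl }))))
        where
        D = tree (nats σ xV 0) (suc v) r C ∅
        p = proj₁ (State.nodesD S)
        count≡ : count C ≡ r
        count≡ = ≤-antisym (ranks-count (Shape.ranks (Node.shape p))) (Shape.whole (Node.shape p) (λ ()))
        finish : ∀ {j τ} → ∃[ k ] (Linking D F B k τ × test (one ≤ⁿ slotA ‼ var rV) τ ≡ false × j + k ≤ suc (4 * trees B)) →
                 Run placeEnd τ (λ i υ → ∃[ B′ ] (State (view υ) ∅ F B′ ×
                   (∀ f → Uniform f → total f ∅ F B′ ≡ total f D F B) × (1 + (j + i)) + 4 * trees B′ ≤ 7 + 4 * trees B))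
        finish {j} {τ} (_ , record { v = v ; r = r ; C = C ; B = B₁ ; state = S₁ ; r≡ = refl ; totals = totals ; k≡ = refl } , done , le) =
          block placeEnd
            ( (λ le′ → let S₂ , eq , t = put-slot S₁ free (override-same slotA r) (λ j → override-other slotA r j)
                                 ≤-refl (does-true (_ ≤? r) le′) (rank-of S₁ refl)
                       in _ , _ , S₂ , (λ f u → trans (eq f) (totals f u)) , cost t)
            , (λ gt → let S₂ , eq , t = put-slot S₁ free (override-same slotA r) (λ j → override-other slotA r j)
                                (<⇒≤ (≰⇒> (does-false (_ ≤? r) gt))) ≤-refl (State.maxr≤ S₁)
                      in _ , _ , S₂ , (λ f u → trans (eq f) (totals f u)) , cost t) )
          where
          free : nats τ slotA r ≡ 0
          free = n<1⇒n≡0 (≰⇒> (does-false (1 ≤? _) done))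
          cost : ∀ {t} → t ≡ suc (trees B₁) → (1 + (j + 1)) + 4 * t ≤ 7 + 4 * trees B
          cost refl = begin
            (1 + (j + 1)) + 4 * suc (trees B₁) ≡⟨ solved j (trees B₁) ⟩
            6 + (j + 4 * trees B₁) ≤⟨ +-monoʳ-≤ 6 le ⟩
            7 + 4 * trees B ∎
            where
            open ≤-Reasoning
            solved : ∀ j t → (1 + (j + 1)) + 4 * suc t ≡ 6 + (j + 4 * t)
            solved = solve-∀

      -- A root with an item spends its 10 on the loop test, `pop`, the branching and the 7 of
      -- `run-place`. A hollow root has potential for releasing its children and for the 10 that
      -- each of them needs as a root.
      record Consolidating (k : ℕ) (τ : Store) : Set (ℓ₀ ⊔ ℓ₂) where
        field
          {F}   : Forest
          {B}   : ℕ → Forest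
          state : State (view τ) ∅ F B
          k≡    : k ≡ 10 * count F + (4 * trees B + total pot ∅ F B)

      run-consolidateBody : ∀ {k τ} → 1 ≤ nats τ spV 0 → Consolidating k τ →
                            Run consolidateBody τ (λ j υ → ∃[ k′ ] (Consolidating k′ υ × suc (j + k′) ≤ k))
      run-consolidateBody sp≥1 record { F = ∅ ; state = S } = ⊥-elim (n≮0 (subst (1 ≤_) (State.stack S) sp≥1))
      run-consolidateBody {τ = τ} sp≥1 record { F = tree x it r C F ; B = B ; state = S ; k≡ = refl } =
        run-seq (run-map (λ { {j} (S₁ , x≡ , refl) → popped it S₁ x≡ }) popping)
        where
        sp≡ : ∃[ sp ] nats τ spV 0 ≡ suc sp
        sp≡ = let sp , eq , _ = State.stack S in sp , eq
        popping : Run pop τ (λ j υ → State (view υ) (tree x it r C ∅) F B × nats υ xV 0 ≡ x × j ≡ 1)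
        popping = block pop (_ ,
          subst (λ sp → State (record (view τ) { spᵛ = sp }) (tree x it r C ∅) F B) (cong (_∸ 1) (sym (proj₂ sp≡))) (proj₁ (pop-first S sp≡)) ,
          trans (cong (nats τ stackA) (cong (_∸ 1) (proj₂ sp≡))) (proj₂ (pop-first S sp≡)) , refl)
        popped : ∀ it {υ} → State (view υ) (tree x it r C ∅) F B → nats υ xV 0 ≡ x →
                 Run (if itemA ‼ var xV ≤ⁿ lit 0 then release else place) υ
                   (λ j φ → ∃[ k′ ] (Consolidating k′ φ ×
                      suc ((1 + j) + k′) ≤ 10 * suc (count F) + (4 * trees B + total pot ∅ (tree x it r C F) B)))
        popped zero {υ} S₁ refl = run-if
          (λ _ → run-map (λ { {j} (F′ , S₂ , pot≡ , count≡ , j≤) → _ , record { state = S₂ ; k≡ = refl } ,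
               cost j≤ (trans (total-push pot {∅} {F} {B} {x} {0} {r} {C}) pot≡) count≡ }) (run-release S₁ refl))
          (λ gt → ⊥-elim (does-false (nats υ itemA (nats υ xV 0) ≤? 0) gt
                    (≤-reflexive (Node.item≡ (proj₁ (State.nodesD S₁))))))
          where
          cost : ∀ {j f p p₀} → j ≤ 2 + 2 * count C → p₀ ≡ 12 * count C + p → f ≡ count C + count F →
                 suc ((1 + suc j) + (10 * f + (4 * trees B + p))) ≤ 10 * suc (count F) + (4 * trees B + p₀)
          cost {j} {p = p} j≤ refl refl = begin
            3 + (j + (10 * (count C + count F) + (4 * trees B + p)))
              ≤⟨ +-monoʳ-≤ 3 (+-monoˡ-≤ (10 * (count C + count F) + (4 * trees B + p)) j≤) ⟩
            3 + ((2 + 2 * count C) + (10 * (count C + count F) + (4 * trees B + p)))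
              ≤⟨ m≤n+m _ 5 ⟩
            5 + (3 + ((2 + 2 * count C) + (10 * (count C + count F) + (4 * trees B + p))))
              ≡⟨ solved (count C) (count F) (trees B) p ⟩
            10 * suc (count F) + (4 * trees B + (12 * count C + p)) ∎
            where
            open ≤-Reasoning
            solved : ∀ c f t p → 5 + (3 + ((2 + 2 * c) + (10 * (c + f) + (4 * t + p)))) ≡ 10 * suc f + (4 * t + (12 * c + p))
            solved = solve-∀
        popped (suc v) {υ} S₁ refl = run-if
          (λ le → ⊥-elim (n≮0 (subst (_≤ 0) (Node.item≡ (proj₁ (State.nodesD S₁)))
                    (does-true (nats υ itemA (nats υ xV 0) ≤? 0) le))))
          (λ _ → run-map (λ { {j} (B′ , S₂ , totals , le) → _ , record { state = S₂ ; k≡ = refl } ,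
               cost {j} {trees B′} le (trans (total-push pot {∅} {F} {B} {x} {suc v} {r} {C}) (sym (totals pot (λ _ _ _ _ → refl)))) }) (run-place S₁))
          where
          cost : ∀ {j t p p₀} → j + 4 * t ≤ 7 + 4 * trees B → p₀ ≡ p →
                 suc ((1 + suc j) + (10 * count F + (4 * t + p))) ≤ 10 * suc (count F) + (4 * trees B + p₀)
          cost {j} {t} {p} le refl = begin
            suc ((1 + suc j) + (10 * count F + (4 * t + p))) ≡⟨ solved j (count F) t p ⟩
            (3 + 10 * count F) + ((j + 4 * t) + p) ≤⟨ +-monoʳ-≤ (3 + 10 * count F) (+-monoˡ-≤ p le) ⟩
            (3 + 10 * count F) + ((7 + 4 * trees B) + p) ≡⟨ solved′ (count F) (trees B) p ⟩
            10 * suc (count F) + (4 * trees B + p) ∎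
            where
            open ≤-Reasoning
            solved : ∀ j f t p → suc ((1 + suc j) + (10 * f + (4 * t + p))) ≡ (3 + 10 * f) + ((j + 4 * t) + p)
            solved = solve-∀
            solved′ : ∀ f t p → (3 + 10 * f) + ((7 + 4 * t) + p) ≡ 10 * suc f + (4 * t + p)
            solved′ = solve-∀

      run-consolidate : ∀ {σ F} → State (record (view σ) { maxrᵛ = 0 }) ∅ F (λ _ → ∅) →
                        Run consolidate σ (λ j τ → ∃[ B ] (State (view τ) ∅ ∅ B ×
                          j + (4 * trees B + total pot ∅ ∅ B) ≤ 2 + (10 * count F + sum pot F)))
      run-consolidate {σ} {F} S = run-seq (block _ (_ , run-map
        (λ { {j} (_ , record { F = ∅ ; B = B ; state = S₁ ; k≡ = refl } , _ , le) → B , S₁ , s≤s (≤-trans le (≤-reflexive (cong suc start)))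
           ; (_ , record { F = tree _ _ _ _ _ ; state = S₁ } , done , _) →
               let _ , sp≡ , _ = State.stack S₁ in ⊥-elim (does-false (1 ≤? _) done (subst (1 ≤_) (sym sp≡) (s≤s z≤n))) })
        (run-while Consolidating (λ go c → run-consolidateBody (does-true (1 ≤? _) go) c)
          record { state = S ; k≡ = refl })))
        where
        start : 10 * count F + (4 * trees (λ _ → ∅) + total pot ∅ F (λ _ → ∅)) ≡ 10 * count F + sum pot F
        start = cong (10 * count F +_) (cong₂ (λ s t → 4 * s + (sum pot F + t)) no-trees no-trees
                ⟨ trans ⟩ +-identityʳ (sum pot F))
          where
          no-trees : sumTo (suc rank≤) (λ _ → 0) ≡ 0
          no-trees = sumTo-zero (suc rank≤) (λ _ _ → refl)

      -- Choice of the root with the least key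

      data Best (best : ℕ) : Forest → Forest → Set (ℓ₀ ⊔ ℓ₂) where
        empty : best ≡ 0 → Best best ∅ ∅
        least : ∀ {v r C F} → 0 < best → LB (Keys.dist K) (Keys.dist K v) F → Best best (tree best (suc v) r C ∅) F

      -- `count≤` is the benefit of consolidation: at most one root for each rank returns to the
      -- stack, so the next round starts with few roots. `R` is the number of slots already emptied,
      -- `P` the potential, which collecting does not change.
      record Collecting (P R : ℕ) (best : ℕ) (V : View) : Set (ℓ₀ ⊔ ℓ₂) where
        field
          {D F}   : Forest
          {B}     : ℕ → Forest
          state   : State V D F B
          cleared : ∀ j → j < R → B j ≡ ∅
          chosen   : Best best D F
          pot≡    : total pot D F B ≡ P
          count≤  : count F ≤ R

      collecting-suc : ∀ {P R best V} → (c : Collecting P R best V) → Collecting.B c R ≡ ∅ → Collecting P (suc R) best V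
      collecting-suc {R = R} c BR≡∅ = record
        { state = state
        ; cleared = λ j j<1+R → case-≤ j (m≤n⇒m<n∨m≡n (≤-pred j<1+R))
        ; chosen = chosen
        ; pot≡ = pot≡
        ; count≤ = m≤n⇒m≤1+n count≤
        }
        where
        open Collecting c
        case-≤ : ∀ j → j < R ⊎ j ≡ R → B j ≡ ∅
        case-≤ j (inj₁ j<R) = cleared j j<R
        case-≤ j (inj₂ refl) = BR≡∅

      run-take : ∀ {P R τ} → nats τ rV 0 ≡ R → ¬ nats τ slotA R ≤ 0 → Collecting P R (nats τ bestV 0) (view τ) →
                 Run collectTake τ (λ j υ → Collecting P (suc R) (nats υ bestV 0) (view υ) × j ≤ 4)
      run-take {P} {R} {τ} refl s≰0 c with Collecting.B c R in BR≡ | State.slots (Collecting.state c) R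
      ... | _ | empty s≡0 = ⊥-elim (s≰0 (≤-reflexive s≡0))
      ... | _ | holds {y} {w} {C} refl 0<y = run-seq (run-map (λ { {j} (S₁ , best≡ , x≡ , refl) → fetched chosen S₁ best≡ x≡ pot≡ count≤ }) fetch)
        where
        open Collecting c
        best = nats τ bestV 0
        B′ = upd B R ∅
        R≤ : R ≤ rank≤
        R≤ with suc rank≤ ≤? R
        ... | no ≰ = ≤-pred (≰⇒> ≰)
        ... | yes le with () ← trans (sym BR≡) (beyond state R le)
        Fetched : ℕ → Store → Set _
        Fetched j υ = State (view υ) (tree y (suc w) R C D) F B′ × nats υ bestV 0 ≡ best × nats υ xV 0 ≡ y × j ≡ 1
        fetch : Run collectFetch τ Fetched
        fetch = block collectFetch (_ ,
          take-slot state BR≡ (override-same slotA R) (λ j → override-other slotA R j) , refl , refl , refl)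
        cleared′ : ∀ j → j < suc R → B′ j ≡ ∅
        cleared′ j j≤R = upd-elim (_≡ ∅) R j (λ _ → refl) (λ R≢j → cleared j (≤∧≢⇒< (≤-pred j≤R) (λ eq → R≢j (sym eq))))
        fetched : ∀ {D F υ} → Best best D F → State (view υ) (tree y (suc w) R C D) F B′ → nats υ bestV 0 ≡ best → nats υ xV 0 ≡ y →
                  total pot D F B ≡ P → count F ≤ R →
                  Run (if var bestV ≤ⁿ lit 0 then bestV ≔ var xV else (collectCompare ⨾ push xV)) υ
                      (λ j φ → Collecting P (suc R) (nats φ bestV 0) (view φ) × 1 + j ≤ 4)
        fetched {υ = υ} (empty b≡0) S₁ best≡ x≡ pot≡ count≤ = run-if
          (λ _ → block _ (_ , record
            { state = S₁
            ; cleared = cleared′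
            ; chosen = subst (λ b → Best b (tree y (suc w) R C ∅) ∅) (sym x≡) (least 0<y tt)
            ; pot≡ = trans (total-take pot {∅} {∅} {B} R≤ BR≡) pot≡
            ; count≤ = z≤n
            } , s≤s (s≤s (s≤s z≤n))))
          (λ gt → ⊥-elim (does-false (nats υ bestV 0 ≤? 0) gt (≤-reflexive (trans best≡ b≡0))))
        fetched {F = F} {υ = υ} (least {v} {r′} {C′} 0<b lb) S₁ best≡ x≡ pot≡ count≤ = run-if
          (λ le → ⊥-elim (<⇒≱ 0<b (subst (_≤ 0) best≡ (does-true (nats υ bestV 0 ≤? 0) le))))
          (λ _ → run-seq (run-map (λ { {j} {φ} (v , r , C , w , r′ , C′ , S₂ , v≤w , b>0 , lbF , lbC , pot≡ , refl) →
            block (push xV) (_ , record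
              { state = push-first S₂ (+-comm (nats φ spV 0) 1) (override-same stackA (nats φ spV 0))
                          (λ i → override-other stackA (nats φ spV 0) i)
              ; cleared = cleared′
              ; chosen = least b>0 ((λ { _ refl → v≤w }) , lbC , lbF)
              ; pot≡ = trans (total-push pot {tree (nats φ bestV 0) (suc v) r C ∅} {F} {B′} {nats φ xV 0} {suc w} {r′} {C′}) pot≡
              ; count≤ = s≤s count≤
              } , ≤-refl) }) compared))
          where
          keyb : lens υ distA (nats υ itemA (nats υ bestV 0) ∸ 1) ≡ Keys.dist K v
          keyb = trans (cong (λ b → lens υ distA (nats υ itemA b ∸ 1)) best≡) (key≡ {υ} S₁ (proj₁ (proj₂ (proj₂ (State.nodesD S₁)))))
          keyx : lens υ distA (nats υ itemA (nats υ xV 0) ∸ 1) ≡ Keys.dist K w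
          keyx = trans (cong (λ b → lens υ distA (nats υ itemA b ∸ 1)) x≡) (key≡ {υ} S₁ (proj₁ (State.nodesD S₁)))
          total≡ : total pot (tree y (suc w) R C (tree best (suc v) r′ C′ ∅)) F B′ ≡ P
          total≡ = trans (total-take pot {tree best (suc v) r′ C′ ∅} {F} {B} R≤ BR≡) pot≡
          compared : Run collectCompare υ (λ j φ → ∃[ v ] ∃[ r ] ∃[ C ] ∃[ w ] ∃[ r′ ] ∃[ C′ ]
            (let D = tree (nats φ xV 0) (suc w) r′ C′ (tree (nats φ bestV 0) (suc v) r C ∅) in
             State (view φ) D F B′ × Keys.dist K v L.≤ Keys.dist K w × 0 < nats φ bestV 0 ×
             LB (Keys.dist K) (Keys.dist K v) F × LB (Keys.dist K) (Keys.dist K v) C′ × total pot D F B′ ≡ P × j ≡ 1))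
          compared = block collectCompare
            ( (λ le → _ , v , r′ , C′ , w , R , C ,
                let v≤w = subst₂ L._≤_ keyb keyx (does-true (lens υ distA (nats υ itemA (nats υ bestV 0) ∸ 1) L.≤? _) le) in
                subst₂ (λ x′ b′ → State (view υ) (tree x′ (suc w) R C (tree b′ (suc v) r′ C′ ∅)) F B′) (sym x≡) (sym best≡) S₁ ,
                v≤w , subst (0 <_) (sym best≡) 0<b , lb ,
                LB-trans C v≤w (Node.order (proj₁ (State.nodesD S₁)) w refl) ,
                subst₂ (λ x′ b′ → total pot (tree x′ (suc w) R C (tree b′ (suc v) r′ C′ ∅)) F B′ ≡ P) (sym x≡) (sym best≡) total≡ , refl)
            , (λ gt → _ , w , R , C , v , r′ , C′ ,
                let w≤v = ≰⇒≥ˡ (subst₂ (λ d e → ¬ d L.≤ e) keyb keyx (does-false (lens υ distA (nats υ itemA (nats υ bestV 0) ∸ 1) L.≤? _) gt)) in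
                subst₂ (λ x′ b′ → State (view υ) (tree b′ (suc v) r′ C′ (tree x′ (suc w) R C ∅)) F B′) (sym x≡) (sym best≡) (swap-first S₁) ,
                w≤v , subst (0 <_) (sym x≡) 0<y , LB-trans F w≤v lb ,
                LB-trans C′ w≤v (Node.order (proj₁ (proj₂ (proj₂ (State.nodesD S₁)))) v refl) ,
                subst₂ (λ x′ b′ → total pot (tree b′ (suc v) r′ C′ (tree x′ (suc w) R C ∅)) F B′ ≡ P) (sym x≡) (sym best≡)
                  (trans (total-swap pot {F} {B′} {y} {suc w} {R} {C} {best} {suc v} {r′} {C′}) total≡) , refl) )

      -- A slot takes at most 7 ticks: the loop test, up to 5 for the branching with `collectTake`,
      -- and the increment.
      run-collect : ∀ {σ B} → State (view σ) ∅ ∅ B →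
                    Run collect σ (λ j τ → ∃[ R ] (Collecting (total pot ∅ ∅ B) R (nats τ bestV 0) (view τ) ×
                      nats τ maxrV 0 < R × R ≤ suc rank≤ × j ≤ 2 + 7 * suc rank≤))
      run-collect {σ} {B} S = run-seq (block _ (_ , run-map
        (λ { {j} {τ} (_ , (R , c , refl , R≤ , refl) , done , le) → R , c ,
             ≰⇒> (does-false (_ ≤? _) done) , ≤-trans R≤ (s≤s (State.maxr≤ (Collecting.state c))) ,
             s≤s (≤-trans (m≤m+n j _) (≤-trans le (s≤s (*-monoʳ-≤ 7 (s≤s (State.maxr≤ S)))))) })
        (run-while Inv body
          (0 , record { state = S ; cleared = λ _ () ; chosen = empty refl ; pot≡ = refl ; count≤ = z≤n } , refl , z≤n , refl))))
        where
        M = nats σ maxrV 0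
        Inv : ℕ → Store → Set _
        Inv k τ = ∃[ R ] (Collecting (total pot ∅ ∅ B) R (nats τ bestV 0) (view τ) × nats τ rV 0 ≡ R ×
                    R ≤ suc (nats τ maxrV 0) × k ≡ 7 * (suc (nats τ maxrV 0) ∸ R))
        body : ∀ {k τ} → test (var rV ≤ⁿ var maxrV) τ ≡ true → Inv k τ →
               Run collectBody τ (λ j υ → ∃[ k′ ] (Inv k′ υ × suc (j + k′) ≤ k))
        body {τ = τ} go (R , c , refl , R≤ , refl) = run-seq (run-map
          (λ { {j} {υ} ((c′ , j≤) , fr) →
             let r≡ = cong-app (Framed.nats≡ fr rV) 0
                 m≡ = cong-app (Framed.nats≡ fr maxrV) 0 in
             block _ (_ , _ , (suc R , c′ , trans (cong (_+ 1) r≡) (+-comm R 1) ,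
               s≤s (subst (R ≤_) (sym m≡) R≤M) , refl) ,
               (begin
                 suc ((j + 1) + 7 * (nats υ maxrV 0 ∸ R)) ≡⟨ cong (λ m → suc ((j + 1) + 7 * (m ∸ R))) m≡ ⟩
                 suc ((j + 1) + 7 * (nats τ maxrV 0 ∸ R)) ≤⟨ s≤s (+-monoˡ-≤ (7 * (nats τ maxrV 0 ∸ R)) (+-monoˡ-≤ 1 j≤)) ⟩
                 7 + 7 * (nats τ maxrV 0 ∸ R) ≡⟨ *-suc 7 (nats τ maxrV 0 ∸ R) ⟨
                 7 * suc (nats τ maxrV 0 ∸ R) ≡⟨ cong (7 *_) (+-∸-assoc 1 R≤M) ⟨
                 7 * (suc (nats τ maxrV 0) ∸ R) ∎)) })
          (run-framed (run-if {Q = λ j υ → Collecting (total pot ∅ ∅ B) (suc R) (nats υ bestV 0) (view υ) × j ≤ 5}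
            (λ le → block skip (_ , collecting-suc c (slot-none (State.slots (Collecting.state c) R)
               (n≤0⇒n≡0 (does-true (nats τ slotA R ≤? 0) le))) , s≤s (s≤s z≤n)))
            (λ gt → run-map (λ (c′ , le) → c′ , s≤s le) (run-take refl (does-false (nats τ slotA R ≤? 0) gt) c)))))
          where
          open ≤-Reasoning
          R≤M : R ≤ nats τ maxrV 0
          R≤M = does-true (nats τ rV 0 ≤? nats τ maxrV 0) go
          slot-none : ∀ {T} → Slot (nats τ slotA R) R T → nats τ slotA R ≡ 0 → T ≡ ∅
          slot-none s eq = slot-empty eq s

  -- Networks that represent a labelled graph

  module _ (G : LabeledGraph Γ) (ℓ : Fin (LabeledGraph.m G) → L.Carrier) where
    open LabeledGraph G using () renaming (n to order)
    open Walks G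

    record Arc (N : Network) (eid : ℕ → ℕ) (b : ℕ) {e u v} (j : Joins e u v) : Set (a₁ ⊔ ℓ₀) where
      constructor arc
      open Network N
      field
        from≡ : from b ≡ toℕ u
        to≡   : to b ≡ toℕ v
        eid≡  : eid b ≡ toℕ e
        lab≡  : lab b ≡ ψₑ e j
        wgt≡  : wgt b ≡ ℓ e

    record Represents (N : Network) (eid : ℕ → ℕ) : Set (a₁ ⊔ ℓ₀) where
      open Network N
      field
        order≡ : n ≡ order
        arcs   : ∀ {b} → b < na → ∃[ e ] ∃[ u ] ∃[ v ] Σ[ j ∈ Joins e u v ] Arc N eid b j
        joins  : ∀ {e u v} (j : Joins e u v) → ∃[ b ] (b < na × Arc N eid b j)

    flip : ∀ {e u v} → Joins e u v → Joins e v u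
    flip (inj₁ (p , q)) = inj₂ (p , q)
    flip (inj₂ (p , q)) = inj₁ (p , q)

  module Search (N : Network) (s rank≤ : ℕ) (rank-bound : ∀ r → pow r ≤ 2 + Network.na N → r ≤ rank≤) where
    open Network N

    -- Dijkstra's algorithm

    record Parent (Λ : Labels) (v b : ℕ) : Set (a₁ ⊔ ℓ₀) where
      constructor parent
      open Labels Λ
      field
        b<na    : b < na
        to≡     : to b ≡ v
        settled : mark (from b) ≡ 2
        dep≡    : dep v ≡ suc (dep (from b))
        dist≡   : dist v ≡ dist (from b) L.+ wgt b
        val≡    : val v ≡ val (from b) Γ.∙ lab b

    Relaxed : Labels → ℕ → Set ℓ₂
    Relaxed Λ b = mark (to b) ≢ 0 × dist (to b) L.≤ dist (from b) L.+ wgt b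
      where open Labels Λ

    record Tree (Λ : Labels) (todo : List ℕ) : Set (a₁ ⊔ ℓ₀ ⊔ ℓ₂) where
      open Labels Λ
      field
        root    : mark s ≢ 0 × dist s L.≤ L.0#
        parents : ∀ {v} → v < n → mark v ≢ 0 → (v ≡ s × dep v ≡ 0) ⊎ Parent Λ v (par v)
        nonneg  : ∀ {v} → v < n → mark v ≢ 0 → L.0# L.≤ dist v
        mark≤2  : ∀ {v} → v < n → mark v ≤ 2
        ordered : ∀ {v w} → v < n → w < n → mark v ≡ 2 → mark w ≡ 1 → dist v L.≤ dist w
        relaxed : ∀ {b} → b < na → mark (from b) ≡ 2 → b ∈ todo ⊎ Relaxed Λ b
        depth₁  : ∀ {v} → v < n → mark v ≡ 1 → dep v + openSum n (λ _ → 1) mark ≤ n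
        depth₂  : ∀ {v} → v < n → mark v ≡ 2 → suc (dep v) + openSum n (λ _ → 1) mark ≤ n

    -- Vertices are settled in order of distance, so while the arcs out of u are relaxed no settled
    -- vertex is farther than u.
    record Last (Λ : Labels) (u : ℕ) : Set (ℓ₂) where
      open Labels Λ
      field
        u<n     : u < n
        mark-u  : mark u ≡ 2
        latest  : ∀ {v} → v < n → mark v ≡ 2 → dist v L.≤ dist u

    ≤+wgt : ∀ {b} d → b < na → d L.≤ d L.+ wgt b
    ≤+wgt {b} d b<na = LO.trans (LO.reflexive (L.sym (L.+-identityˡ d)))
      (LO.trans (L.+-monoˡ-≤ L.0# (wgt b) d (wgt≥0 b<na)) (LO.reflexive (L.+-comm (wgt b) d)))

    parent-same : ∀ {Λ Λ′ v b} → SameLabel Λ Λ′ v → SameLabel Λ Λ′ (from b) → Parent Λ v b → Parent Λ′ v b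
    parent-same e f p = parent b<na to≡ (trans (sym (SameLabel.mark f)) settled)
        (trans (sym (SameLabel.dep e)) (trans dep≡ (cong suc (SameLabel.dep f))))
        (trans (sym (SameLabel.dist e)) (trans dist≡ (cong (L._+ _) (SameLabel.dist f))))
        (trans (sym (SameLabel.val e)) (trans val≡ (cong (Γ._∙ _) (SameLabel.val f))))
      where open Parent p

    2≢1 : ∀ {k} → k ≡ 2 → k ≡ 1 → ⊥
    2≢1 refl ()

    below-2 : ∀ k → k ≤ 2 → k ≢ 0 → k ≢ 2 → k ≡ 1
    below-2 0 _ k≢0 _ = ⊥-elim (k≢0 refl)
    below-2 1 _ _ _ = refl
    below-2 2 _ _ k≢2 = ⊥-elim (k≢2 refl)
    below-2 (suc (suc (suc _))) (s≤s (s≤s ())) _ _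

    tree-skip : ∀ {Λ b todo} → Tree Λ (b ∷ todo) → Relaxed Λ b → Tree Λ todo
    tree-skip {Λ} {b} {todo} t r = record
      { root = root ; parents = parents ; nonneg = nonneg ; mark≤2 = mark≤2 ; ordered = ordered
      ; relaxed = λ {b′} b′<na m → rest b′ (relaxed b′<na m)
      ; depth₁ = depth₁ ; depth₂ = depth₂ }
      where
      open Tree t
      rest : ∀ b′ → b′ ∈ b ∷ todo ⊎ Relaxed Λ b′ → b′ ∈ todo ⊎ Relaxed Λ b′
      rest b′ (inj₁ (here refl)) = inj₂ r
      rest b′ (inj₁ (there p))   = inj₁ p
      rest b′ (inj₂ r)           = inj₂ r

    -- The vertex v is reached anew, or nearer, through the arc b.

    module Update {Λ Λ′ : Labels} {b : ℕ} {todo} (b<na : b < na) (t : Tree Λ (b ∷ todo)) (last : Last Λ (from b))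
                  (closer : Labels.mark Λ (to b) ≢ 0 →
                            ¬ Labels.dist Λ (to b) L.≤ Labels.dist Λ (from b) L.+ wgt b)
                  (others : ∀ x → x ≢ to b → SameLabel Λ Λ′ x)
                  (mark≡ : Labels.mark Λ′ (to b) ≡ 1)
                  (dep≡  : Labels.dep Λ′ (to b) ≡ suc (Labels.dep Λ (from b)))
                  (par≡  : Labels.par Λ′ (to b) ≡ b)
                  (dist≡ : Labels.dist Λ′ (to b) ≡ Labels.dist Λ (from b) L.+ wgt b)
                  (val≡  : Labels.val Λ′ (to b) ≡ Labels.val Λ (from b) Γ.∙ lab b) where
      open Tree t
      open Last last
      private
        module Λ = Labels Λ
        module Λ′ = Labels Λ′
        u = from b
        v = to b
        cand = Λ.dist u L.+ wgt b

      v<n : v < n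
      v<n = to< b<na

      -- A settled v would be no farther than u, hence no farther than the candidate, which adds a
      -- nonnegative length; this contradicts `closer`.
      unsettled : Λ.mark v ≢ 2
      unsettled m = closer (λ m≡0 → 0≢2 (trans (sym m≡0) m)) (LO.trans (latest v<n m) (≤+wgt _ b<na))
        where
        0≢2 : 0 ≢ 2
        0≢2 ()

      unaltered : ∀ {x} → Λ.mark x ≡ 2 → SameLabel Λ Λ′ x
      unaltered {x} m = others x (λ { refl → unsettled m })

      settled-before : ∀ {x} → Λ′.mark x ≡ 2 → Λ.mark x ≡ 2
      settled-before {x} m with x ≟ v
      ... | yes refl = ⊥-elim (2≢1 m mark≡)
      ... | no x≢v   = trans (SameLabel.mark (others x x≢v)) m

      open≡ : ∀ x → open₀ (Λ′.mark x) ≡ open₀ (Λ.mark x) ⊎ v ≡ x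
      open≡ x with v ≟ x
      ... | yes eq = inj₂ eq
      ... | no v≢x = inj₁ (cong open₀ (sym (SameLabel.mark (others x (λ eq → v≢x (sym eq))))))

      openSum≡ : ∀ w → openSum n w Λ′.mark ≡ openSum n w Λ.mark
      openSum≡ w = sumTo-cong n (λ x x<n → cong (_* w x) (eq x))
        where
        case₂ : ∀ k → k ≤ 2 → k ≢ 2 → open₀ k ≡ 1
        case₂ 0 _ _ = refl
        case₂ 1 _ _ = refl
        case₂ 2 _ k≢2 = ⊥-elim (k≢2 refl)
        case₂ (suc (suc (suc _))) (s≤s (s≤s ())) _
        eq : ∀ x → open₀ (Λ′.mark x) ≡ open₀ (Λ.mark x)
        eq x with open≡ x
        ... | inj₁ e = e
        ... | inj₂ refl = trans (cong open₀ mark≡) (sym (case₂ (Λ.mark v) (mark≤2 v<n) unsettled))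

      last′ : Last Λ′ u
      last′ = record
        { u<n = u<n
        ; mark-u = trans (sym (SameLabel.mark (unaltered mark-u))) mark-u
        ; latest = λ x<n m → subst₂ L._≤_ (SameLabel.dist (unaltered (settled-before m))) (SameLabel.dist (unaltered mark-u))
                              (latest x<n (settled-before m))
        }

      -- Arcs into v only gain from its smaller distance, and arcs out of v are not concerned
      -- because v is unsettled.
      relaxed-still : ∀ {b′} → Λ.mark (from b′) ≡ 2 → Relaxed Λ b′ → Relaxed Λ′ b′
      relaxed-still {b′} m (seen , le) with to b′ ≟ v
      ... | no ≢v = (λ m′ → seen (trans (SameLabel.mark (others _ ≢v)) m′)) ,
            subst₂ L._≤_ (SameLabel.dist (others _ ≢v)) (cong (L._+ wgt b′) (SameLabel.dist (unaltered m))) le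
      ... | yes ≡v = (λ m′ → 1≢0 (trans (sym mark≡) (trans (cong Λ′.mark (sym ≡v)) m′))) ,
            subst₂ L._≤_ (trans (sym dist≡) (cong Λ′.dist (sym ≡v))) (cong (L._+ wgt b′) (SameLabel.dist (unaltered m)))
              (LO.trans nearer le)
        where
        1≢0 : 1 ≢ 0
        1≢0 ()
        nearer : cand L.≤ Λ.dist (to b′)
        nearer with LO.total cand (Λ.dist (to b′))
        ... | inj₁ p = p
        ... | inj₂ p = ⊥-elim (closer (λ m → seen (trans (cong Λ.mark ≡v) m)) (subst (λ x → Λ.dist x L.≤ cand) ≡v p))

      relaxed-now : Relaxed Λ′ b
      relaxed-now = (λ m → 1≢0 (trans (sym mark≡) m)) ,
                    LO.reflexive (L.reflexive (trans dist≡ (cong (L._+ wgt b) (SameLabel.dist (unaltered mark-u)))))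
        where
        1≢0 : 1 ≢ 0
        1≢0 ()

      tree-update : Tree Λ′ todo
      tree-update = record
        { root    = root′
        ; parents = parents′
        ; nonneg  = nonneg′
        ; mark≤2  = mark≤2′
        ; ordered = ordered′
        ; relaxed = λ {b′} b′<na m → relaxed′ b′ (settled-before m) (relaxed b′<na (settled-before m))
        ; depth₁  = depth₁′
        ; depth₂  = λ {x} x<n m → subst (_≤ n) (cong₂ (λ d U → suc d + U)
                       (SameLabel.dep (unaltered (settled-before m))) (sym (openSum≡ (λ _ → 1)))) (depth₂ x<n (settled-before m))
        }
        where
        cand≥0 : L.0# L.≤ cand
        cand≥0 = LO.trans (nonneg u<n (λ m → 0≢2 (trans (sym m) mark-u))) (≤+wgt _ b<na)
          where
          0≢2 : 0 ≢ 2
          0≢2 ()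
        root′ : Λ′.mark s ≢ 0 × Λ′.dist s L.≤ L.0#
        root′ with s ≟ v
        ... | no s≢v = (λ m → proj₁ root (trans (SameLabel.mark (others s s≢v)) m)) ,
                       subst (L._≤ L.0#) (SameLabel.dist (others s s≢v)) (proj₂ root)
        ... | yes s≡v = ⊥-elim (closer (λ m → proj₁ root (trans (cong Λ.mark s≡v) m))
                          (LO.trans (subst (λ x → Λ.dist x L.≤ L.0#) s≡v (proj₂ root)) cand≥0))
        parents′ : ∀ {x} → x < n → Λ′.mark x ≢ 0 → (x ≡ s × Λ′.dep x ≡ 0) ⊎ Parent Λ′ x (Λ′.par x)
        parents′ {x} x<n m with x ≟ v
        ... | yes refl = inj₂ (subst (Parent Λ′ v) (sym par≡) (parent b<na refl
                (trans (sym (SameLabel.mark (unaltered mark-u))) mark-u)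
                (trans dep≡ (cong suc (SameLabel.dep (unaltered mark-u))))
                (trans dist≡ (cong (L._+ wgt b) (SameLabel.dist (unaltered mark-u))))
                (trans val≡ (cong (Γ._∙ lab b) (SameLabel.val (unaltered mark-u))))))
        ... | no x≢v with parents x<n (λ m′ → m (trans (sym (SameLabel.mark (others x x≢v))) m′))
        ... | inj₁ (x≡s , d) = inj₁ (x≡s , trans (sym (SameLabel.dep (others x x≢v))) d)
        ... | inj₂ p = inj₂ (subst (Parent Λ′ x) (SameLabel.par (others x x≢v))
                         (parent-same {Λ} {Λ′} (others x x≢v) (unaltered (Parent.settled p)) p))
        nonneg′ : ∀ {x} → x < n → Λ′.mark x ≢ 0 → L.0# L.≤ Λ′.dist x
        nonneg′ {x} x<n m with x ≟ v
        ... | yes refl = subst (L.0# L.≤_) (sym dist≡) cand≥0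
        ... | no x≢v = subst (L.0# L.≤_) (SameLabel.dist (others x x≢v))
                         (nonneg x<n (λ m′ → m (trans (sym (SameLabel.mark (others x x≢v))) m′)))
        mark≤2′ : ∀ {x} → x < n → Λ′.mark x ≤ 2
        mark≤2′ {x} x<n with x ≟ v
        ... | yes refl = subst (_≤ 2) (sym mark≡) (s≤s z≤n)
        ... | no x≢v = subst (_≤ 2) (SameLabel.mark (others x x≢v)) (mark≤2 x<n)
        ordered′ : ∀ {x w} → x < n → w < n → Λ′.mark x ≡ 2 → Λ′.mark w ≡ 1 → Λ′.dist x L.≤ Λ′.dist w
        ordered′ {x} {w} x<n w<n m m′ with w ≟ v
        ... | yes refl = subst₂ L._≤_ (SameLabel.dist (unaltered (settled-before m))) (sym dist≡)
                           (LO.trans (latest x<n (settled-before m)) (≤+wgt _ b<na))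
        ... | no w≢v = subst₂ L._≤_ (SameLabel.dist (unaltered (settled-before m))) (SameLabel.dist (others w w≢v))
                         (ordered x<n w<n (settled-before m) (trans (SameLabel.mark (others w w≢v)) m′))
        relaxed′ : ∀ b′ → Λ.mark (from b′) ≡ 2 → b′ ∈ b ∷ todo ⊎ Relaxed Λ b′ → b′ ∈ todo ⊎ Relaxed Λ′ b′
        relaxed′ b′ m (inj₁ (here refl)) = inj₂ relaxed-now
        relaxed′ b′ m (inj₁ (there p))   = inj₁ p
        relaxed′ b′ m (inj₂ r)           = inj₂ (relaxed-still m r)
        depth₁′ : ∀ {x} → x < n → Λ′.mark x ≡ 1 → Λ′.dep x + openSum n (λ _ → 1) Λ′.mark ≤ n
        depth₁′ {x} x<n m with x ≟ v
        ... | yes refl = subst (_≤ n) (cong₂ _+_ (sym dep≡) (sym (openSum≡ (λ _ → 1)))) (depth₂ u<n mark-u)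
        ... | no x≢v = subst (_≤ n) (cong₂ _+_ (SameLabel.dep (others x x≢v)) (sym (openSum≡ (λ _ → 1))))
                         (depth₁ x<n (trans (SameLabel.mark (others x x≢v)) m))

    module Settle {Λ : Labels} {mark′ : ℕ → ℕ} {u : ℕ} (t : Tree Λ []) (u<n : u < n) (mark-u : Labels.mark Λ u ≡ 1)
                  (least : ∀ {v} → v < n → Labels.mark Λ v ≡ 1 → Labels.dist Λ u L.≤ Labels.dist Λ v)
                  (mark-u′ : mark′ u ≡ 2) (others : ∀ v → v ≢ u → mark′ v ≡ Labels.mark Λ v) where
      open Tree t
      open Labels Λ
      Λ′ = labels mark′ dep par dist val

      reached-before : ∀ {v} → mark′ v ≢ 0 → mark v ≢ 0
      reached-before {v} m m′ with v ≟ u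
      ... | yes refl = 1≢0 (trans (sym mark-u) m′)
        where
        1≢0 : 1 ≢ 0
        1≢0 ()
      ... | no v≢u   = m (trans (others v v≢u) m′)

      one-before : ∀ {v} → mark′ v ≡ 1 → mark v ≡ 1
      one-before {v} m with v ≟ u
      ... | yes refl = ⊥-elim (2≢1 mark-u′ m)
      ... | no v≢u   = trans (sym (others v v≢u)) m

      settled-still : ∀ {v} → mark v ≡ 2 → mark′ v ≡ 2
      settled-still {v} m = trans (others v (λ { refl → 2≢1 m mark-u })) m

      settled-cases : ∀ {v} → mark′ v ≡ 2 → v ≡ u ⊎ mark v ≡ 2
      settled-cases {v} m with v ≟ u
      ... | yes eq = inj₁ eq
      ... | no v≢u = inj₂ (trans (sym (others v v≢u)) m)

      openSum-u : ∀ w → openSum n w mark′ + w u ≡ openSum n w mark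
      openSum-u w = openSum-settle n w u u<n mark-u mark-u′ others

      last′ : Last Λ′ u
      last′ = record { u<n = u<n ; mark-u = mark-u′ ; latest = λ {v} v<n m → before v<n (settled-cases m) }
        where
        before : ∀ {v} → v < n → v ≡ u ⊎ mark v ≡ 2 → dist v L.≤ dist u
        before v<n (inj₁ refl) = LO.refl
        before v<n (inj₂ m)    = ordered v<n u<n m mark-u

      tree-settle : Tree Λ′ (adj u)
      tree-settle = record
        { root    = (λ m → proj₁ root (zero-before m)) , proj₂ root
        ; parents = λ v<n m → map-parent (parents v<n (reached-before m))
        ; nonneg  = λ v<n m → nonneg v<n (reached-before m)
        ; mark≤2  = λ {v} v<n → mark≤2′ v v<n
        ; ordered = λ v<n w<n m m′ → ordered′ v<n w<n (settled-cases m) (one-before m′)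
        ; relaxed = λ {b} b<na m → relaxed′ b<na (settled-cases m)
        ; depth₁  = λ v<n m → ≤-trans (+-monoʳ-≤ _ (≤-trans (n≤1+n _) (≤-reflexive suc-U))) (depth₁ v<n (one-before m))
        ; depth₂  = λ v<n m → depth₂′ v<n (settled-cases m)
        }
        where
        U′ = openSum n (λ _ → 1) mark′
        suc-U : suc U′ ≡ openSum n (λ _ → 1) mark
        suc-U = trans (+-comm 1 U′) (openSum-u (λ _ → 1))
        zero-before : ∀ {v} → mark′ v ≡ 0 → mark v ≡ 0
        zero-before {v} m with v ≟ u
        ... | no v≢u   = trans (sym (others v v≢u)) m
        ... | yes refl with () ← trans (sym mark-u′) m
        map-parent : ∀ {v} → (v ≡ s × dep v ≡ 0) ⊎ Parent Λ v (par v) → (v ≡ s × dep v ≡ 0) ⊎ Parent Λ′ v (par v)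
        map-parent (inj₁ p) = inj₁ p
        map-parent (inj₂ (parent b<na to≡ m d e f)) = inj₂ (parent b<na to≡ (settled-still m) d e f)
        mark≤2′ : ∀ v → v < n → mark′ v ≤ 2
        mark≤2′ v v<n with v ≟ u
        ... | yes refl = ≤-reflexive mark-u′
        ... | no v≢u   = subst (_≤ 2) (sym (others v v≢u)) (mark≤2 v<n)
        ordered′ : ∀ {v w} → v < n → w < n → v ≡ u ⊎ mark v ≡ 2 → mark w ≡ 1 → dist v L.≤ dist w
        ordered′ v<n w<n (inj₁ refl) m = least w<n m
        ordered′ v<n w<n (inj₂ m′) m   = ordered v<n w<n m′ m
        relaxed′ : ∀ {b} → b < na → from b ≡ u ⊎ mark (from b) ≡ 2 → b ∈ adj u ⊎ Relaxed Λ′ b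
        relaxed′ b<na (inj₁ refl) = inj₁ (adj-complete b<na)
        relaxed′ b<na (inj₂ m) with relaxed b<na m
        ... | inj₂ (r , le) = inj₂ ((λ m → r (zero-before m)) , le)
        depth₂′ : ∀ {v} → v < n → v ≡ u ⊎ mark v ≡ 2 → suc (dep v) + U′ ≤ n
        depth₂′ {v} v<n (inj₁ refl) = subst (_≤ n) (trans (cong (dep v +_) (sym suc-U)) (+-suc (dep v) U′)) (depth₁ v<n mark-u)
        depth₂′ {v} v<n (inj₂ m) =
          ≤-trans (+-monoʳ-≤ (suc (dep v)) (≤-trans (n≤1+n _) (≤-reflexive suc-U))) (depth₂ v<n m)

    -- The heap between its operations

    open Heaps n (2 + na) rank≤ rank-bound

    -- `items` says at once that a vertex of mark 1 is held by exactly one node and any other vertex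
    -- by none. Node numbers are not reused, so `size<` turns a count of creations into a bound on
    -- the size.
    record Resting (V : View) (fresh : ℕ) (F : Forest) : Set (ℓ₀ ⊔ ℓ₂) where
      open View V
      field
        stack   : Stack stackᵛ spᵛ F
        slots   : ∀ r → slotᵛ r ≡ 0
        nodes   : AllN (Node cellsᵛ keysᵛ) F
        once    : ∀ y → sum (occ y) F ≤ 1
        fresh∉  : ∀ y → fresh ≤ y → sum (occ y) F ≡ 0
        zero∉   : sum (occ 0) F ≡ 0
        fresh>0 : 0 < fresh
        size<   : sum size F < fresh
        items   : ∀ v → v < n → sum (has v) F ≡ δ 1 (Keys.mark keysᵛ v)

    -- All of the heap but the new node fresh for v, whose children are to be C.

    record Pending (V : View) (fresh v : ℕ) (bound : L.Carrier) (F : Forest) (r : ℕ) (C : Forest) : Set (ℓ₀ ⊔ ℓ₂) where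
      open View V
      field
        stack   : Stack stackᵛ spᵛ F
        slots   : ∀ r → slotᵛ r ≡ 0
        nodesF  : AllN (Node cellsᵛ keysᵛ) F
        nodesC  : AllN (Node cellsᵛ keysᵛ) C
        once    : ∀ y → sum (occ y) F + sum (occ y) C ≤ 1
        fresh∉  : ∀ y → fresh ≤ y → sum (occ y) F + sum (occ y) C ≡ 0
        zero∉   : sum (occ 0) F + sum (occ 0) C ≡ 0
        fresh>0 : 0 < fresh
        size<   : sum size F + sum size C < fresh
        items   : ∀ w → w < n → w ≢ v → sum (has w) F + sum (has w) C ≡ δ 1 (Keys.mark keysᵛ w)
        item-v  : sum (has v) F + sum (has v) C ≡ 0
        links   : Links (Cells.sib cellsᵛ) (Cells.child cellsᵛ fresh) C
        cnt≡    : Cells.cnt cellsᵛ fresh ≡ count C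
        ranks   : Ranks r C
        whole   : r ≤ count C
        lower   : LB (Keys.dist keysᵛ) bound C

    positive-≢ : ∀ {f : ℕ → Weight} {F x y} → (0 < sum (f y) F) → sum (f x) F ≡ 0 → y ≢ x
    positive-≢ p eq refl = <-irrefl (sym eq) p

    -- This is why the heap is considered between the loss of the old node of v and the creation of
    -- the new one: no node holds v then, so its key can change without harm to the heap order.
    pending-keys : ∀ {V fresh v d F r C K′} → Pending V fresh v d F r C →
                   (∀ w → w ≢ v → SameKey (View.keysᵛ V) K′ w) → Pending (record V { keysᵛ = K′ }) fresh v d F r C
    pending-keys {V} {fresh} {v} {d} {F} {r} {C} {K′} p off = record
      { stack   = stack
      ; slots   = slots
      ; nodesF  = nodes-keys F (λ w w∈ → off w (positive-≢ {has} {F} w∈ (m+n≡0⇒m≡0 _ item-v))) nodesF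
      ; nodesC  = nodes-keys C offC nodesC
      ; once    = once
      ; fresh∉  = fresh∉
      ; zero∉   = zero∉
      ; fresh>0 = fresh>0
      ; size<   = size<
      ; items   = λ w w<n w≢v → trans (items w w<n w≢v) (cong (δ 1) (SameKey.mark (off w w≢v)))
      ; item-v  = item-v
      ; links   = links
      ; cnt≡    = cnt≡
      ; ranks   = ranks
      ; whole   = whole
      ; lower   = LB-cong C (λ w w∈ → SameKey.dist (offC w w∈)) lower
      }
      where
      open Pending p
      offC : ∀ w → 0 < sum (has w) C → SameKey (View.keysᵛ V) K′ w
      offC w w∈ = off w (positive-≢ {has} {C} w∈ (m+n≡0⇒n≡0 (sum (has v) F) item-v))

    pending-attach : ∀ {V fresh v d F r C} {item node st : ℕ → ℕ} {sp fresh′ : ℕ} → Pending V fresh v d F r C → v < n →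
                     let open View V
                         module A = Cells cellsᵛ
                         module K = Keys keysᵛ in
                     K.mark v ≡ 1 → K.dist v ≡ d →
                     item fresh ≡ suc v → (∀ y → y ≢ fresh → item y ≡ A.item y) →
                     node v ≡ fresh → (∀ w → w ≢ v → node w ≡ K.node w) →
                     sp ≡ suc spᵛ → st spᵛ ≡ fresh → (∀ i → i ≢ spᵛ → st i ≡ stackᵛ i) → fresh′ ≡ suc fresh →
                     Resting (record V { cellsᵛ = cells item A.cnt A.child A.sib ; keysᵛ = keys node K.mark K.dist
                                    ; stackᵛ = st ; spᵛ = sp }) fresh′ (tree fresh (suc v) r C F)
    pending-attach {V} {fresh} {v} {F = F} {r} {C} {item} {node} p v<n mark≡ refl item≡ item-off node≡ node-off sp≡ top st-off refl = record
      { stack   = _ , sp≡ , top , stack-cong F (λ i i< → st-off i (<⇒≢ i<)) stack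
      ; slots   = slots
      ; nodes   = record
          { item≡ = item≡
          ; cnt≡  = cnt≡
          ; links = links
          ; shape = record { ranks = ranks ; two = ≤-trans (m⊓n≤n 2 r) whole ; whole = λ _ → whole }
          ; order = λ { _ refl → lower }
          ; full  = λ { _ refl → v<n , mark≡ , node≡ }
          } ,
          moved C (λ y → m+n≡0⇒n≡0 (sum (occ y) F)) (m+n≡0⇒n≡0 (sum (has v) F) item-v) nodesC ,
          moved F (λ y → m+n≡0⇒m≡0 (sum (occ y) F)) (m+n≡0⇒m≡0 (sum (has v) F) item-v) nodesF
      ; once    = λ y → once′ y (y ≟ fresh)
      ; fresh∉  = λ y f<y → cong₂ _+_ (δ-≢ {y} {fresh} (λ { refl → <-irrefl refl f<y }))
                    (trans (+-comm (sum (occ y) C) _) (fresh∉ y (<⇒≤ f<y)))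
      ; zero∉   = cong₂ _+_ (δ-≢ {0} {fresh} (λ { refl → n≮0 fresh>0 })) (trans (+-comm (sum (occ 0) C) _) zero∉)
      ; fresh>0 = s≤s z≤n
      ; size<   = s≤s (subst (_< fresh) (+-comm (sum size F) _) size<)
      ; items   = λ w w<n → items′ w w<n (w ≟ v)
      }
      where
      open Pending p
      A = View.cellsᵛ V
      K = View.keysᵛ V
      A′ = cells item (Cells.cnt A) (Cells.child A) (Cells.sib A)
      K′ = keys node (Keys.mark K) (Keys.dist K)
      moved : ∀ D → (∀ y → sum (occ y) F + sum (occ y) C ≡ 0 → sum (occ y) D ≡ 0) → sum (has v) D ≡ 0 →
              AllN (Node A K) D → AllN (Node A′ K′) D
      moved D none∈ has≡0 ns =
        nodes-cells D (λ y y∈ → same (sym (item-off y (positive-≢ {occ} {D} y∈ (none∈ fresh (fresh∉ fresh ≤-refl))))) refl refl refl)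
          (nodes-keys D (λ w w∈ → same (sym (node-off w (positive-≢ {has} {D} w∈ has≡0))) refl refl) ns)
      once′ : ∀ y → Dec (y ≡ fresh) → δ y fresh + (sum (occ y) C + sum (occ y) F) ≤ 1
      once′ y (yes refl) = subst (_≤ 1) (sym (cong₂ _+_ (δ-refl y)
                             (trans (+-comm (sum (occ y) C) _) (fresh∉ y ≤-refl)))) ≤-refl
      once′ y (no y≢)    = subst (_≤ 1) (sym (cong₂ _+_ (δ-≢ y≢) (+-comm (sum (occ y) C) _))) (once y)
      items′ : ∀ w → w < n → Dec (w ≡ v) → δ w v + (sum (has w) C + sum (has w) F) ≡ δ 1 (Keys.mark K w)
      items′ w w<n (yes refl) = trans (cong₂ _+_ (δ-refl w) (trans (+-comm (sum (has w) C) _) item-v)) (cong (δ 1) (sym mark≡))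
      items′ w w<n (no w≢v)   = trans (cong₂ _+_ (δ-≢ w≢v) (+-comm (sum (has w) C) _)) (items w w<n w≢v)

    pending-new : ∀ {V fresh v F} {cnt : ℕ → ℕ} {d} → Resting V fresh F → v < n → Keys.mark (View.keysᵛ V) v ≡ 0 →
                  let module A = Cells (View.cellsᵛ V) in
                  cnt fresh ≡ 0 → (∀ y → y ≢ fresh → cnt y ≡ A.cnt y) →
                  Pending (record V { cellsᵛ = cells A.item cnt A.child A.sib }) fresh v d F 0 ∅
    pending-new {F = F} h v<n mark≡ cnt≡ cnt-off = record
      { stack   = stack
      ; slots   = slots
      ; nodesF  = nodes-cells F (λ y y∈ → same refl (sym (cnt-off y (positive-≢ {occ} {F} y∈ (fresh∉ _ ≤-refl)))) refl refl) nodes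
      ; nodesC  = tt
      ; once    = λ y → subst (_≤ 1) (sym (+-identityʳ _)) (once y)
      ; fresh∉  = λ y f≤y → trans (+-identityʳ _) (fresh∉ y f≤y)
      ; zero∉   = trans (+-identityʳ _) zero∉
      ; fresh>0 = fresh>0
      ; size<   = subst (_< _) (sym (+-identityʳ _)) size<
      ; items   = λ w w<n _ → trans (+-identityʳ _) (items w w<n)
      ; item-v  = trans (+-identityʳ _) (trans (items _ v<n) (cong (δ 1) mark≡))
      ; links   = tt
      ; cnt≡    = cnt≡
      ; ranks   = []
      ; whole   = z≤n
      ; lower   = tt
      }
      where open Resting h

    -- The children behind the first two have ranks r - 3, r - 4, ..., so they are a complete set
    -- for a node of rank r - 2. They respect the new key since it is at most the old one.
    pending-steal : ∀ {V fresh v F x r C F′ d} {item cnt child : ℕ → ℕ} → Resting V fresh F → v < n →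
                    Keys.mark (View.keysᵛ V) v ≡ 1 → Cut v F x r C F′ → d L.≤ Keys.dist (View.keysᵛ V) v →
                    let module A = Cells (View.cellsᵛ V) in
                    item x ≡ 0 → (∀ y → y ≢ x → item y ≡ A.item y) →
                    cnt x ≡ count (take₂ C) → cnt fresh ≡ count (drop₂ C) → (∀ y → y ≢ x → y ≢ fresh → cnt y ≡ A.cnt y) →
                    Links A.sib (child fresh) (drop₂ C) → (∀ y → y ≢ fresh → child y ≡ A.child y) →
                    Pending (record V { cellsᵛ = cells item cnt child A.sib }) fresh v d F′ (r ∸ 2) (drop₂ C)
    pending-steal {V} {fresh} {v} {F} {x} {r} {C} {F′} {d} {item} {cnt} {child} h v<n mark≡ c d≤ item-x item-off cnt-x cnt-f cnt-off links child-off = record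
      { stack   = stack-cut c stack
      ; slots   = slots
      ; nodesF  = nodes-cut c (once x) (λ y y∈ y≢x → off y y≢x (y≢fresh y∈)) item-x cnt-x
                    (sym (child-off x (y≢fresh (cut-occ c)))) refl nodes
      ; nodesC  = nodes-cells (drop₂ C) (λ y y∈ → off y
                    (λ { refl → <⇒≱ (<-≤-trans (s≤s y∈) (δ+drop y c)) (once y) })
                    (positive-≢ {occ} {drop₂ C} y∈ (m+n≡0⇒n≡0 (sum (occ fresh) F′) (trans (occ≡ fresh) (fresh∉ fresh ≤-refl)))))
                    (AllN-drop₂ C (proj₂ node))
      ; once    = λ y → subst (_≤ 1) (sym (occ≡ y)) (once y)
      ; fresh∉  = λ y f≤y → trans (occ≡ y) (fresh∉ y f≤y)
      ; zero∉   = trans (occ≡ 0) zero∉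
      ; fresh>0 = fresh>0
      ; size<   = subst (_< fresh) (sym (flat≡ (λ _ _ → 1) refl)) size<
      ; items   = λ w w<n w≢v → trans (has≡ w w≢v) (items w w<n)
      ; item-v  = has-v
      ; links   = links
      ; cnt≡    = cnt-f
      ; ranks   = Ranks-drop₂ C (Shape.ranks shape)
      ; whole   = subst (r ∸ 2 ≤_) (sym (count-drop₂ C)) (∸-monoˡ-≤ 2 (Shape.whole shape (λ ())))
      ; lower   = LB-trans (drop₂ C) d≤ (AllN-drop₂ C (Node.order (proj₁ node) v refl))
      }
      where
      open Resting h
      node = cut-node c nodes
      shape = Node.shape (proj₁ node)
      stack-cut : ∀ {F F′ x r C st p} → Cut v F x r C F′ → Stack st p F → Stack st p F′
      stack-cut here s = s
      stack-cut (down c) s = s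
      stack-cut (side c) (q , e , e′ , s) = q , e , e′ , stack-cut c s
      y≢fresh : ∀ {y} → 0 < sum (occ y) F → y ≢ fresh
      y≢fresh y∈ = positive-≢ {occ} {F} y∈ (fresh∉ fresh ≤-refl)
      off : ∀ y → y ≢ x → y ≢ fresh → SameCell (View.cellsᵛ V) (cells item cnt child (Cells.sib (View.cellsᵛ V))) y
      off y y≢x y≢f = same (sym (item-off y y≢x)) (sym (cnt-off y y≢x y≢f)) (sym (child-off y y≢f)) refl
      flat≡ : ∀ g → g x (suc v) ≡ g x 0 → sum (flat g) F′ + sum (flat g) (drop₂ C) ≡ sum (flat g) F
      flat≡ g eq = +-cancelʳ-≡ (g x 0) _ _ (begin
        (sum (flat g) F′ + sum (flat g) (drop₂ C)) + g x 0 ≡⟨ +-assoc (sum (flat g) F′) _ _ ⟩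
        sum (flat g) F′ + (sum (flat g) (drop₂ C) + g x 0) ≡⟨ cong (sum (flat g) F′ +_) (trans (+-comm _ (g x 0)) (cong (_+ sum (flat g) (drop₂ C)) (sym eq))) ⟩
        sum (flat g) F′ + (g x (suc v) + sum (flat g) (drop₂ C)) ≡⟨ cut-sum (flat g) c ⟩
        sum (flat g) F + g x 0 ∎)
        where open ≡-Reasoning
      occ≡ : ∀ y → sum (occ y) F′ + sum (occ y) (drop₂ C) ≡ sum (occ y) F
      occ≡ y = flat≡ (λ x _ → δ y x) refl
      has≡ : ∀ w → w ≢ v → sum (has w) F′ + sum (has w) (drop₂ C) ≡ sum (has w) F
      has≡ w w≢v = flat≡ (λ _ it → δ (suc w) it) (δ-≢ w≢v)
      has-v : sum (has v) F′ + sum (has v) (drop₂ C) ≡ 0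
      has-v = suc-injective (begin
        suc (sum (has v) F′ + sum (has v) (drop₂ C)) ≡⟨ +-suc (sum (has v) F′) _ ⟨
        sum (has v) F′ + suc (sum (has v) (drop₂ C)) ≡⟨ cong (λ k → sum (has v) F′ + (k + sum (has v) (drop₂ C))) (δ-refl v) ⟨
        sum (has v) F′ + (δ v v + sum (has v) (drop₂ C)) ≡⟨ cut-sum (has v) c ⟩
        sum (has v) F + 0 ≡⟨ +-identityʳ _ ⟩
        sum (has v) F ≡⟨ items v v<n ⟩
        δ 1 (Keys.mark (View.keysᵛ V) v) ≡⟨ cong (δ 1) mark≡ ⟩
        1 ∎)
        where open ≡-Reasoning
      δ+drop : ∀ {F F′ C r} y → Cut v F y r C F′ → suc (sum (occ y) (drop₂ C)) ≤ sum (occ y) F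
      δ+drop {C = C} y (here {r = r} {S = S}) = ≤-trans (≤-reflexive (cong (_+ sum (occ y) (drop₂ C)) (sym (δ-refl y))))
        (+-monoʳ-≤ (δ y y) (≤-trans (≤-trans (m≤n+m _ (sum (occ y) (take₂ C))) (≤-reflexive (sum-split (occ y) C))) (m≤m+n _ (sum (occ y) S))))
      δ+drop y (down {z} {it} {r} {D} {S = S} c) = ≤-trans (δ+drop y c) (kids≤ (occ y) {z} {it} {r} D S)
      δ+drop y (side {z} {it} {r} {D} {S} c) = ≤-trans (δ+drop y c) (sibs≤ (occ y) {z} {it} {r} D S)

    -- Relaxation of arcs

    record At (b : ℕ) (τ : Store) : Set (ℓ₀) where
      field
        b≡    : nats τ bV 0 ≡ b
        v≡    : nats τ vV 0 ≡ to b
        u≡    : nats τ uV 0 ≡ from b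
        cand≡ : lens τ candV 0 ≡ lens τ distA (from b) L.+ wgt b

    record Labelled (b v : ℕ) (τ υ : Store) : Set (a₁ ⊔ ℓ₀) where
      field
        others : ∀ x → x ≢ v → SameLabel (labelsOf τ) (labelsOf υ) x
        mark≡  : nats υ markA v ≡ 1
        dep≡   : nats υ depA v ≡ suc (nats τ depA (from b))
        par≡   : nats υ parA v ≡ b
        dist≡  : lens υ distA v ≡ lens τ distA (from b) L.+ wgt b
        val≡   : grps υ gA v ≡ grps τ gA (from b) Γ.∙ lab b
        view≡  : view υ ≡ record (view τ) { keysᵛ = keys (nats τ nodeA) (nats υ markA) (lens υ distA) }
        fresh≡ : nats υ freshV 0 ≡ nats τ freshV 0
        v≡     : nats υ vV 0 ≡ v

    run-attachLabel : ∀ {b τ} → Static N τ → At b τ → Run attachLabel τ (λ j υ → Labelled b (to b) τ υ × j ≡ 1)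
    run-attachLabel {b} {τ} S at = block attachLabel (_ , subst (λ v → Labelled b v τ _) v≡ (record
      { others = λ x x≢v → same (sym (override-other markA v x x≢v)) (sym (override-other depA v x x≢v))
                   (sym (override-other parA v x x≢v)) (sym (override-other distA v x x≢v)) (sym (override-other gA v x x≢v))
      ; mark≡  = override-same markA v
      ; dep≡   = trans (override-same depA v) (trans (+-comm _ 1) (cong (λ u → suc (nats τ depA u)) u≡))
      ; par≡   = trans (override-same parA v) b≡
      ; dist≡  = trans (override-same distA v) cand≡
      ; val≡   = trans (override-same gA v) (cong₂ Γ._∙_ (cong (grps τ gA) u≡)
                   (trans (cong-app (Static.lab≡ S) (nats τ bV 0)) (cong lab b≡)))
      ; view≡  = refl
      ; fresh≡ = refl
      ; v≡     = refl
      }) , refl)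
      where
      open At at
      v = nats τ vV 0

    record Attaching (b : ℕ) (F : Forest) (r : ℕ) (C : Forest) (todo : List ℕ) (τ : Store) : Set (a₁ ⊔ ℓ₀ ⊔ ℓ₂) where
      field
        b<na    : b < na
        static  : Static N τ
        at      : At b τ
        pending : Pending (view τ) (nats τ freshV 0) (to b) (lens τ distA (from b) L.+ wgt b) F r C
        tree-b  : Tree (labelsOf τ) (b ∷ todo)
        last    : Last (labelsOf τ) (from b)
        closer  : nats τ markA (to b) ≢ 0 → ¬ lens τ distA (to b) L.≤ lens τ distA (from b) L.+ wgt b

    record Attached (b : ℕ) (F : Forest) (todo : List ℕ) (f : ℕ) (mark : ℕ → ℕ) (υ : Store) : Set (a₁ ⊔ ℓ₀ ⊔ ℓ₂) where
      field
        resting : Resting (view υ) (nats υ freshV 0) F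
        fresh≡  : nats υ freshV 0 ≡ suc f
        tree-b  : Tree (labelsOf υ) todo
        last    : Last (labelsOf υ) (from b)
        sums    : ∀ w → openSum n w (nats υ markA) ≡ openSum n w mark

    run-attach : ∀ {b F r C todo τ} → Attaching b F r C todo τ →
                 Run attach τ (λ j υ → Attached b (tree (nats τ freshV 0) (suc (to b)) r C F) todo
                                         (nats τ freshV 0) (nats τ markA) υ × j ≡ 2)
    run-attach {b} {F} {r} {C} {todo} {τ} att = run-seq (run-map (λ { (l , refl) → labelled l }) (run-attachLabel static at))
      where
      open Attaching att
      f = nats τ freshV 0
      labelled : ∀ {υ} → Labelled b (to b) τ υ → Run attachNode υ (λ j φ →
                   Attached b (tree f (suc (to b)) r C F) todo f (nats τ markA) φ × 1 + j ≡ 2)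
      labelled {υ} l = block attachNode (_ , record
        { resting = subst (λ f′ → Resting _ (nats υ freshV 0 + 1) (tree f′ _ _ _ _)) fresh≡
                      (pending-attach
                         pending′ v<n mark≡ dist≡
                         (trans (override-same itemA (nats υ freshV 0)) (trans (+-comm _ 1) (cong suc v≡)))
                         (λ y → override-other itemA (nats υ freshV 0) y)
                         (override-at nodeA v≡)
                         (λ w w≢v → override-other nodeA (nats υ vV 0) w (λ eq → w≢v (trans eq v≡)))
                         (+-comm (nats υ spV 0) 1) (override-same stackA (nats υ spV 0)) (λ i → override-other stackA (nats υ spV 0) i)
                         (+-comm (nats υ freshV 0) 1))
        ; fresh≡  = trans (+-comm _ 1) (cong suc fresh≡)
        ; tree-b  = tree-update
        ; last    = last′
        ; sums    = openSum≡
        } , refl)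
        where
        open Labelled l
        open Update {labelsOf τ} {labelsOf υ} b<na tree-b last closer others mark≡ dep≡ par≡ dist≡ val≡
        pending′ : Pending (view υ) (nats υ freshV 0) (to b) (lens τ distA (from b) L.+ wgt b) F r C
        pending′ = subst₂ (λ V f → Pending V f (to b) (lens τ distA (from b) L.+ wgt b) F r C) (sym view≡) (sym fresh≡)
          (pending-keys pending (λ w w≢v → same refl (SameLabel.mark (others w w≢v)) (SameLabel.dist (others w w≢v))))

    -- The budget with which the next consolidation starts: 10 for every root and the potential of
    -- the hollow nodes.
    credit : Forest → ℕ
    credit F = 10 * count F + sum pot F

    -- The 24 is the potential 12 · 2 of the hollowed node, which keeps at most two children. This
    -- is the entire amortised price of hollowing, and it does not depend on the rank.
    run-steal : ∀ {b F todo τ} → b < na → Static N τ → At b τ → Resting (view τ) (nats τ freshV 0) F →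
                Tree (labelsOf τ) (b ∷ todo) → Last (labelsOf τ) (from b) → nats τ markA (to b) ≡ 1 →
                ¬ lens τ distA (to b) L.≤ lens τ distA (from b) L.+ wgt b →
                Run steal τ (λ j υ → ∃[ F′ ] ∃[ r ] ∃[ C ] (Attaching b F′ r C todo υ × nats υ freshV 0 ≡ nats τ freshV 0 ×
                  nats υ markA ≡ nats τ markA × credit F′ + sum pot C ≤ 24 + credit F × j ≡ 1))
    run-steal {b} {F} {todo} {τ} b<na S at R t last mark≡ far with cut (to b) F
        (subst (0 <_) (sym (trans (Resting.items R (to b) (to< b<na)) (cong (δ 1) mark≡))) (s≤s z≤n))
    ... | x , r , C , F′ , c = block steal
          ( (λ le → _ , F′ , r ∸ 2 , drop₂ C ,
               record { b<na = b<na ; static = record { Static S } ; at = record { At at } ; tree-b = t ; last = last ; closer = λ _ → far ; pending = (pending-steal R (to< b<na) mark≡ c nearer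
                 (override-at itemA x≡) (λ y y≢x → override-other itemA x′ y (λ eq → y≢x (trans eq x≡)))
                 (trans (override-at cntA x≡) (sym (count-take₂≡2 C (large le))))
                 (trans (override-other cntA x′ f f≢x′) (trans (override-same cntA f)
                   (trans (cong (_∸ 2) cnt≡) (sym (count-drop₂ C)))))
                 (λ y y≢x y≢f → trans (override-other cntA x′ y (λ eq → y≢x (trans eq x≡))) (override-other cntA f y y≢f))
                 (subst (λ p → Links sib p (drop₂ C)) (sym (trans (override-same childA f) (cong (λ x → sib (sib (child x))) x≡)))
                   (Links-drop₂ C (large le) (Node.links node)))
                 (λ y → override-other childA f y)) } , refl , refl , cost , refl)
          , (λ gt → _ , F′ , r ∸ 2 , drop₂ C ,
               record { b<na = b<na ; static = record { Static S } ; at = record { At at } ; tree-b = t ; last = last ; closer = λ _ → far ; pending = (pending-steal {child = child} R (to< b<na) mark≡ c nearer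
                 (override-at itemA x≡) (λ y y≢x → override-other itemA x′ y (λ eq → y≢x (trans eq x≡)))
                 (trans (override-other cntA f x (λ eq → f≢x (sym eq))) (trans cntx (cong count (sym (proj₁ (count-small C (little gt)))))))
                 (trans (override-same cntA f) (cong count (sym (proj₂ (count-small C (little gt))))))
                 (λ y _ y≢f → override-other cntA f y y≢f)
                 (subst (Links sib (child f)) (sym (proj₂ (count-small C (little gt)))) tt)
                 (λ _ _ → refl)) } , refl , refl , cost , refl) )
        where
        f = nats τ freshV 0
        x′ = nats τ nodeA (nats τ vV 0)
        sib = nats τ sibA
        child = nats τ childA
        node = proj₁ (cut-node c (Resting.nodes R))
        x≡ : x′ ≡ x
        x≡ = trans (cong (nats τ nodeA) (At.v≡ at)) (proj₂ (proj₂ (Node.full node (to b) refl)))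
        cntx : nats τ cntA x ≡ count C
        cntx = Node.cnt≡ node
        cnt≡ : nats τ cntA x′ ≡ count C
        cnt≡ = trans (cong (nats τ cntA) x≡) cntx
        f≢x : f ≢ x
        f≢x eq = positive-≢ {occ} {F} (cut-occ c) (Resting.fresh∉ R f ≤-refl) (sym eq)
        f≢x′ : f ≢ x′
        f≢x′ eq = f≢x (trans eq x≡)
        large : does (2 ≤? nats τ cntA x′) ≡ true → 2 ≤ count C
        large le = subst (2 ≤_) cnt≡ (does-true (2 ≤? nats τ cntA x′) le)
        little : does (2 ≤? nats τ cntA x′) ≡ false → count C < 2
        little gt = subst (_< 2) cnt≡ (≰⇒> (does-false (2 ≤? nats τ cntA x′) gt))
        nearer : lens τ distA (from b) L.+ wgt b L.≤ lens τ distA (to b)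
        nearer with LO.total (lens τ distA (from b) L.+ wgt b) (lens τ distA (to b))
        ... | inj₁ p = p
        ... | inj₂ p = ⊥-elim (far p)
        cost : credit F′ + sum pot (drop₂ C) ≤ 24 + credit F
        cost = begin
          (10 * count F′ + sum pot F′) + sum pot (drop₂ C) ≡⟨ +-assoc (10 * count F′) _ _ ⟩
          10 * count F′ + (sum pot F′ + sum pot (drop₂ C)) ≡⟨ cong₂ (λ k p → 10 * k + p) (cut-count c) (cut-sum pot c) ⟩
          10 * count F + (sum pot F + 12 * count (take₂ C)) ≤⟨ +-monoʳ-≤ (10 * count F) (+-monoʳ-≤ (sum pot F) (*-monoʳ-≤ 12 (count-take₂ C))) ⟩
          10 * count F + (sum pot F + 24) ≡⟨ +-assoc (10 * count F) _ 24 ⟨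
          credit F + 24 ≡⟨ +-comm (credit F) 24 ⟩
          24 + credit F ∎
          where open ≤-Reasoning

    degree : ℕ → ℕ
    degree v = length (adj v)

    -- The 45 for an arc cover 7 ticks of work and up to 34 of new credit, with 4 to spare. In
    -- `fuel` each arc that has not been relaxed may still create one node; `M` are the marks after
    -- u has been settled.
    record Relaxing (u : ℕ) (M : ℕ → ℕ) (k : ℕ) (τ : Store) : Set (a₁ ⊔ ℓ₀ ⊔ ℓ₂) where
      field
        {F}     : Forest
        {todo}  : List ℕ
        static  : Static N τ
        resting : Resting (view τ) (nats τ freshV 0) F
        tree-u  : Tree (labelsOf τ) todo
        last    : Last (labelsOf τ) u
        u≡      : nats τ uV 0 ≡ u
        ptr     : Chained next (nats τ aV 0) todo
        sound   : ∀ {b} → b ∈ todo → b < na × from b ≡ u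
        sums    : ∀ w → openSum n w (nats τ markA) ≡ openSum n w M
        fuel    : nats τ freshV 0 + (openSum n degree M + length todo) ≤ 2 + na
        k≡      : k ≡ credit F + 45 * length todo

    -- The 34 are 10 for the new root and 24 for a node that has become hollow.
    record Relaxed₁ (b : ℕ) (M : ℕ → ℕ) (f : ℕ) (todo : List ℕ) (c : ℕ) (υ : Store) : Set (a₁ ⊔ ℓ₀ ⊔ ℓ₂) where
      field
        {F}     : Forest
        resting : Resting (view υ) (nats υ freshV 0) F
        fresh≤  : nats υ freshV 0 ≤ suc f
        tree-b  : Tree (labelsOf υ) todo
        last    : Last (labelsOf υ) (from b)
        sums    : ∀ w → openSum n w (nats υ markA) ≡ openSum n w M
        credit≤ : credit F ≤ 34 + c

    run-relaxCase : ∀ {b F todo τ} → b < na → Static N τ → At b τ → Resting (view τ) (nats τ freshV 0) F →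
                    Tree (labelsOf τ) (b ∷ todo) → Last (labelsOf τ) (from b) →
                    Run relaxCase τ (λ j υ → Relaxed₁ b (nats τ markA) (nats τ freshV 0) todo (credit F) υ × j ≤ 5)
    run-relaxCase {b} {F} {todo} {τ} b<na S at R t last = run-if
      (λ le → run-seq (block _ (_ , run-map
        (λ { (a , refl) → record
               { resting = Attached.resting a ; fresh≤ = ≤-reflexive (Attached.fresh≡ a) ; tree-b = Attached.tree-b a
               ; last = Attached.last a ; sums = Attached.sums a
               ; credit≤ = ≤-trans (≤-reflexive (solved (count F) (sum pot F))) (m≤n+m _ 24) } , n≤1+n 4 })
        (run-attach record
           { b<na = b<na ; static = record { Static S } ; at = record { At at }
           ; pending = pending-new R (to< b<na) (unseen le) (override-same cntA f) (λ y → override-other cntA f y)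
           ; tree-b = t ; last = last ; closer = λ seen → ⊥-elim (seen (unseen le)) }))))
      (λ gt → run-if
        (λ le → block skip (_ , record
           { resting = R ; fresh≤ = n≤1+n _ ; last = last ; sums = λ _ → refl ; credit≤ = m≤n+m _ 34
           ; tree-b = tree-skip t (seen gt , subst₂ (λ v c → lens τ distA v L.≤ c) (At.v≡ at) (At.cand≡ at)
                                      (does-true (lens τ distA (nats τ vV 0) L.≤? _) le)) } , s≤s (s≤s (s≤s z≤n))))
        (λ far → let far′ = subst₂ (λ v c → ¬ lens τ distA v L.≤ c) (At.v≡ at) (At.cand≡ at)
                               (does-false (lens τ distA (nats τ vV 0) L.≤? _) far) in
           run-seq (run-map
             (λ { {j} (F′ , r , C , a , f≡ , m≡ , cost , refl) → run-map (λ { (a , refl) → record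
                  { resting = Attached.resting a ; fresh≤ = ≤-reflexive (trans (Attached.fresh≡ a) (cong suc f≡))
                  ; tree-b = Attached.tree-b a ; last = Attached.last a
                  ; sums = λ w → trans (Attached.sums a w) (cong (openSum n w) m≡)
                  ; credit≤ = ≤-trans (≤-reflexive (solved′ (count F′) (sum pot F′) (sum pot C))) (+-monoʳ-≤ 10 cost) } , ≤-refl })
                  (run-attach a) })
             (run-steal b<na S at R t last
                (below-2 _ (Tree.mark≤2 t (to< b<na)) (seen gt)
                   (λ m → far′ (LO.trans (Last.latest last (to< b<na) m) (≤+wgt _ b<na)))) far′))))
      where
      f = nats τ freshV 0
      unseen : does (nats τ markA (nats τ vV 0) ≤? 0) ≡ true → nats τ markA (to b) ≡ 0
      unseen le = trans (cong (nats τ markA) (sym (At.v≡ at))) (n≤0⇒n≡0 (does-true (nats τ markA (nats τ vV 0) ≤? 0) le))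
      seen : does (nats τ markA (nats τ vV 0) ≤? 0) ≡ false → nats τ markA (to b) ≢ 0
      seen gt m = does-false (nats τ markA (nats τ vV 0) ≤? 0) gt
        (≤-reflexive (trans (cong (nats τ markA) (At.v≡ at)) m))
      solved : ∀ f p → 10 * suc f + p ≡ 10 + (10 * f + p)
      solved = solve-∀
      solved′ : ∀ f p c → 10 * suc f + (c + p) ≡ 10 + ((10 * f + p) + c)
      solved′ = solve-∀

    run-relax : ∀ {u M k τ} → 1 ≤ nats τ aV 0 → Relaxing u M k τ →
                Run relax τ (λ j υ → ∃[ k′ ] (Relaxing u M k′ υ × suc (j + k′) ≤ k))
    run-relax a≥1 record { todo = [] ; ptr = a≡0 } = ⊥-elim (n≮0 (subst (1 ≤_) a≡0 a≥1))
    run-relax {u} {M} {τ = τ} _ record { F = F ; todo = b ∷ todo ; static = S ; resting = R ; tree-u = t ; last = last ; u≡ = u≡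
                                ; ptr = a≡ , ptr ; sound = sound ; sums = sums ; fuel = fuel ; k≡ = refl } with sound (here refl)
    ... | b<na , refl = run-seq (block relaxInit (_ , run-map
          (λ { {j} ((r , j≤) , fr) → _ , record
               { static  = static-frame fr record { Static S }
               ; resting = Relaxed₁.resting r
               ; tree-u  = Relaxed₁.tree-b r
               ; last    = Relaxed₁.last r
               ; u≡      = trans (cong-app (Framed.nats≡ fr uV) 0) u≡
               ; ptr     = subst (λ p → Chained next p todo) (sym (trans (cong-app (Framed.nats≡ fr aV) 0)
                             (trans (cong (λ a → nats τ nextA (a ∸ 1)) a≡) (cong-app (Static.next≡ S) b)))) ptr
               ; sound   = λ p → sound (there p)
               ; sums    = λ w → trans (Relaxed₁.sums r w) (sums w)
               ; fuel    = ≤-trans (+-monoˡ-≤ _ (Relaxed₁.fresh≤ r)) (≤-trans (≤-reflexive (move (nats τ freshV 0) _ (length todo))) fuel)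
               ; k≡      = refl
               } , cost j≤ (Relaxed₁.credit≤ r) })
          (run-framed (run-relaxCase b<na record { Static S } at R t last))))
      where
      at : At b _
      at = record
        { b≡    = cong (_∸ 1) a≡
        ; v≡    = trans (cong (λ a → nats τ toA (a ∸ 1)) a≡) (cong-app (Static.to≡ S) b)
        ; u≡    = u≡
        ; cand≡ = cong₂ L._+_ (cong (lens τ distA) u≡) (trans (cong (λ a → lens τ lenA (a ∸ 1)) a≡) (cong-app (Static.wgt≡ S) b))
        }
      move : ∀ f o t → suc f + (o + t) ≡ f + (o + suc t)
      move f o t = trans (sym (+-suc f (o + t))) (cong (f +_) (sym (+-suc o t)))
      cost : ∀ {j c} → j ≤ 5 → c ≤ 34 + credit F →
             suc ((1 + j) + (c + 45 * length todo)) ≤ credit F + 45 * suc (length todo)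
      cost {j} {c} j≤ c≤ = begin
        2 + (j + (c + 45 * length todo)) ≤⟨ +-monoʳ-≤ 2 (+-mono-≤ j≤ (+-monoˡ-≤ (45 * length todo) c≤)) ⟩
        2 + (5 + ((34 + credit F) + 45 * length todo)) ≤⟨ m≤n+m _ 4 ⟩
        4 + (2 + (5 + ((34 + credit F) + 45 * length todo))) ≡⟨ solved (credit F) (length todo) ⟩
        credit F + 45 * suc (length todo) ∎
        where
        open ≤-Reasoning
        solved : ∀ c t → 4 + (2 + (5 + ((34 + c) + 45 * t))) ≡ c + 45 * suc t
        solved = solve-∀

    -- Rounds of the search and their amortised cost

    -- Of the 30 for each rank, 7 pay for emptying the slots, 10 for the roots that remain and 12
    -- for the potential of the extracted root, which becomes hollow. The 45 for each arc pass to
    -- `Relaxing`.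
    vertexCost : ℕ → ℕ
    vertexCost v = (40 + 30 * rank≤) + 45 * degree v

    -- The round that finds the heap empty settles no vertex, so it needs an allowance of its own.
    finalCost : ℕ
    finalCost = 20 + 10 * rank≤

    -- The factor `goV` in the budget is 1 until the round that finds no root, which then takes
    -- `finalCost`.
    record Running (k : ℕ) (τ : Store) : Set (a₁ ⊔ ℓ₀ ⊔ ℓ₂) where
      field
        {F}     : Forest
        static  : Static N τ
        resting : Resting (view τ) (nats τ freshV 0) F
        tree-s  : Tree (labelsOf τ) []
        fuel    : nats τ freshV 0 + openSum n degree (nats τ markA) ≤ 2 + na
        phase   : nats τ goV 0 ≡ 1 ⊎ nats τ goV 0 ≡ 0 × (∀ v → v < n → nats τ markA v ≢ 1)
        k≡      : k ≡ credit F + (openSum n vertexCost (nats τ markA) + finalCost * nats τ goV 0)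

    state-start : ∀ {V fresh F} (R : Resting V fresh F) (small : sum size F ≤ 2 + na) →
                  Consolidation.State (View.keysᵛ V) F (Resting.once R) (Resting.zero∉ R) small
                    (record V { maxrᵛ = 0 }) ∅ F (λ _ → ∅)
    state-start {F = F} R small = record
      { keys≡  = refl
      ; stack  = stack
      ; slots  = λ r → empty (slots r)
      ; nodesD = tt
      ; nodesF = nodes
      ; nodesB = λ _ → tt
      ; large  = λ _ _ → refl
      ; maxr≤  = z≤n
      ; total≤ = λ g → ≤-reflexive (start (flat g))
      ; items  = λ v → start (has v)
      }
      where
      open Resting R
      start : ∀ f → total f ∅ F (λ _ → ∅) ≡ sum f F
      start f = trans (cong (sum f F +_) (sumTo-zero (suc rank≤) (λ _ _ → refl))) (+-identityʳ _)

    module Step {σ : Store} {F₀ : Forest} (S₀ : Static N σ) (R₀ : Resting (view σ) (nats σ freshV 0) F₀)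
                (t₀ : Tree (labelsOf σ) []) (fuel₀ : nats σ freshV 0 + openSum n degree (nats σ markA) ≤ 2 + na) where
      small : sum size F₀ ≤ 2 + na
      small = ≤-trans (<⇒≤ (Resting.size< R₀)) (≤-trans (m≤m+n _ _) fuel₀)

      K = View.keysᵛ (view σ)

      open Consolidation K F₀ (Resting.once R₀) (Resting.zero∉ R₀) small

      clear-all : ∀ {V P R best} (c : Collecting P R best V) →
                  View.maxrᵛ V < R → ∀ j → Collecting.B c j ≡ ∅
      clear-all {R = R} c m<R j with j <? R
      ... | yes j<R = Collecting.cleared c j j<R
      ... | no j≮R  = State.large (Collecting.state c) j (<-≤-trans m<R (≮⇒≥ j≮R))

      total-clear : ∀ f {D F B} → (∀ j → B j ≡ ∅) → total f D F B ≡ sum f D + sum f F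
      total-clear f {D} {F} B∅ = cong (sum f D +_) (trans (cong (sum f F +_)
        (sumTo-zero (suc rank≤) (λ j _ → cong (sum f) (B∅ j)))) (+-identityʳ _))

      slot-clear : ∀ {x r T} → Slot x r T → T ≡ ∅ → x ≡ 0
      slot-clear (empty e) _ = e

      resting-none : ∀ {V B fresh} (S : State V ∅ ∅ B) → (∀ j → B j ≡ ∅) → 0 < fresh → Resting V fresh ∅
      resting-none S B∅ fresh>0 = record
        { stack   = State.stack S
        ; slots   = λ r → slot-clear (State.slots S r) (B∅ r)
        ; nodes   = tt
        ; once    = λ _ → z≤n
        ; fresh∉  = λ _ _ → refl
        ; zero∉   = refl
        ; fresh>0 = fresh>0
        ; size<   = fresh>0
        ; items   = λ v v<n → trans (sym (total-clear (has v) {∅} {∅} B∅)) (trans (State.items S v)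
                      (trans (Resting.items R₀ v v<n) (cong (λ K → δ 1 (Keys.mark K v)) (sym (State.keys≡ S)))))
        }

      -- Consolidation loses no item, so an empty forest afterwards means that no vertex had mark 1
      -- before.
      none-left : ∀ {V B} (S : State V ∅ ∅ B) → (∀ j → B j ≡ ∅) → ∀ v → v < n → nats σ markA v ≢ 1
      none-left S B∅ v v<n m with () ← trans (sym (total-clear (has v) {∅} {∅} B∅)) (trans (State.items S v)
                                  (trans (Resting.items R₀ v v<n) (cong (δ 1) m)))

      module Found {V : View} {best v r : ℕ} {C F : Forest} {B : ℕ → Forest}
                   (S : State V (tree best (suc v) r C ∅) F B) (B∅ : ∀ j → B j ≡ ∅) where
        open State S
        D = tree best (suc v) r C ∅
        p = proj₁ nodesD

        sum≡ : ∀ f → total f D F B ≡ f best (suc v) (count C) + (sum f C + sum f F)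
        sum≡ f = trans (total-clear f {D} {F} B∅) (trans (cong (λ k → (f best (suc v) (count C) + k) + sum f F) (+-identityʳ (sum f C)))
                   (+-assoc (f best (suc v) (count C)) (sum f C) (sum f F)))

        v<n : v < n
        v<n = proj₁ (Node.full p v refl)

        mark-v : nats σ markA v ≡ 1
        mark-v = proj₁ (proj₂ (Node.full p v refl))

        count-C≤ : count C ≤ rank≤
        count-C≤ = ≤-trans (ranks-count (Shape.ranks (Node.shape p))) (rank-of S refl)

        best∉ : sum (occ best) C + sum (occ best) F ≡ 0
        best∉ = n≤0⇒n≡0 (≤-pred (begin
          1 + (sum (occ best) C + sum (occ best) F) ≡⟨ cong (_+ (sum (occ best) C + sum (occ best) F)) (δ-refl best) ⟨
          δ best best + (sum (occ best) C + sum (occ best) F) ≡⟨ sum≡ (occ best) ⟨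
          total (occ best) D F B ≤⟨ total≤ (λ x _ → δ best x) ⟩
          sum (occ best) F₀ ≤⟨ Resting.once R₀ best ⟩
          1 ∎))
          where open ≤-Reasoning

        v∉ : sum (has v) C + sum (has v) F ≡ 0
        v∉ = suc-injective (begin
          1 + (sum (has v) C + sum (has v) F) ≡⟨ cong (_+ (sum (has v) C + sum (has v) F)) (δ-refl v) ⟨
          δ v v + (sum (has v) C + sum (has v) F) ≡⟨ sum≡ (has v) ⟨
          total (has v) D F B ≡⟨ items v ⟩
          sum (has v) F₀ ≡⟨ Resting.items R₀ v v<n ⟩
          δ 1 (nats σ markA v) ≡⟨ cong (δ 1) mark-v ⟩
          1 ∎)
          where open ≡-Reasoning

        -- A vertex w of mark 1 is held in the chosen tree or under one of the other roots. In the
        -- first case heap order bounds it, in the second the choice of the root does.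
        v-least : LB (lens σ distA) (lens σ distA v) F → ∀ {w} → w < n → nats σ markA w ≡ 1 → lens σ distA v L.≤ lens σ distA w
        v-least lb {w} w<n m = LB-lookup (tree best (suc v) r C F) (subst (0 <_) present (s≤s z≤n))
            ((λ { _ refl → LO.refl }) , Node.order p v refl , lb)
          where
          present : 1 ≡ sum (has w) (tree best (suc v) r C F)
          present = trans (sym (trans (Resting.items R₀ w w<n) (cong (δ 1) m))) (trans (sym (items w)) (sum≡ (has w)))

        resting-settled : ∀ {fresh item mark st sp} → 
                          fresh ≡ nats σ freshV 0 →
                          item best ≡ 0 → (∀ y → y ≢ best → item y ≡ Cells.item (View.cellsᵛ V) y) →
                          mark v ≡ 2 → (∀ w → w ≢ v → mark w ≡ nats σ markA w) →
                          sp ≡ suc (View.spᵛ V) → st (View.spᵛ V) ≡ best → (∀ i → i ≢ View.spᵛ V → st i ≡ View.stackᵛ V i) →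
                          Resting (record V { cellsᵛ = cells item (Cells.cnt (View.cellsᵛ V)) (Cells.child (View.cellsᵛ V)) (Cells.sib (View.cellsᵛ V))
                                            ; keysᵛ = keys (Keys.node (View.keysᵛ V)) mark (Keys.dist (View.keysᵛ V))
                                            ; stackᵛ = st ; spᵛ = sp }) fresh (tree best 0 r C F)
        resting-settled {item = item} {mark} refl item≡ item-off mark≡ mark-off sp≡ top st-off = record
          { stack   = _ , sp≡ , top , stack-cong F (λ i i< → st-off i (<⇒≢ i<)) stack
          ; slots   = λ r → slot-clear (slots r) (B∅ r)
          ; nodes   = record
              { item≡ = item≡
              ; cnt≡  = Node.cnt≡ p
              ; links = Node.links p
              ; shape = record { ranks = Shape.ranks (Node.shape p) ; two = Shape.two (Node.shape p) ; whole = λ 0≢0 → ⊥-elim (0≢0 refl) }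
              ; order = λ _ ()
              ; full  = λ _ ()
              } , moved C (m+n≡0⇒m≡0 _ best∉) (m+n≡0⇒m≡0 _ v∉) (proj₁ (proj₂ nodesD)) ,
              moved F (m+n≡0⇒n≡0 (sum (occ best) C) best∉) (m+n≡0⇒n≡0 (sum (has v) C) v∉) nodesF
          ; once    = λ y → ≤-trans (flat≤ (λ x _ → δ y x) refl) (Resting.once R₀ y)
          ; fresh∉  = λ y f≤y → n≤0⇒n≡0 (≤-trans (flat≤ (λ x _ → δ y x) refl) (≤-reflexive (Resting.fresh∉ R₀ y f≤y)))
          ; zero∉   = n≤0⇒n≡0 (≤-trans (flat≤ (λ x _ → δ 0 x) refl) (≤-reflexive (Resting.zero∉ R₀)))
          ; fresh>0 = Resting.fresh>0 R₀
          ; size<   = ≤-<-trans (flat≤ (λ _ _ → 1) refl) (Resting.size< R₀)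
          ; items   = λ w w<n → items′ w w<n (w ≟ v)
          }
          where
          flat≤ : ∀ g → g best 0 ≡ g best (suc v) → sum (flat g) (tree best 0 r C F) ≤ sum (flat g) F₀
          flat≤ g eq = ≤-trans (≤-reflexive (trans (cong (_+ (sum (flat g) C + sum (flat g) F)) eq) (sym (sum≡ (flat g))))) (total≤ g)
          A′ = cells item (Cells.cnt (View.cellsᵛ V)) (Cells.child (View.cellsᵛ V)) (Cells.sib (View.cellsᵛ V))
          K′ = keys (Keys.node (View.keysᵛ V)) mark (Keys.dist (View.keysᵛ V))
          moved : ∀ T → sum (occ best) T ≡ 0 → sum (has v) T ≡ 0 → AllN (Node (View.cellsᵛ V) K) T → AllN (Node A′ K′) T
          moved T o h ns = nodes-cells T (λ y y∈ → same (sym (item-off y (positive-≢ {occ} {T} y∈ o))) refl refl refl)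
            (nodes-keys T (λ w w∈ → same (cong (λ K → Keys.node K w) (sym keys≡)) (sym (mark-off w (positive-≢ {has} {T} w∈ h)))
                                         (cong (λ K → Keys.dist K w) (sym keys≡))) ns)
          items′ : ∀ w → w < n → Dec (w ≡ v) → sum (has w) C + sum (has w) F ≡ δ 1 (mark w)
          items′ w w<n (yes refl) = trans v∉ (cong (δ 1) (sym mark≡))
          items′ w w<n (no w≢v) = trans (cong (_+ (sum (has w) C + sum (has w) F)) (sym (δ-≢ w≢v)))
            (trans (sym (sum≡ (has w))) (trans (items w) (trans (Resting.items R₀ w w<n) (cong (δ 1) (sym (mark-off w w≢v))))))

      run-settleInit : ∀ {τ v r C F B} → State (view τ) (tree (nats τ bestV 0) (suc v) r C ∅) F B → (∀ j → B j ≡ ∅) →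
                       LB (lens σ distA) (lens σ distA v) F → Static N τ → labelsOf τ ≡ labelsOf σ →
                       nats τ freshV 0 ≡ nats σ freshV 0 →
                       Run settleInit τ (λ j υ → Relaxing v (nats υ markA) (credit (tree (nats τ bestV 0) 0 r C F) + 45 * degree v) υ ×
                         (∀ w → openSum n w (nats υ markA) + w v ≡ openSum n w (nats σ markA)) ×
                         nats υ goV 0 ≡ nats τ goV 0 × j ≡ 1)
      run-settleInit {τ} {v} {r} {C} {F} {B} S B∅ lb Sτ l≡ f≡ = block settleInit (_ , record
          { static  = record { Static Sτ }
          ; resting = resting-settled f≡ (override-same itemA best) (λ y → override-other itemA best y)
                        (override-at markA u≡) mark-off
                        (+-comm (nats τ spV 0) 1) (override-same stackA (nats τ spV 0)) (λ i → override-other stackA (nats τ spV 0) i)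
          ; tree-u  = subst (λ Λ → Tree (labels _ (Labels.dep Λ) (Labels.par Λ) (Labels.dist Λ) (Labels.val Λ)) (adj v)) (sym l≡)
                        (Settle.tree-settle t₀ v<n mark-v (v-least lb) (override-at markA u≡) mark-off)
          ; last    = subst (λ Λ → Last (labels _ (Labels.dep Λ) (Labels.par Λ) (Labels.dist Λ) (Labels.val Λ)) v) (sym l≡)
                        (Settle.last′ t₀ v<n mark-v (v-least lb) (override-at markA u≡) mark-off)
          ; u≡      = u≡
          ; ptr     = subst (λ p → Chained next p (adj v)) (sym (trans (cong (nats τ firstA) u≡) (cong-app (Static.first≡ Sτ) v))) (chained v<n)
          ; sound   = adj-sound v<n
          ; sums    = λ _ → refl
          ; fuel    = ≤-trans (≤-reflexive (cong₂ _+_ f≡ (Settle.openSum-u t₀ v<n mark-v (v-least lb) (override-at markA u≡) mark-off degree))) fuel₀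
          ; k≡      = refl
          } , Settle.openSum-u t₀ v<n mark-v (v-least lb) (override-at markA u≡) mark-off , refl , refl)
        where
        open Found S B∅
        best = nats τ bestV 0
        u≡ : nats τ itemA best ∸ 1 ≡ v
        u≡ = cong (_∸ 1) (Node.item≡ p)
        mark-off : ∀ w → w ≢ v → override markA (nats τ itemA best ∸ 1) 2 _ markA w ≡ nats σ markA w
        mark-off w w≢v = trans (override-other markA (nats τ itemA best ∸ 1) w (λ eq → w≢v (trans eq u≡)))
                               (cong (λ Λ → Labels.mark Λ w) l≡)

    run-dijkstraBody : ∀ {k σ} → 1 ≤ nats σ goV 0 → Running k σ →
                       Run dijkstraBody σ (λ j τ → ∃[ k′ ] (Running k′ τ × suc (j + k′) ≤ k))
    run-dijkstraBody go≥1 record { phase = inj₂ (go≡0 , _) } = ⊥-elim (n≮0 (subst (1 ≤_) go≡0 go≥1))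
    run-dijkstraBody {σ = σ} _ record { F = F₀ ; static = S₀ ; resting = R₀ ; tree-s = t₀ ; fuel = fuel₀ ; phase = inj₁ go≡1 ; k≡ = refl } =
      run-seq (run-map (λ { {j₁} {τ₁} ((B₁ , S₁ , cost₁) , fr₁) → run-seq (run-map (λ { {j₂} {τ₂} ((R , c , m<R , R≤ , cost₂) , fr₂) →
          let j≤ = budget {j₁} {j₂} {trees B₁} cost₁ cost₂ in
          collected {j₁} {j₂} (Collecting.chosen c) (Collecting.state c) (clear-all c m<R) (Collecting.count≤ c)
            (static-frame fr₂ (static-frame fr₁ S₀)) (trans (labels-frame fr₂) (labels-frame fr₁))
            (trans (cong-app (Framed.nats≡ fr₂ freshV) 0) (cong-app (Framed.nats≡ fr₁ freshV) 0))
            (trans (cong-app (Framed.nats≡ fr₂ goV) 0) (trans (cong-app (Framed.nats≡ fr₁ goV) 0) go≡1))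
            R≤ (subst (λ p → j₁ + (j₂ + p) ≤ 11 + 7 * rank≤ + credit F₀) (sym (Collecting.pot≡ c)) j≤) })
        (run-framed (run-collect S₁))) })
      (run-framed (run-consolidate (state-start R₀ small))))
      where
      open Step S₀ R₀ t₀ fuel₀
      open Consolidation K F₀ (Resting.once R₀) (Resting.zero∉ R₀) small
      M = nats σ markA
      k₀ = credit F₀ + (openSum n vertexCost M + finalCost * nats σ goV 0)

      budget : ∀ {j₁ j₂ t p} → j₁ + (4 * t + p) ≤ 2 + credit F₀ → j₂ ≤ 2 + 7 * suc rank≤ →
               j₁ + (j₂ + p) ≤ 11 + 7 * rank≤ + credit F₀
      budget {j₁} {j₂} {t} {p} le le′ = begin
        -- The ticks left in occupied slots are forfeited, as `collect` is charged to the bound on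
        -- ranks.
        j₁ + (j₂ + p) ≤⟨ m≤n+m _ (4 * t) ⟩
        4 * t + (j₁ + (j₂ + p)) ≡⟨ solved t j₁ j₂ p ⟩
        j₂ + (j₁ + (4 * t + p)) ≤⟨ +-mono-≤ le′ le ⟩
        (2 + 7 * suc rank≤) + (2 + credit F₀) ≡⟨ solved′ rank≤ (credit F₀) ⟩
        11 + 7 * rank≤ + credit F₀ ∎
        where
        open ≤-Reasoning
        solved : ∀ t j j′ p → 4 * t + (j + (j′ + p)) ≡ j′ + (j + (4 * t + p))
        solved = solve-∀
        solved′ : ∀ r c → (2 + 7 * suc r) + (2 + c) ≡ 11 + 7 * r + c
        solved′ = solve-∀

      collected : ∀ {j₁ j₂ τ D F B R} → Best (nats τ bestV 0) D F → State (view τ) D F B →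
              (∀ j → B j ≡ ∅) → count F ≤ R → Static N τ → labelsOf τ ≡ labelsOf σ → nats τ freshV 0 ≡ nats σ freshV 0 →
              nats τ goV 0 ≡ 1 → R ≤ suc rank≤ → j₁ + (j₂ + total pot D F B) ≤ 11 + 7 * rank≤ + credit F₀ →
              Run (if var bestV ≤ⁿ lit 0 then goV ≔ lit 0 else settle) τ
                (λ j υ → ∃[ k′ ] (Running k′ υ × suc ((j₁ + (j₂ + j)) + k′) ≤ k₀))
      collected {j₁} {j₂} {τ} (empty b≡0) S B∅ _ Sτ l≡ f≡ _ _ cost = run-if
        (λ _ → block _ (_ , _ , record
          { static  = record { Static Sτ }
          ; resting = resting-none S B∅ (subst (0 <_) (sym f≡) (Resting.fresh>0 R₀))
          ; tree-s  = subst (λ Λ → Tree Λ []) (sym l≡) t₀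
          ; fuel    = subst₂ (λ f m → f + openSum n degree m ≤ 2 + na) (sym f≡) (sym (cong Labels.mark l≡)) fuel₀
          ; phase   = inj₂ (refl , λ v v<n m → none-left S B∅ v v<n (trans (cong (λ Λ → Labels.mark Λ v) (sym l≡)) m))
          ; k≡      = refl
          } , bound))
        (λ gt → ⊥-elim (does-false (nats τ bestV 0 ≤? 0) gt (≤-reflexive b≡0)))
        where
        bound : suc ((j₁ + (j₂ + 2)) + (0 + (openSum n vertexCost (nats τ markA) + finalCost * 0))) ≤ k₀
        bound = begin
          suc ((j₁ + (j₂ + 2)) + (0 + (openSum n vertexCost (nats τ markA) + finalCost * 0)))
            ≡⟨ cong (λ m → suc ((j₁ + (j₂ + 2)) + (openSum n vertexCost m + finalCost * 0))) (cong Labels.mark l≡) ⟩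
          suc ((j₁ + (j₂ + 2)) + (W + finalCost * 0)) ≡⟨ solved j₁ j₂ W finalCost ⟩
          3 + (W + (j₁ + (j₂ + 0))) ≤⟨ +-monoʳ-≤ 3 (+-monoʳ-≤ W (≤-trans (+-monoʳ-≤ j₁ (+-monoʳ-≤ j₂ z≤n)) cost)) ⟩
          3 + (W + (11 + 7 * rank≤ + credit F₀)) ≤⟨ m≤n+m _ (6 + 3 * rank≤) ⟩
          6 + 3 * rank≤ + (3 + (W + (11 + 7 * rank≤ + credit F₀))) ≡⟨ solved′ rank≤ W (credit F₀) ⟩
          credit F₀ + (W + finalCost * 1) ≡⟨ cong (λ g → credit F₀ + (W + finalCost * g)) go≡1 ⟨
          k₀ ∎
          where
          open ≤-Reasoning
          W = openSum n vertexCost M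
          solved : ∀ j j′ w c → suc ((j + (j′ + 2)) + (w + c * 0)) ≡ 3 + (w + (j + (j′ + 0)))
          solved = solve-∀
          solved′ : ∀ r w c → 6 + 3 * r + (3 + (w + (11 + 7 * r + c))) ≡ c + (w + (20 + 10 * r) * 1)
          solved′ = solve-∀
      collected {j₁} {j₂} {τ} (least {v} {r} {C} {F} 0<b lb) S B∅ count≤ Sτ l≡ f≡ g≡ R≤ cost = run-if
        (λ le → ⊥-elim (<⇒≱ 0<b (does-true (nats τ bestV 0 ≤? 0) le)))
        (λ _ → run-seq (run-map (λ { {_} {υ} (rel , sums , go≡ , refl) →
          run-map (λ { {j₃} {φ} (( _ , record { F = F′ ; todo = [] ; static = Sφ ; resting = R ; tree-u = t ; sums = sums′ ; fuel = fuel ; k≡ = refl } , _ , le) , fr) →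
                       let g = trans (cong-app (Framed.nats≡ fr goV) 0) (trans go≡ g≡) in
                       _ , record
                         { static = Sφ ; resting = R ; tree-s = t
                         ; fuel = ≤-trans (≤-reflexive (cong (nats φ freshV 0 +_) (trans (sums′ degree) (sym (+-identityʳ _))))) fuel
                         ; phase = inj₁ g ; k≡ = refl } ,
                       subst₂ (λ W g → suc ((j₁ + (j₂ + suc (suc j₃))) + (credit F′ + (W + finalCost * g))) ≤ k₀) (sym (sums′ vertexCost)) (sym g)
                         (bound {j₃} {openSum n vertexCost (nats υ markA)} le (sums vertexCost))
                   ; ((_ , record { todo = b ∷ _ ; ptr = a≡ , _ } , done , _) , _) →
                       ⊥-elim (does-false (1 ≤? _) done (subst (1 ≤_) (sym a≡) (s≤s z≤n))) })
            (run-framed (run-while (Relaxing v (nats υ markA)) (λ go r → run-relax (does-true (1 ≤? _) go) r) rel)) })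
          (run-settleInit S B∅ lb Sτ l≡ f≡)))
        where
        open Found S B∅ using (count-C≤; sum≡)
        best = nats τ bestV 0
        bound : ∀ {j₃ W p} → j₃ + (p + 45 * 0) ≤ suc (credit (tree best 0 r C F) + 45 * degree v) → W + vertexCost v ≡ openSum n vertexCost M →
                suc ((j₁ + (j₂ + suc (suc j₃))) + (p + (W + finalCost * 1))) ≤ k₀
        bound {j₃} {W} {p} le w≡ = begin
          suc ((j₁ + (j₂ + suc (suc j₃))) + (p + (W + finalCost * 1))) ≡⟨ solved j₁ j₂ j₃ p W (finalCost * 1) ⟩
          3 + ((j₁ + j₂) + ((j₃ + (p + 45 * 0)) + (W + finalCost * 1)))
            ≤⟨ +-monoʳ-≤ 3 (+-monoʳ-≤ (j₁ + j₂) (+-monoˡ-≤ (W + finalCost * 1) le)) ⟩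
          3 + ((j₁ + j₂) + (suc ((10 * suc (count F) + (12 * count C + q)) + 45 * degree v) + (W + finalCost * 1)))
            ≤⟨ +-monoʳ-≤ 3 (+-monoʳ-≤ (j₁ + j₂) (+-monoˡ-≤ (W + finalCost * 1) (s≤s (+-monoˡ-≤ (45 * degree v)
                 (+-mono-≤ (*-monoʳ-≤ 10 (s≤s (≤-trans count≤ R≤))) (+-monoˡ-≤ q (*-monoʳ-≤ 12 count-C≤))))))) ⟩
          3 + ((j₁ + j₂) + (suc ((10 * suc (suc rank≤) + (12 * rank≤ + q)) + 45 * degree v) + (W + finalCost * 1)))
            ≡⟨ solved′ j₁ j₂ rank≤ q (degree v) W (finalCost * 1) ⟩
          (24 + 22 * rank≤) + ((45 * degree v + (W + finalCost * 1)) + (j₁ + (j₂ + q)))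
            ≤⟨ +-monoʳ-≤ (24 + 22 * rank≤) (+-monoʳ-≤ (45 * degree v + (W + finalCost * 1)) (subst (λ p → j₁ + (j₂ + p) ≤ 11 + 7 * rank≤ + credit F₀) (sum≡ pot) cost)) ⟩
          (24 + 22 * rank≤) + ((45 * degree v + (W + finalCost * 1)) + (11 + 7 * rank≤ + credit F₀)) ≤⟨ m≤n+m _ (5 + rank≤) ⟩
          (5 + rank≤) + ((24 + 22 * rank≤) + ((45 * degree v + (W + finalCost * 1)) + (11 + 7 * rank≤ + credit F₀)))
            ≡⟨ solved″ rank≤ (degree v) W (finalCost * 1) (credit F₀) ⟩
          credit F₀ + ((W + vertexCost v) + finalCost * 1) ≡⟨ cong₂ (λ w g → credit F₀ + (w + finalCost * g)) w≡ (sym go≡1) ⟩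
          k₀ ∎
          where
          open ≤-Reasoning
          q = sum pot C + sum pot F
          solved : ∀ j₁ j₂ j₃ p w f → suc ((j₁ + (j₂ + suc (suc j₃))) + (p + (w + f))) ≡ 3 + ((j₁ + j₂) + ((j₃ + (p + 45 * 0)) + (w + f)))
          solved = solve-∀
          solved′ : ∀ j₁ j₂ r q d w f → 3 + ((j₁ + j₂) + (suc ((10 * suc (suc r) + (12 * r + q)) + 45 * d) + (w + f))) ≡
                    (24 + 22 * r) + ((45 * d + (w + f)) + (j₁ + (j₂ + q)))
          solved′ = solve-∀
          solved″ : ∀ r d w f c → (5 + r) + ((24 + 22 * r) + ((45 * d + (w + f)) + (11 + 7 * r + c))) ≡ c + ((w + ((40 + 30 * r) + 45 * d)) + f)
          solved″ = solve-∀

    -- Start and total time of the search from one source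

    run-clear : ∀ {σ} → nats σ 0 0 ≡ n → Run clear σ (λ j τ → (∀ v → v < n → nats τ markA v ≡ 0) × j ≤ 2 + 2 * n)
    run-clear {σ} n≡ = run-seq (block _ (_ , run-map
        (λ { {j} {τ} (_ , (i , v≡ , n≡ , zeros , i≤n , refl) , done , le) →
             (λ v v<n → zeros v (≤-trans v<n (≮⇒≥ (subst₂ (λ i n → ¬ suc i ≤ n) v≡ n≡ (does-false (suc (nats τ vV 0) ≤? nats τ 0 0) done))))) ,
             s≤s (≤-trans (m≤m+n j _) le) })
        (run-while Inv body (0 , refl , n≡ , (λ _ ()) , z≤n , refl))))
      where
      Inv : ℕ → Store → Set
      Inv k τ = ∃[ i ] (nats τ vV 0 ≡ i × nats τ 0 0 ≡ n × (∀ v → v < i → nats τ markA v ≡ 0) × i ≤ n × k ≡ 2 * (n ∸ i))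
      body : ∀ {k τ} → test (one +ⁿ var vV ≤ⁿ nN) τ ≡ true → Inv k τ →
             Run (markA [ var vV ]≔ lit 0 ⨾ vV ≔ var vV +ⁿ one) τ (λ j υ → ∃[ k′ ] (Inv k′ υ × suc (j + k′) ≤ k))
      body {τ = τ} go (i , refl , n≡ , zeros , i≤n , refl) = block _ (_ , _ ,
        (suc i , +-comm i 1 , n≡ ,
         (λ v v≤i → override-elim (_≡ 0) markA i v (λ _ → refl) (λ i≢v → zeros v (≤∧≢⇒< (≤-pred v≤i) (λ eq → i≢v (sym eq))))) ,
         i<n , refl) , ≤-reflexive (trans (sym (*-suc 2 (n ∸ suc i))) (cong (2 *_) (sym (+-∸-assoc 1 i<n)))))
        where
        i<n : i < n
        i<n = subst (suc i ≤_) n≡ (does-true (suc i ≤? nats τ 0 0) go)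

    record Sourced (υ : Store) : Set (a₁ ⊔ ℓ₀) where
      field
        static : Static N υ
        s≡     : nats υ sV 0 ≡ s
        slots  : ∀ r → nats υ slotA r ≡ 0
        mark-s : nats υ markA s ≡ 1
        others : ∀ v → v < n → v ≢ s → nats υ markA v ≡ 0
        dist-s : lens υ distA s ≡ L.0#
        dep-s  : nats υ depA s ≡ 0
        go≡    : nats υ goV 0 ≡ 1

    run-sourceLabel : ∀ {τ} → Static N τ → nats τ sV 0 ≡ s → (∀ r → nats τ slotA r ≡ 0) → (∀ v → v < n → nats τ markA v ≡ 0) →
                      Run sourceLabel τ (λ j υ → Sourced υ × j ≡ 1)
    run-sourceLabel {τ} S s≡ slots zeros = block sourceLabel (_ , record
      { static = record { Static S }
      ; s≡     = s≡
      ; slots  = slots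
      ; mark-s = override-at markA s≡
      ; others = λ v v<n v≢s → trans (override-other markA (nats τ sV 0) v (λ eq → v≢s (trans eq s≡))) (zeros v v<n)
      ; dist-s = override-at distA s≡
      ; dep-s  = override-at depA s≡
      ; go≡    = refl
      } , refl)

    tree-source : ∀ {υ} → Sourced υ → Tree (labelsOf υ) []
    tree-source {υ} so = record
      { root    = (λ m → 1≢0 (trans (sym mark-s) m)) , LO.reflexive (L.reflexive dist-s)
      ; parents = λ {v} v<n m → inj₁ (parents v<n m (v ≟ s))
      ; nonneg  = λ {v} v<n m → nonneg v<n m (v ≟ s)
      ; mark≤2  = λ {v} v<n → mark≤2 v<n (v ≟ s)
      ; ordered = λ v<n _ m _ → ⊥-elim (≢2 v<n m)
      ; relaxed = λ b<na m → ⊥-elim (≢2 (from< b<na) m)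
      ; depth₁  = λ {v} v<n m → depth₁ v<n m (v ≟ s)
      ; depth₂  = λ v<n m → ⊥-elim (≢2 v<n m)
      }
      where
      open Sourced so
      1≢0 : 1 ≢ 0
      1≢0 ()
      ≢2 : ∀ {v} → v < n → nats υ markA v ≢ 2
      ≢2 {v} v<n m with v ≟ s
      ... | yes refl with () ← trans (sym mark-s) m
      ≢2 {v} v<n m | no v≢s with () ← trans (sym (others v v<n v≢s)) m
      parents : ∀ {v} → v < n → nats υ markA v ≢ 0 → Dec (v ≡ s) → v ≡ s × nats υ depA v ≡ 0
      parents v<n m (yes refl) = refl , dep-s
      parents v<n m (no v≢s)   = ⊥-elim (m (others _ v<n v≢s))
      nonneg : ∀ {v} → v < n → nats υ markA v ≢ 0 → Dec (v ≡ s) → L.0# L.≤ lens υ distA v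
      nonneg v<n m (yes refl) = LO.reflexive (L.reflexive (sym dist-s))
      nonneg v<n m (no v≢s)   = ⊥-elim (m (others _ v<n v≢s))
      mark≤2 : ∀ {v} → v < n → Dec (v ≡ s) → nats υ markA v ≤ 2
      mark≤2 v<n (yes refl) = ≤-trans (≤-reflexive mark-s) (s≤s z≤n)
      mark≤2 v<n (no v≢s)   = ≤-trans (≤-reflexive (others _ v<n v≢s)) z≤n
      depth₁ : ∀ {v} → v < n → nats υ markA v ≡ 1 → Dec (v ≡ s) → nats υ depA v + openSum n (λ _ → 1) (nats υ markA) ≤ n
      depth₁ v<n m (yes refl) = ≤-trans (≤-reflexive (cong (_+ openSum n (λ _ → 1) (nats υ markA)) dep-s))
        (≤-trans (openSum-≤ n (λ _ → 1) (nats υ markA)) (≤-reflexive (trans (sumTo-const n 1) (*-identityʳ n))))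
      depth₁ v<n m (no v≢s) with () ← trans (sym m) (others _ v<n v≢s)

    run-sourceNode : ∀ {υ} → s < n → Sourced υ →
                     Run sourceNode υ (λ j φ → Running (10 + (openSum n vertexCost (nats υ markA) + finalCost * 1)) φ × j ≡ 1)
    run-sourceNode {υ} s<n so = block sourceNode (_ , record
      { F       = tree 1 (suc s) 0 ∅ ∅
      ; static  = record { Static static }
      ; resting = record
        { stack   = 0 , refl , refl , refl
        ; slots   = slots
        ; nodes   = record
            { item≡ = trans (+-comm (nats υ sV 0) 1) (cong suc s≡)
            ; cnt≡  = refl
            ; links = tt
            ; shape = record { ranks = [] ; two = z≤n ; whole = λ _ → z≤n }
            ; order = λ _ _ → tt
            ; full  = λ { _ refl → s<n , mark-s , override-at nodeA s≡ }
            } , tt , tt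
        ; once    = λ y → ≤-trans (≤-reflexive (+-identityʳ _)) (δ≤1 y 1)
        ; fresh∉  = λ y 2≤y → trans (+-identityʳ _) (δ-≢ {y} {1} (λ { refl → <-irrefl refl 2≤y }))
        ; zero∉   = refl
        ; fresh>0 = s≤s z≤n
        ; size<   = s≤s (s≤s z≤n)
        ; items   = λ v v<n → trans (+-identityʳ _) (items v v<n (v ≟ s))
        }
      ; tree-s  = tree-source so
      -- Number 0 means no node and number 1 is the node of the source; each of the `na` arcs can
      -- use up one number more.
      ; fuel    = s≤s (s≤s (≤-trans (openSum-≤ n degree (nats υ markA)) (≤-reflexive adj-total)))
      ; phase   = inj₁ go≡
      ; k≡      = cong (λ g → 10 + (openSum n vertexCost (nats υ markA) + finalCost * g)) (sym go≡)
      } , refl)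
      where
      open Sourced so
      δ≤1 : ∀ x y → δ x y ≤ 1
      δ≤1 zero    zero    = ≤-refl
      δ≤1 zero    (suc y) = z≤n
      δ≤1 (suc x) zero    = z≤n
      δ≤1 (suc x) (suc y) = δ≤1 x y
      items : ∀ v → v < n → Dec (v ≡ s) → δ v s ≡ δ 1 (nats υ markA v)
      items v v<n (yes refl) = trans (δ-refl v) (cong (δ 1) (sym mark-s))
      items v v<n (no v≢s)   = trans (δ-≢ v≢s) (cong (δ 1) (sym (others v v<n v≢s)))

    dijkstraTime : ℕ
    dijkstraTime = 40 + 10 * rank≤ + (n * (50 + 30 * rank≤) + 45 * na)

    record Done (τ : Store) : Set (a₁ ⊔ ℓ₀ ⊔ ℓ₂) where
      field
        static  : Static N τ
        tree-s  : Tree (labelsOf τ) []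
        settled : ∀ v → v < n → nats τ markA v ≢ 1
        slots   : ∀ r → nats τ slotA r ≡ 0

    run-dijkstra : ∀ {σ} → s < n → Static N σ → nats σ sV 0 ≡ s → (∀ r → nats σ slotA r ≡ 0) →
                   Run dijkstra σ (λ j τ → Done τ × j ≤ dijkstraTime)
    run-dijkstra {σ} s<n S s≡ slots = run-seq (run-seq (run-map
        (λ { {j₁} {τ} ((zeros , j₁≤) , fr) → run-seq (run-map (λ { {_} {υ} (so , refl) → run-map
          (λ { (r , refl) → run-map (λ { {j₂} (_ , record { phase = inj₁ g≡1 } , done , _) →
                                           ⊥-elim (does-false (1 ≤? _) done (≤-reflexive (sym g≡1)))
                                       ; {j₂} (k , record { static = S ; resting = R ; tree-s = t ; phase = inj₂ (_ , settled) } , _ , le) →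
                                           record { static = S ; tree-s = t ; settled = settled ; slots = Resting.slots R } ,
                                           bound {j₁} {j₂} {k} j₁≤ le (openSum-≤ n vertexCost (nats υ markA)) })
                               (run-while Running (λ go r → run-dijkstraBody (does-true (1 ≤? _) go) r) r) })
          (run-sourceNode s<n so) })
          (run-sourceLabel (static-frame fr S) (trans (cong-app (Framed.nats≡ fr sV) 0) s≡)
             (λ r → trans (cong-app (Framed.nats≡ fr slotA) r) (slots r)) zeros)) })
        (run-framed (run-clear (Static.n≡ S)))))
      where
      bound : ∀ {j₁ j₂ k W} → j₁ ≤ 2 + 2 * n → j₂ + k ≤ suc (10 + (W + finalCost * 1)) → W ≤ sumTo n vertexCost →
              (j₁ + 2) + j₂ ≤ dijkstraTime
      bound {j₁} {j₂} {k} {W} le le′ W≤ = begin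
        (j₁ + 2) + j₂ ≤⟨ +-mono-≤ (+-monoˡ-≤ 2 le) (≤-trans (m≤m+n j₂ k) le′) ⟩
        (2 + 2 * n + 2) + suc (10 + (W + finalCost * 1)) ≤⟨ +-monoʳ-≤ (2 + 2 * n + 2) (+-monoʳ-≤ 11 (+-monoˡ-≤ (finalCost * 1) W≤)) ⟩
        (2 + 2 * n + 2) + suc (10 + (sumTo n vertexCost + finalCost * 1))
          ≡⟨ cong (λ W → (2 + 2 * n + 2) + suc (10 + (W + finalCost * 1))) (trans (sumTo-+ n (λ _ → 40 + 30 * rank≤) (λ v → 45 * degree v))
               (cong₂ _+_ (sumTo-const n (40 + 30 * rank≤)) (trans (sumTo-* n 45 degree) (cong (45 *_) adj-total)))) ⟩
        (2 + 2 * n + 2) + suc (10 + ((n * (40 + 30 * rank≤) + 45 * na) + finalCost * 1)) ≤⟨ m≤n+m _ (5 + 8 * n) ⟩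
        (5 + 8 * n) + ((2 + 2 * n + 2) + suc (10 + ((n * (40 + 30 * rank≤) + 45 * na) + finalCost * 1))) ≡⟨ solved n rank≤ na ⟩
        dijkstraTime ∎
        where
        open ≤-Reasoning
        solved : ∀ n r a → (5 + 8 * n) + ((2 + 2 * n + 2) + suc (10 + ((n * (40 + 30 * r) + 45 * a) + (20 + 10 * r) * 1))) ≡
                           40 + 10 * r + (n * (50 + 30 * r) + 45 * a)
        solved = solve-∀

    module Potential (G : LabeledGraph Γ) (ℓ : Fin (LabeledGraph.m G) → L.Carrier) (eid : ℕ → ℕ) (R : Represents G ℓ N eid)
                     {Λ : Labels} (t : Tree Λ []) (settled : ∀ v → v < n → Labels.mark Λ v ≢ 1) where
      open LabeledGraph G using () renaming (n to order)
      open Walks G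
      open Represents R
      open Labels Λ
      open Tree t
      private module Λ = Labels Λ

      -- Fundamental cycles of bad arcs

      vertex< : ∀ (v : Vertex) → toℕ v < n
      vertex< v = subst (toℕ v <_) (sym order≡) (toℕ<n v)

      reached : ∀ {v} → v < n → mark v ≢ 0 → mark v ≡ 2
      reached {v} v<n m with mark v ≟ 2
      ... | yes eq = eq
      ... | no ≢2  = ⊥-elim (settled v v<n (below-2 _ (mark≤2 v<n) m ≢2))

      arc-relaxed : ∀ {b} → b < na → mark (from b) ≢ 0 → Relaxed Λ b
      arc-relaxed b<na m with relaxed b<na (reached (from< b<na) m)
      ... | inj₂ r = r

      edge-relaxed : ∀ {e u v} (j : Joins e u v) → mark (toℕ u) ≢ 0 →
                     mark (toℕ v) ≢ 0 × dist (toℕ v) L.≤ dist (toℕ u) L.+ ℓ e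
      edge-relaxed j m with joins j
      ... | b , b<na , arc from≡ to≡ _ _ wgt≡ =
        let seen , le = arc-relaxed b<na (subst (λ x → mark x ≢ 0) (sym from≡) m) in
        subst (λ x → mark x ≢ 0) to≡ seen ,
        subst₂ L._≤_ (cong dist to≡) (cong₂ L._+_ (cong dist from≡) wgt≡) le

      record Bad (b : ℕ) : Set a₂ where
        constructor bad
        field
          seen  : mark (from b) ≢ 0
          wrong : ¬ val (from b) Γ.∙ lab b Γ.≈ val (to b)

      cand : ℕ → L.Carrier
      cand b = wgt b L.+ (dist (to b) L.+ dist (from b))

      -- Induction from the end at s: every edge is used against the direction of the walk, which is
      -- possible since both of its arcs are in the network and relaxed.
      dist≤walk : ∀ {u w} (W : Walk u w) → toℕ w ≡ s → mark (toℕ u) ≢ 0 × dist (toℕ u) L.≤ walkLength L ℓ W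
      dist≤walk (stop v) refl = root
      dist≤walk (step u e j W) w≡s =
        let seen , le = dist≤walk W w≡s
            seen′ , le′ = edge-relaxed (flip G ℓ j) seen
        in seen′ , ≤ˡ-trans le′ (≤ˡ-trans (≤ˡ-reflexive (L.+-comm _ _)) (+-monoʳ (ℓ e) le))

      -- The labels of the arcs of W telescope unless one of them is bad.

      bad-arc : ∀ {u w} (W : Walk u w) → toℕ w ≡ s → ∀ p → dist (toℕ u) L.≤ p →
                val (toℕ u) Γ.∙ ψ W Γ.≈ val (toℕ w) ⊎
                (∃[ b ] (b < na × Bad b × cand b L.≤ p L.+ walkLength L ℓ W))
      bad-arc (stop v) w≡s p _ = inj₁ (Γ.identityʳ _)
      -- Here p is a bound for the distance of u, namely the length of what precedes u, while the
      -- remaining walk bounds the distance of v. Together with the edge itself they cover the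
      -- candidate of a bad arc at this place.
      bad-arc (step u e {v} j W) w≡s p d≤p with joins j
      ... | b , b<na , arc from≡ to≡ _ lab≡ wgt≡ with (val (toℕ u) Γ.∙ ψₑ e j) ≟ᵍ val (toℕ v)
      ... | no wrong = inj₂ (b , b<na ,
            bad (subst (λ x → mark x ≢ 0) (sym from≡) seen)
                (λ eq → wrong (subst₂ Γ._≈_ (cong₂ Γ._∙_ (cong val from≡) lab≡) (cong val to≡) eq)) ,
            ≤ˡ-trans (≤ˡ-reflexive (L.reflexive (cong₂ L._+_ wgt≡ (cong₂ L._+_ (cong dist to≡) (cong dist from≡)))))
              (≤ˡ-trans (+-monoʳ (ℓ e) (+-mono (proj₂ (dist≤walk W w≡s)) d≤p))
                (≤ˡ-reflexive (L.trans (L.sym (L.+-assoc _ _ _)) (L.+-comm _ p)))))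
        where seen = proj₁ (dist≤walk (step u e j W) w≡s)
      ... | yes right with bad-arc W w≡s (p L.+ ℓ e)
                             (≤ˡ-trans (proj₂ (edge-relaxed j (proj₁ (dist≤walk (step u e j W) w≡s)))) (L.+-monoˡ-≤ _ p (ℓ e) d≤p))
      ... | inj₁ eq = inj₁ (Γ.trans (Γ.sym (Γ.assoc _ _ _)) (Γ.trans (Γ.∙-congʳ right) eq))
      ... | inj₂ (b′ , b′<na , bad-b , le) = inj₂ (b′ , b′<na , bad-b , ≤ˡ-trans le (≤ˡ-reflexive (L.+-assoc _ _ _)))

      -- Without a bad arc the label of w, multiplied by that of the closed walk, would be the label
      -- of w again, which forces the walk to be zero.
      bad-cycle : ∀ {w} (D : Walk w w) → toℕ w ≡ s → NonZero D → ∃[ b ] (b < na × Bad b × cand b L.≤ walkLength L ℓ D)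
      bad-cycle {w} D w≡s nz with bad-arc D w≡s L.0# (subst (λ x → dist x L.≤ L.0#) (sym w≡s) (proj₂ root))
      ... | inj₁ eq = ⊥-elim (nz (identityʳ-unique _ _ eq))
      ... | inj₂ (b , b<na , bad-b , le) = b , b<na , bad-b , ≤ˡ-trans le (≤ˡ-reflexive (L.+-identityˡ _))

      -- Tree edges have this property and the edge of a bad arc has not. This tells that edge apart
      -- from the edges of both branches even if it is parallel to one of them.
      ZeroEdge : Edge → Set a₂
      ZeroEdge e = ∀ {p q} (j : Joins e p q) → val (toℕ p) Γ.∙ ψₑ e j Γ.≈ val (toℕ q)

      record Up (y : Vertex) : Set (a₁ ⊔ a₂ ⊔ ℓ₀ ⊔ ℓ₂) where
        field
          {p}   : Vertex
          {e}   : Edge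
          join  : Joins e p y
          p≡    : from (par (toℕ y)) ≡ toℕ p
          e≡    : eid (par (toℕ y)) ≡ toℕ e
          seen  : mark (toℕ p) ≢ 0
          dep≡  : dep (toℕ y) ≡ suc (dep (toℕ p))
          dist≡ : dist (toℕ y) ≡ dist (toℕ p) L.+ ℓ e
          zero-e : ZeroEdge e

      undo : ∀ {x y g} → x Γ.∙ g Γ.≈ y → y Γ.∙ g Γ.⁻¹ Γ.≈ x
      undo {x} {y} {g} eq = Γ.trans (Γ.∙-congʳ (Γ.sym eq)) (Γ.trans (Γ.assoc x g (g Γ.⁻¹)) (Γ.trans (Γ.∙-congˡ (Γ.inverseʳ g)) (Γ.identityʳ x)))

      redo : ∀ {x y g} → x Γ.∙ g Γ.⁻¹ Γ.≈ y → y Γ.∙ g Γ.≈ x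
      redo {x} {y} {g} eq = Γ.trans (Γ.∙-congʳ (Γ.sym eq)) (Γ.trans (Γ.assoc x (g Γ.⁻¹) g) (Γ.trans (Γ.∙-congˡ (Γ.inverseˡ g)) (Γ.identityʳ x)))

      zero-edge : ∀ {e u v} (j : Joins e u v) → val (toℕ u) Γ.∙ ψₑ e j Γ.≈ val (toℕ v) → ZeroEdge e
      zero-edge (inj₁ (refl , refl)) eq (inj₁ (refl , refl)) = eq
      zero-edge (inj₁ (refl , refl)) eq (inj₂ (refl , refl)) = undo eq
      zero-edge (inj₂ (refl , refl)) eq (inj₁ (refl , refl)) = redo eq
      zero-edge (inj₂ (refl , refl)) eq (inj₂ (refl , refl)) = eq

      up : ∀ y → mark (toℕ y) ≢ 0 → toℕ y ≡ s × dep (toℕ y) ≡ 0 ⊎ Up y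
      up y m with parents (vertex< y) m
      ... | inj₁ eq = inj₁ eq
      ... | inj₂ (parent b<na to≡y settled-p dep≡ dist≡ val≡) with arcs b<na
      ... | e , p , v , j , arc from≡ to≡ eid≡ lab≡ wgt≡ with toℕ-injective (trans (sym to≡) to≡y)
      ... | refl = inj₂ (record
            { join = j
            ; p≡ = from≡
            ; e≡ = eid≡
            ; seen = λ m′ → 2≢0 (trans (sym settled-p) (trans (cong mark from≡) m′))
            ; dep≡ = trans dep≡ (cong (λ x → suc (dep x)) from≡)
            ; dist≡ = trans dist≡ (cong₂ L._+_ (cong dist from≡) wgt≡)
            ; zero-e = zero-edge j (Γ.reflexive (sym (trans val≡ (cong₂ Γ._∙_ (cong val from≡) lab≡))))
            })
        where
        2≢0 : 2 ≢ 0
        2≢0 ()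

      -- The two branches of the tree below x and y, which end in the arc from
      -- u₀ to v₀: X leads from x to u₀, and rest is put after the path from v₀
      -- to y by ext.

      record Branches {u₀ v₀ : Vertex} (x y : Vertex) : Set (a₁ ⊔ a₂ ⊔ ℓ₀ ⊔ ℓ₁ ⊔ ℓ₂) where
        field
          seen-x   : mark (toℕ x) ≢ 0
          seen-y   : mark (toℕ y) ≢ 0
          X        : Walk x u₀
          xs       : List Vertex
          ext      : ∀ {z} → Walk y z → Walk v₀ z
          ys       : List Vertex
          es       : List Edge
          X-verts  : vertices X ≡ x ∷ xs
          ext-vs   : ∀ {z} (W : Walk y z) → vertices (ext W) ≡ ys ++ vertices W
          ext-es   : ∀ {z} (W : Walk y z) → edges (ext W) ≡ es ++ edges W
          X-val    : val (toℕ x) Γ.∙ ψ X Γ.≈ val (toℕ u₀)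
          ext-val  : ∀ {z} (W : Walk y z) → val (toℕ v₀) Γ.∙ ψ (ext W) Γ.≈ val (toℕ y) Γ.∙ ψ W
          X-len    : walkLength L ℓ X L.+ dist (toℕ x) L.≤ dist (toℕ u₀)
          ext-len  : ∀ {z} (W : Walk y z) → walkLength L ℓ (ext W) L.+ dist (toℕ y) L.≤ dist (toℕ v₀) L.+ walkLength L ℓ W
          -- Vertices already passed lie strictly below their own end and not above the other one.
          -- At equal depth the explicit inequality is needed to know that the other end has not
          -- been passed.
          deeper-x : All (λ z → dep (toℕ x) < dep (toℕ z) × dep (toℕ y) ≤ dep (toℕ z) × z ≢ y) xs
          deeper-y : All (λ z → dep (toℕ y) < dep (toℕ z) × dep (toℕ x) ≤ dep (toℕ z) × z ≢ x) ys
          unique   : Unique (ys ++ xs)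
          zero-X   : All ZeroEdge (edges X)
          zero-es  : All ZeroEdge es

      module _ {u₀ v₀ : Vertex} where

        branches-start : ∀ {e} (j : Joins e u₀ v₀) → mark (toℕ u₀) ≢ 0 → mark (toℕ v₀) ≢ 0 → Branches {u₀} {v₀} u₀ v₀
        branches-start j seen-u seen-v = record
          { seen-x = seen-u ; seen-y = seen-v
          ; X = stop u₀ ; xs = [] ; ext = λ W → W ; ys = [] ; es = []
          ; X-verts = refl ; ext-vs = λ _ → refl ; ext-es = λ _ → refl
          ; X-val = Γ.identityʳ _ ; ext-val = λ _ → Γ.refl
          ; X-len = ≤ˡ-reflexive (L.+-identityˡ _) ; ext-len = λ _ → ≤ˡ-reflexive (L.+-comm _ _)
          ; deeper-x = [] ; deeper-y = [] ; unique = [] ; zero-X = [] ; zero-es = [] }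

        up-< : ∀ {y} (U : Up y) → dep (toℕ (Up.p U)) < dep (toℕ y)
        up-< U = ≤-reflexive (sym (Up.dep≡ U))

        climb-x : ∀ {x y} → Branches {u₀} {v₀} x y → dep (toℕ y) < dep (toℕ x) → (U : Up x) → Branches {u₀} {v₀} (Up.p U) y
        climb-x {x} {y} B y<x U = record
          { seen-x = Up.seen U ; seen-y = seen-y
          ; X = step p e (Up.join U) X ; xs = x ∷ xs ; ext = ext ; ys = ys ; es = es
          ; X-verts = cong (p ∷_) X-verts ; ext-vs = ext-vs ; ext-es = ext-es
          ; X-val = Γ.trans (Γ.sym (Γ.assoc _ _ _)) (Γ.trans (Γ.∙-congʳ (Up.zero-e U (Up.join U))) X-val)
          ; ext-val = ext-val
          ; X-len = ≤ˡ-trans (≤ˡ-reflexive (L.trans (L.+-congʳ (L.+-comm _ _)) (L.trans (L.+-assoc _ _ _) (L.+-congˡ (L.trans (L.+-comm _ _) (L.reflexive (sym (Up.dist≡ U)))))))) X-len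
          ; ext-len = ext-len
          ; deeper-x = (up-< U , <⇒≤ y<x , (λ { refl → <-irrefl refl y<x })) ∷
                       All.map (λ (a , b , c) → <-trans (up-< U) a , b , c) deeper-x
          ; deeper-y = All.map (λ (a , b , c) → a , ≤-trans (<⇒≤ (up-< U)) b , (λ { refl → <⇒≱ (up-< U) b })) deeper-y
          ; unique = unique-insert ys unique (λ z∈ → proj₂ (proj₂ (All.lookup deeper-y z∈)) refl)
                                             (λ z∈ → <-irrefl refl (proj₁ (All.lookup deeper-x z∈)))
          ; zero-X = Up.zero-e U ∷ zero-X ; zero-es = zero-es }
          where
          open Branches B
          p = Up.p U
          e = Up.e U

        -- Ties in depth are resolved in favour of climbing on this side, and then x ≢ y provides
        -- the inequality that `deeper-y` asks of the passed vertex y.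
        climb-y : ∀ {x y} → Branches {u₀} {v₀} x y → x ≢ y → dep (toℕ x) ≤ dep (toℕ y) → (U : Up y) → Branches {u₀} {v₀} x (Up.p U)
        climb-y {x} {y} B x≢y x≤y U = record
          { seen-x = seen-x ; seen-y = Up.seen U
          ; X = X ; xs = xs ; ext = λ W → ext (step y e (flip G ℓ (Up.join U)) W) ; ys = ys ++ y ∷ [] ; es = es ++ e ∷ []
          ; X-verts = X-verts
          ; ext-vs = λ W → trans (ext-vs _) (sym (++-assoc ys (y ∷ []) (vertices W)))
          ; ext-es = λ W → trans (ext-es _) (sym (++-assoc es (e ∷ []) (edges W)))
          ; X-val = X-val
          ; ext-val = λ W → Γ.trans (ext-val _) (Γ.trans (Γ.sym (Γ.assoc _ _ _)) (Γ.∙-congʳ (Up.zero-e U (flip G ℓ (Up.join U)))))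
          ; X-len = X-len
          ; ext-len = λ W → ext-len′ W
          ; deeper-x = All.map (λ (a , b , c) → a , ≤-trans (<⇒≤ (up-< U)) b , (λ { refl → <⇒≱ (up-< U) b })) deeper-x
          ; deeper-y = All.++⁺ (All.map (λ (a , b , c) → <-trans (up-< U) a , b , c) deeper-y)
                               ((up-< U , x≤y , (λ eq → x≢y (sym eq))) ∷ [])
          ; unique = subst Unique (sym (++-assoc ys (y ∷ []) xs))
                       (unique-insert ys unique (λ z∈ → <-irrefl refl (proj₁ (All.lookup deeper-y z∈)))
                                                (λ z∈ → proj₂ (proj₂ (All.lookup deeper-x z∈)) refl))
          ; zero-X = zero-X ; zero-es = All.++⁺ zero-es (Up.zero-e U ∷ []) }
          where
          open Branches B
          p = Up.p U
          e = Up.e U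
          -- The tree edge of length b now belongs to the walk instead of to the distance of its
          -- lower end; adding - b on both sides removes it from each.
          cancel : ∀ {a b c d w} → a L.+ d L.≤ c L.+ (b L.+ w) → d L.≈ dist (toℕ p) L.+ b → a L.+ dist (toℕ p) L.≤ c L.+ w
          cancel {a} {b} {c} {d} {w} le eq = ≤ˡ-trans (≤ˡ-reflexive (L.sym l≈)) (≤ˡ-trans (L.+-monoˡ-≤ _ _ (L.- b) le) (≤ˡ-reflexive r≈))
            where
            minus : ∀ x → (x L.+ b) L.+ L.- b L.≈ x
            minus x = L.trans (L.+-assoc x b (L.- b)) (L.trans (L.+-congˡ (L.-‿inverseʳ b)) (L.+-identityʳ x))
            l≈ : (a L.+ d) L.+ L.- b L.≈ a L.+ dist (toℕ p)
            l≈ = L.trans (L.+-congʳ (L.trans (L.+-congˡ eq) (L.sym (L.+-assoc a _ b)))) (minus _)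
            r≈ : (c L.+ (b L.+ w)) L.+ L.- b L.≈ c L.+ w
            r≈ = L.trans (L.+-congʳ (L.trans (L.+-congˡ (L.+-comm b w)) (L.sym (L.+-assoc c w b)))) (minus _)
          ext-len′ : ∀ {z} (W : Walk p z) → walkLength L ℓ (ext (step y e (flip G ℓ (Up.join U)) W)) L.+ dist (toℕ p) L.≤ dist (toℕ v₀) L.+ walkLength L ℓ W
          ext-len′ W = cancel (ext-len (step y e (flip G ℓ (Up.join U)) W)) (L.reflexive (Up.dist≡ U))

        module _ {e₀} (j₀ : Joins e₀ u₀ v₀) (wrong : ¬ val (toℕ u₀) Γ.∙ ψₑ e₀ j₀ Γ.≈ val (toℕ v₀))
                 {w} (B : Branches {u₀} {v₀} w w) where
          open Branches B

          cycle : Walk u₀ u₀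
          cycle = step u₀ e₀ j₀ (ext X)

          cycle-vertices : vertices cycle ≡ u₀ ∷ ys ++ w ∷ xs
          cycle-vertices = cong (u₀ ∷_) (trans (ext-vs X) (cong (ys ++_) X-verts))

          cycle-edges : edges cycle ≡ e₀ ∷ es ++ edges X
          cycle-edges = cong (e₀ ∷_) (ext-es X)

          cycle-IsCycle : IsCycle cycle
          cycle-IsCycle = refl ,
            subst Unique (sym (trans (ext-vs X) (cong (ys ++_) X-verts)))
              (unique-insert ys unique (λ z∈ → <-irrefl refl (proj₁ (All.lookup deeper-y z∈)))
                                       (λ z∈ → <-irrefl refl (proj₁ (All.lookup deeper-x z∈)))) ,
            -- All edges of the branches satisfy `ZeroEdge`, which for `e₀` would contradict
            -- `wrong`.
            (λ e₀∈ → wrong (All.lookup (All.++⁺ zero-es zero-X) (subst (e₀ ∈_) (ext-es X) e₀∈) j₀))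

          -- The path `ext X` carries the label of v₀ to that of u₀. If the cycle were zero, it
          -- would carry `val (toℕ u₀) ∙ ψₑ e₀ j₀` there too, and cancellation on the right would
          -- make the arc good.
          cycle-NonZero : NonZero cycle
          cycle-NonZero eq = wrong (∙-cancelʳ (ψ (ext X)) _ _ (Γ.trans (Γ.assoc _ _ _)
            (Γ.trans (Γ.∙-congˡ eq) (Γ.trans (Γ.identityʳ _) (Γ.sym (Γ.trans (ext-val X) X-val))))))

          -- Each branch has at most the distance of its lower end minus that of w, and the distance
          -- of w is nonnegative.
          cycle-length : walkLength L ℓ cycle L.≤ ℓ e₀ L.+ (dist (toℕ v₀) L.+ dist (toℕ u₀))
          cycle-length = +-monoʳ (ℓ e₀) (≤ˡ-trans (≤-+ʳ _ (nonneg (vertex< w) seen-x)) (≤ˡ-trans (ext-len X)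
            (+-monoʳ (dist (toℕ v₀)) (≤ˡ-trans (≤-+ʳ _ (nonneg (vertex< w) seen-x)) X-len))))

      -- The scan for the best bad arc

      record Fixed (τ : Store) : Set (a₁ ⊔ ℓ₀) where
        field
          static  : Static N τ
          eid≡    : nats τ edgeA ≡ eid
          labels≡ : labelsOf τ ≡ Λ

      -- `found₀` and `min₀` are the values left by earlier sources. `source` distinguishes a scan
      -- that keeps them, so that the earlier output stands, from one whose minimum is the candidate
      -- of a bad arc of the present tree.
      record Scanned (found₀ : ℕ) (min₀ : L.Carrier) (i found : ℕ) (min : L.Carrier) (barc : ℕ) : Set (a₂ ⊔ ℓ₀ ⊔ ℓ₂) where
        field
          covered : ∀ b → b < i → Bad b → found ≡ 1 × min L.≤ cand b
          earlier : found₀ ≡ 1 → found ≡ 1 × min L.≤ min₀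
          source  : (barc ≡ 0 × found ≡ found₀ × min ≡ min₀) ⊎
                    (∃[ b ] (barc ≡ suc b × b < na × Bad b × min ≡ cand b × found ≡ 1))
          flag    : found ≤ 1

      scanned-skip : ∀ {f₀ M₀ i f M c} → Scanned f₀ M₀ i f M c → (Bad i → f ≡ 1 × M L.≤ cand i) → Scanned f₀ M₀ (suc i) f M c
      scanned-skip {i = i} S at-i = record
        { covered = λ b b≤i → cover b (m≤n⇒m<n∨m≡n (≤-pred b≤i)) ; earlier = earlier ; source = source ; flag = flag }
        where
        open Scanned S
        cover : ∀ b → b < i ⊎ b ≡ i → Bad b → _
        cover b (inj₁ b<i) = covered b b<i
        cover b (inj₂ refl) = at-i

      scanned-take : ∀ {f₀ M₀ i f M c M′ c′} → Scanned f₀ M₀ i f M c → i < na → Bad i → (f ≡ 1 → cand i L.≤ M) →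
                     M′ ≡ cand i → c′ ≡ suc i → Scanned f₀ M₀ (suc i) 1 M′ c′
      scanned-take {i = i} S i<na bad-i le refl refl = record
        { covered = λ b b≤i → cover b (m≤n⇒m<n∨m≡n (≤-pred b≤i))
        ; earlier = λ f₀ → refl , (let f , M≤ = earlier f₀ in ≤ˡ-trans (le f) M≤)
        ; source  = inj₂ (i , refl , i<na , bad-i , refl , refl)
        ; flag    = ≤-refl
        }
        where
        open Scanned S
        cover : ∀ b → b < i ⊎ b ≡ i → Bad b → 1 ≡ 1 × cand i L.≤ cand b
        cover b (inj₁ b<i) bad-b = let f , M≤ = covered b b<i bad-b in refl , ≤ˡ-trans (le f) M≤
        cover b (inj₂ refl) _ = refl , ≤ˡ-refl

      record Scanning (f₀ : ℕ) (M₀ : L.Carrier) (i : ℕ) (τ : Store) : Set (a₁ ⊔ a₂ ⊔ ℓ₀ ⊔ ℓ₂) where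
        field
          fixed   : Fixed τ
          scanned : Scanned f₀ M₀ i (nats τ foundV 0) (lens τ minV 0) (nats τ barcV 0)

      module _ {f₀ : ℕ} {M₀ : L.Carrier} {i : ℕ} (i<na : i < na) where

        record Ready (τ : Store) : Set (a₁ ⊔ a₂ ⊔ ℓ₀ ⊔ ℓ₂) where
          field
            scanning : Scanning f₀ M₀ i τ
            b≡       : nats τ bV 0 ≡ i
            u≡       : nats τ uV 0 ≡ from i
            v≡       : nats τ vV 0 ≡ to i

        run-take : ∀ {τ} → Ready τ → Bad i → lens τ candV 0 ≡ cand i → (nats τ foundV 0 ≡ 1 → cand i L.≤ lens τ minV 0) →
                   Run take τ (λ j υ → Scanning f₀ M₀ (suc i) υ × j ≡ 1)
        run-take r bad-i c≡ le = block take (_ , record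
          { fixed = record { static = record { Static (Fixed.static (Scanning.fixed scanning)) } ; eid≡ = Fixed.eid≡ (Scanning.fixed scanning) ; labels≡ = Fixed.labels≡ (Scanning.fixed scanning) }
          ; scanned = scanned-take (Scanning.scanned scanning) i<na bad-i le c≡ (trans (+-comm _ 1) (cong suc b≡)) } , refl)
          where open Ready r

        run-scanTest : ∀ {τ} → Ready τ → Bad i → lens τ candV 0 ≡ cand i →
                       Run scanTest τ (λ j υ → Scanning f₀ M₀ (suc i) υ × j ≤ 3)
        run-scanTest {τ} r bad-i c≡ = run-if
          (λ le → run-map (λ { (s , refl) → s , s≤s (s≤s z≤n) }) (run-take r bad-i c≡
             (λ f≡1 → ⊥-elim (n≮0 (subst (_≤ 0) f≡1 (does-true (nats τ foundV 0 ≤? 0) le))))))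
          (λ gt → run-if
            (λ le → block skip (_ , record
               { fixed = Scanning.fixed scanning
               ; scanned = scanned-skip (Scanning.scanned scanning) (λ _ →
                   ≤-antisym (Scanned.flag (Scanning.scanned scanning)) (≰⇒> (does-false (nats τ foundV 0 ≤? 0) gt)) ,
                   subst (lens τ minV 0 L.≤_) c≡ (does-true (lens τ minV 0 L.≤? _) le)) } , ≤-refl))
            (λ ≰ → run-map (λ { (s , refl) → s , ≤-refl }) (run-take r bad-i c≡ (λ _ → nearer (does-false (lens τ minV 0 L.≤? _) ≰)))))
          where
          open Ready r
          nearer : ¬ lens τ minV 0 L.≤ lens τ candV 0 → cand i L.≤ lens τ minV 0
          nearer ≰ with IsDecTotalOrder.total L.isDecTotalOrder (cand i) (lens τ minV 0)
          ... | inj₁ p = p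
          ... | inj₂ p = ⊥-elim (≰ (subst (lens τ minV 0 L.≤_) (sym c≡) p))

        run-scanCase : ∀ {τ} → Ready τ → Run scanCase τ (λ j υ → Scanning f₀ M₀ (suc i) υ × j ≤ 6)
        run-scanCase {τ} r = run-if
          (λ le → block skip (_ , skipped (λ bad-i → Bad.seen bad-i (trans (sym mark≡) (n≤0⇒n≡0 (does-true (nats τ markA (nats τ uV 0) ≤? 0) le)))) , s≤s (s≤s z≤n)))
          (λ gt → run-if
            (λ eq → block skip (_ , skipped (λ bad-i → Bad.wrong bad-i
               (subst₂ Γ._≈_ prod≡ val≡ (does-true (_ ≟ᵍ grps τ gA (nats τ vV 0)) eq))) , s≤s (s≤s (s≤s z≤n))))
            (λ neq → run-seq (block _ (_ , run-map (λ (s , le) → s , s≤s (s≤s (s≤s le))) (run-scanTest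
               record { scanning = record { fixed = record { static = record { Static (Fixed.static fixed) } ; eid≡ = Fixed.eid≡ fixed ; labels≡ = Fixed.labels≡ fixed } ; scanned = scanned } ; b≡ = b≡ ; u≡ = u≡ ; v≡ = v≡ }
               (bad (λ m → does-false (nats τ markA (nats τ uV 0) ≤? 0) gt (≤-reflexive (trans mark≡ m)))
                    (λ eq → does-false (_ ≟ᵍ grps τ gA (nats τ vV 0)) neq (subst₂ Γ._≈_ (sym prod≡) (sym val≡) eq)))
               cand≡)))))
          where
          open Ready r
          open Scanning scanning
          open Fixed fixed
          mark≡ : nats τ markA (nats τ uV 0) ≡ mark (from i)
          mark≡ = trans (cong (nats τ markA) u≡) (cong (λ Λ → Labels.mark Λ (from i)) labels≡)
          val≡ : grps τ gA (nats τ vV 0) ≡ val (to i)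
          val≡ = trans (cong (grps τ gA) v≡) (cong (λ Λ → Labels.val Λ (to i)) labels≡)
          prod≡ : grps τ gA (nats τ uV 0) Γ.∙ grps τ labA (nats τ bV 0) ≡ val (from i) Γ.∙ lab i
          prod≡ = cong₂ Γ._∙_ (trans (cong (grps τ gA) u≡) (cong (λ Λ → Labels.val Λ (from i)) labels≡))
                              (trans (cong (grps τ labA) b≡) (cong-app (Static.lab≡ static) i))
          cand≡ : lens τ lenA (nats τ bV 0) L.+ (lens τ distA (nats τ vV 0) L.+ lens τ distA (nats τ uV 0)) ≡ cand i
          cand≡ = cong₂ L._+_ (trans (cong (lens τ lenA) b≡) (cong-app (Static.wgt≡ static) i))
                    (cong₂ L._+_ (trans (cong (lens τ distA) v≡) (cong (λ Λ → Labels.dist Λ (to i)) labels≡))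
                                 (trans (cong (lens τ distA) u≡) (cong (λ Λ → Labels.dist Λ (from i)) labels≡)))
          skipped : ¬ Bad i → Scanning f₀ M₀ (suc i) τ
          skipped ¬bad = record { fixed = fixed ; scanned = scanned-skip scanned (λ bad-i → ⊥-elim (¬bad bad-i)) }

      run-scan : ∀ {τ} → Fixed τ → nats τ foundV 0 ≤ 1 →
                 Run scan τ (λ j υ → Scanning (nats τ foundV 0) (lens τ minV 0) na υ × j ≤ 2 + 10 * na)
      run-scan {τ} fixed flag = run-seq (block _ (_ , run-map
          (λ { {j} {υ} (_ , (i , S , b≡ , i≤na , refl) , done , le) →
               subst (λ i → Scanning _ _ i υ) (≤-antisym i≤na (≮⇒≥ (λ i<na → does-false (suc (nats υ bV 0) ≤? nats υ naV 0) done
                 (subst₂ (λ i n → suc i ≤ n) (sym b≡) (sym (Static.na≡ (Fixed.static (Scanning.fixed S)))) i<na)))) S ,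
               s≤s (≤-trans (m≤m+n j _) le) })
          (run-while Inv body (0 , record { fixed = record { static = record { Static (Fixed.static fixed) } ; eid≡ = Fixed.eid≡ fixed ; labels≡ = Fixed.labels≡ fixed } ; scanned = record
            { covered = λ _ () ; earlier = λ f → f , ≤ˡ-refl ; source = inj₁ (refl , refl , refl) ; flag = flag } } , refl , z≤n , refl))))
        where
        f₀ = nats τ foundV 0
        M₀ = lens τ minV 0
        Inv : ℕ → Store → Set _
        Inv k υ = ∃[ i ] (Scanning f₀ M₀ i υ × nats υ bV 0 ≡ i × i ≤ na × k ≡ 10 * (na ∸ i))
        body : ∀ {k υ} → test (one +ⁿ var bV ≤ⁿ var naV) υ ≡ true → Inv k υ →
               Run scanBody υ (λ j φ → ∃[ k′ ] (Inv k′ φ × suc (j + k′) ≤ k))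
        body {υ = υ} go (i , S , refl , _ , refl) = run-seq (block scanFetch (_ , run-seq (run-map
            (λ { {j} ((S′ , le) , fr) → block _ (_ , _ ,
                 (suc i , record { fixed = record { static = record { Static (Fixed.static (Scanning.fixed S′)) } ; eid≡ = Fixed.eid≡ (Scanning.fixed S′) ; labels≡ = Fixed.labels≡ (Scanning.fixed S′) } ; scanned = Scanning.scanned S′ } ,
                  trans (cong (_+ 1) (cong-app (Framed.nats≡ fr bV) 0)) (+-comm i 1) , i<na , refl) ,
                 cost le) })
            (run-framed (run-scanCase i<na record
              { scanning = record { fixed = record { static = record { Static (Fixed.static (Scanning.fixed S)) } ; eid≡ = Fixed.eid≡ (Scanning.fixed S) ; labels≡ = Fixed.labels≡ (Scanning.fixed S) } ; scanned = Scanning.scanned S }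
              ; b≡ = refl ; u≡ = cong-app (Static.from≡ static) i ; v≡ = cong-app (Static.to≡ static) i })))))
          where
          open Fixed (Scanning.fixed S) using (static)
          i<na : i < na
          i<na = subst (suc i ≤_) (Static.na≡ static) (does-true (suc i ≤? nats υ naV 0) go)
          cost : ∀ {j} → j ≤ 6 → suc ((1 + (j + 1)) + 10 * (na ∸ suc i)) ≤ 10 * (na ∸ i)
          cost {j} le = begin
            suc ((1 + (j + 1)) + 10 * (na ∸ suc i)) ≤⟨ s≤s (+-monoˡ-≤ (10 * (na ∸ suc i)) (s≤s (+-monoˡ-≤ 1 le))) ⟩
            9 + 10 * (na ∸ suc i) ≤⟨ n≤1+n _ ⟩
            10 + 10 * (na ∸ suc i) ≡⟨ *-suc 10 (na ∸ suc i) ⟨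
            10 * suc (na ∸ suc i) ≡⟨ cong (10 *_) (+-∸-assoc 1 i<na) ⟨
            10 * (na ∸ i) ∎
            where open ≤-Reasoning

      -- Writing the fundamental cycle to the output

      module _ {e₀ : Edge} {u₀ v₀ : Vertex} where

        -- A step lowers one of the depths by 1 and takes 3 ticks with its loop test. On the side of
        -- x the other 2 are kept for unwinding the vertex put on the pile.
        record Climbing (k : ℕ) (τ : Store) : Set (a₁ ⊔ a₂ ⊔ ℓ₀ ⊔ ℓ₁ ⊔ ℓ₂) where
          field
            {x y}  : Vertex
            fixed  : Fixed τ
            x≡     : nats τ xV 0 ≡ toℕ x
            y≡     : nats τ yV 0 ≡ toℕ y
            B      : Branches {u₀} {v₀} x y
          open Branches B
          field
            verts  : Prefix (nats τ vertO) 0 (u₀ ∷ ys)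
            edgs   : Prefix (nats τ edgeO) 0 (e₀ ∷ es)
            j≡ys   : nats τ jV 0 ≡ length (u₀ ∷ ys)
            j≡es   : nats τ jV 0 ≡ length (e₀ ∷ es)
            pile-v : Pile (nats τ tmpV) (nats τ tV 0) xs
            pile-e : Pile (nats τ tmpE) (nats τ tV 0) (edges X)
            k≡     : k ≡ 5 * (Λ.dep (toℕ x) + Λ.dep (toℕ y)) + 2 * length xs

        length-snoc : ∀ {a} {A : Set a} (xs : List A) {x} → length (xs ++ x ∷ []) ≡ suc (length xs)
        length-snoc xs = trans (length-++ xs) (+-comm (length xs) 1)

        run-climbBody : ∀ {k τ} → 1 ≤ (nats τ xV 0 ∸ nats τ yV 0) + (nats τ yV 0 ∸ nats τ xV 0) → Climbing k τ →
                        Run climbBody τ (λ j υ → ∃[ k′ ] (Climbing k′ υ × suc (j + k′) ≤ k))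
        run-climbBody {τ = τ} differ record { x = x ; y = y ; fixed = fixed ; x≡ = x≡ ; y≡ = y≡ ; B = B ; verts = verts ; edgs = edgs
                                            ; j≡ys = j≡ys ; j≡es = j≡es ; pile-v = pile-v ; pile-e = pile-e ; k≡ = refl } = run-if
            (λ le → let le′ = subst₂ _≤_ (dep≡ x≡) (dep≡ y≡) (does-true (nats τ depA (nats τ xV 0) ≤? _) le) in y-branch le′ (up-y le′))
            (λ gt → let gt′ = ≰⇒> (subst₂ (λ a b → ¬ a ≤ b) (dep≡ x≡) (dep≡ y≡) (does-false (nats τ depA (nats τ xV 0) ≤? _) gt)) in x-branch gt′ (up-x gt′))
          where
          open Branches B
          open Fixed fixed
          x≢y : x ≢ y
          x≢y refl = n≮0 (subst (1 ≤_) (trans (cong₂ (λ a b → (a ∸ b) + (b ∸ a)) x≡ y≡) (cong₂ _+_ (n∸n≡0 (toℕ x)) (n∸n≡0 (toℕ x)))) differ)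
          dep≡ : ∀ {i v} → i ≡ v → nats τ depA i ≡ Λ.dep v
          dep≡ refl = cong (λ Λ → Labels.dep Λ _) labels≡
          par≡ : ∀ {i v} → i ≡ v → nats τ parA i ≡ Λ.par v
          par≡ refl = cong (λ Λ → Labels.par Λ _) labels≡
          from′ : ∀ {i v w} → i ≡ v → from (Λ.par v) ≡ w → nats τ fromA (nats τ parA i) ≡ w
          from′ {i} eq eq′ = trans (cong (nats τ fromA) (par≡ eq)) (trans (cong-app (Static.from≡ static) _) eq′)
          edge′ : ∀ {i v w} → i ≡ v → eid (Λ.par v) ≡ w → nats τ edgeA (nats τ parA i) ≡ w
          edge′ {i} eq eq′ = trans (cong (nats τ edgeA) (par≡ eq)) (trans (cong-app eid≡ _) eq′)
          up-x : Λ.dep (toℕ y) < Λ.dep (toℕ x) → Up x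
          up-x y<x with up x seen-x
          ... | inj₁ (_ , d) = ⊥-elim (n≮0 (subst (Λ.dep (toℕ y) <_) d y<x))
          ... | inj₂ U = U
          -- Only the source has no parent. Were y the source, x would have depth 0 too, hence no
          -- parent, and would equal y.
          up-y : Λ.dep (toℕ x) ≤ Λ.dep (toℕ y) → Up y
          up-y x≤y with up y seen-y | up x seen-x
          ... | inj₂ U | _ = U
          ... | inj₁ (y≡s , _) | inj₁ (x≡s , _) = ⊥-elim (x≢y (toℕ-injective (trans x≡s (sym y≡s))))
          ... | inj₁ (_ , d) | inj₂ U = ⊥-elim (n≮0 (≤-trans (subst (0 <_) (sym (Up.dep≡ U)) (s≤s z≤n)) (≤-trans x≤y (≤-reflexive d))))
          d = Λ.dep (toℕ x)
          d′ = Λ.dep (toℕ y)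
          y-branch : d ≤ d′ → (U : Up y) → Run _ τ (λ j υ → ∃[ k′ ] (Climbing k′ υ × suc (suc j + k′) ≤ 5 * (d + d′) + 2 * length xs))
          y-branch x≤y U = block _ (_ , _ , record
              { fixed  = record { static = record { Static static } ; eid≡ = eid≡ ; labels≡ = labels≡ }
              ; x≡     = x≡
              ; y≡     = from′ y≡ (Up.p≡ U)
              ; B      = climb-y B x≢y x≤y U
              ; verts  = prefix-write vertO (u₀ ∷ ys) j≡ys y≡ verts
              ; edgs   = prefix-write edgeO (e₀ ∷ es) j≡es (edge′ y≡ (Up.e≡ U)) edgs
              ; j≡ys   = trans (cong (_+ 1) j≡ys) (trans (+-comm _ 1) (cong suc (sym (length-snoc ys))))
              ; j≡es   = trans (cong (_+ 1) j≡es) (trans (+-comm _ 1) (cong suc (sym (length-snoc es))))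
              ; pile-v = pile-v
              ; pile-e = pile-e
              ; k≡     = refl
              } , (begin
                3 + (5 * (d + p) + 2 * length xs) ≤⟨ m≤n+m _ 2 ⟩
                2 + (3 + (5 * (d + p) + 2 * length xs)) ≡⟨ solved d p (length xs) ⟩
                5 * (d + suc p) + 2 * length xs ≡⟨ cong (λ z → 5 * (d + z) + 2 * length xs) (Up.dep≡ U) ⟨
                5 * (d + d′) + 2 * length xs ∎))
            where
            open ≤-Reasoning
            p = Λ.dep (toℕ (Up.p U))
            solved : ∀ d p l → 2 + (3 + (5 * (d + p) + 2 * l)) ≡ 5 * (d + suc p) + 2 * l
            solved = solve-∀
          x-branch : d′ < d → (U : Up x) → Run _ τ (λ j υ → ∃[ k′ ] (Climbing k′ υ × suc (suc j + k′) ≤ 5 * (d + d′) + 2 * length xs))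
          x-branch y<x U = block _ (_ , _ , record
              { fixed  = record { static = record { Static static } ; eid≡ = eid≡ ; labels≡ = labels≡ }
              ; x≡     = from′ x≡ (Up.p≡ U)
              ; y≡     = y≡
              ; B      = climb-x B y<x U
              ; verts  = verts
              ; edgs   = edgs
              ; j≡ys   = j≡ys
              ; j≡es   = j≡es
              ; pile-v = pile-write tmpV xs x≡ pile-v
              ; pile-e = pile-write tmpE (edges X) (edge′ x≡ (Up.e≡ U)) pile-e
              ; k≡     = refl
              } , ≤-reflexive (trans (solved d′ p (length xs)) (cong (λ z → 5 * (z + d′) + 2 * length xs) (sym (Up.dep≡ U)))))
            where
            p = Λ.dep (toℕ (Up.p U))
            solved : ∀ d p l → 3 + (5 * (p + d) + 2 * suc l) ≡ 5 * (suc p + d) + 2 * l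
            solved = solve-∀

      -- `vs₁` and `es₁` are written, `vs₂` and `es₂` wait on the piles. The vertex at which the
      -- branches meet is written before the loop, so the vertices are one ahead of the edges
      -- counted by `jV`.
      record Unwinding (vs : List Vertex) (es : List Edge) (k : ℕ) (τ : Store) : Set (a₁ ⊔ ℓ₀) where
        field
          {vs₁ vs₂} : List Vertex
          {es₁ es₂} : List Edge
          vs≡    : vs₁ ++ vs₂ ≡ vs
          es≡    : es₁ ++ es₂ ≡ es
          verts  : Prefix (nats τ vertO) 0 vs₁
          edgs   : Prefix (nats τ edgeO) 0 es₁
          j≡vs   : suc (nats τ jV 0) ≡ length vs₁
          j≡es   : nats τ jV 0 ≡ length es₁
          pile-v : Pile (nats τ tmpV) (nats τ tV 0) vs₂
          pile-e : Pile (nats τ tmpE) (nats τ tV 0) es₂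
          k≡     : k ≡ 2 * length vs₂

      run-unwindBody : ∀ {vs es k τ} → 1 ≤ nats τ tV 0 → Unwinding vs es k τ →
                       Run unwindBody τ (λ j υ → ∃[ k′ ] (Unwinding vs es k′ υ × suc (j + k′) ≤ k))
      run-unwindBody t≥1 record { vs₂ = [] ; pile-v = t≡0 } = ⊥-elim (n≮0 (subst (1 ≤_) t≡0 t≥1))
      run-unwindBody t≥1 record { es₂ = [] ; pile-e = t≡0 } = ⊥-elim (n≮0 (subst (1 ≤_) t≡0 t≥1))
      run-unwindBody {τ = τ} _ record { vs₁ = vs₁ ; vs₂ = v ∷ vs₂ ; es₁ = es₁ ; es₂ = e ∷ es₂ ; vs≡ = vs≡ ; es≡ = es≡ ; verts = verts ; edgs = edgs
                              ; j≡vs = j≡vs ; j≡es = j≡es ; pile-v = p , t≡ , v≡ , pile-v ; pile-e = q , t≡′ , e≡ , pile-e ; k≡ = refl } =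
        block unwindBody (_ , _ , record
          { vs≡    = trans (++-assoc vs₁ (v ∷ []) vs₂) vs≡
          ; es≡    = trans (++-assoc es₁ (e ∷ []) es₂) es≡
          ; verts  = prefix-write vertO vs₁ (trans (+-comm _ 1) j≡vs) (trans (cong (λ t → nats τ tmpV (t ∸ 1)) t≡) v≡) verts
          ; edgs   = prefix-write edgeO es₁ j≡es (trans (cong (λ t → nats τ tmpE (t ∸ 1)) t≡′) e≡) edgs
          ; j≡vs   = trans (cong suc (trans (+-comm _ 1) j≡vs)) (sym (trans (length-++ vs₁) (+-comm (length vs₁) 1)))
          ; j≡es   = trans (+-comm _ 1) (trans (cong suc j≡es) (sym (trans (length-++ es₁) (+-comm (length es₁) 1))))
          ; pile-v = subst (λ t → Pile (nats τ tmpV) t vs₂) (sym (cong (_∸ 1) t≡)) pile-v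
          ; pile-e = subst (λ t → Pile (nats τ tmpE) t es₂) (sym (cong (_∸ 1) t≡′)) pile-e
          ; k≡     = refl
          } , ≤-reflexive (sym (*-suc 2 (length vs₂))))

      record Extracted (b : ℕ) (τ : Store) : Set (a₁ ⊔ a₂ ⊔ ℓ₀ ⊔ ℓ₂) where
        field
          {v}     : Vertex
          C       : Walk v v
          isCycle : IsCycle C
          nonzero : NonZero C
          length≤ : walkLength L ℓ C L.≤ cand b
          count≡  : nats τ countO 0 ≡ length (edges C)
          verts   : Lists G ℓ (nats τ vertO) (vertices C)
          edgs    : Lists G ℓ (nats τ edgeO) (edges C)

      dep<n : ∀ (v : Vertex) → Λ.mark (toℕ v) ≢ 0 → Λ.dep (toℕ v) ≤ n
      dep<n v m = ≤-trans (≤-trans (n≤1+n _) (m≤m+n _ _)) (Tree.depth₂ t (vertex< v) (reached (vertex< v) m))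

      run-extract : ∀ {b τ} → Fixed τ → nats τ barcV 0 ≡ suc b → b < na → Bad b →
                    Run extract τ (λ j υ → Extracted b υ × j ≤ 6 + 10 * n)
      run-extract {b} {τ} fixed c≡ b<na bad-b with Represents.arcs R b<na
      ... | e₀ , u₀ , v₀ , j₀ , arc from≡ to≡ eid≡₀ lab≡ wgt≡ = run-if
          (λ le → ⊥-elim (n≮0 (subst (_≤ 0) c≡ (does-true (nats τ barcV 0 ≤? 0) le))))
          (λ _ → run-seq (run-map (λ { {_} (c , refl) → run-seq (run-map
            (λ { {j₁} {υ₁} (k , record { x = x ; y = y ; x≡ = x≡ ; y≡ = y≡ ; B = B ; verts = vs ; edgs = es ; j≡ys = j≡ys ; j≡es = j≡es ; pile-v = pv ; pile-e = pe ; k≡ = refl } , done , le) →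
                 climbed {j₁} {υ₁} x≡ y≡ (same-end {υ₁} x≡ y≡ done) B vs es j≡ys j≡es pv pe le })
            (run-while (Climbing {e₀} {u₀} {v₀}) (λ go c → run-climbBody (does-true (1 ≤? _) go) c) c)) }) start))
        where
        D = 5 * (Λ.dep (toℕ u₀) + Λ.dep (toℕ v₀))
        seen-u : Λ.mark (toℕ u₀) ≢ 0
        seen-u = subst (λ x → Λ.mark x ≢ 0) from≡ (Bad.seen bad-b)
        seen-v : Λ.mark (toℕ v₀) ≢ 0
        seen-v = subst (λ x → Λ.mark x ≢ 0) to≡ (proj₁ (arc-relaxed b<na (Bad.seen bad-b)))
        wrong : ¬ Λ.val (toℕ u₀) Γ.∙ ψₑ e₀ j₀ Γ.≈ Λ.val (toℕ v₀)
        wrong eq = Bad.wrong bad-b (subst₂ Γ._≈_ (sym (cong₂ Γ._∙_ (cong Λ.val from≡) lab≡)) (sym (cong Λ.val to≡)) eq)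
        open Fixed fixed

        start : Run extractInit τ (λ j υ → Climbing {e₀} {u₀} {v₀} (D + 0) υ × j ≡ 1)
        start = block extractInit (_ , record
          { fixed  = record { static = record { Static static } ; eid≡ = eid≡ ; labels≡ = labels≡ }
          ; x≡     = trans (cong (λ c → nats τ fromA (c ∸ 1)) c≡) (trans (cong-app (Static.from≡ static) b) from≡)
          ; y≡     = trans (cong (λ c → nats τ toA (c ∸ 1)) c≡) (trans (cong-app (Static.to≡ static) b) to≡)
          ; B      = branches-start j₀ seen-u seen-v
          ; verts  = trans (cong (λ c → nats τ fromA (c ∸ 1)) c≡) (trans (cong-app (Static.from≡ static) b) from≡) , tt
          ; edgs   = trans (cong (λ c → nats τ edgeA (c ∸ 1)) c≡) (trans (cong-app eid≡ b) eid≡₀) , tt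
          ; j≡ys   = refl
          ; j≡es   = refl
          ; pile-v = refl
          ; pile-e = refl
          ; k≡     = refl
          } , refl)

        same-end : ∀ {υ} {x y : Vertex} → nats υ xV 0 ≡ toℕ x → nats υ yV 0 ≡ toℕ y →
                   test (one ≤ⁿ (var xV ∸ⁿ var yV) +ⁿ (var yV ∸ⁿ var xV)) υ ≡ false → x ≡ y
        same-end {υ} x≡ y≡ done = toℕ-injective (trans (sym x≡) (trans
            (≤-antisym (m∸n≡0⇒m≤n (m+n≡0⇒m≡0 _ zero₂)) (m∸n≡0⇒m≤n (m+n≡0⇒n≡0 (nats υ xV 0 ∸ nats υ yV 0) zero₂))) y≡))
          where
          zero₂ : (nats υ xV 0 ∸ nats υ yV 0) + (nats υ yV 0 ∸ nats υ xV 0) ≡ 0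
          zero₂ = n<1⇒n≡0 (≰⇒> (does-false (1 ≤? _) done))

        climbed : ∀ {j₁ υ} {x y : Vertex} → nats υ xV 0 ≡ toℕ x → nats υ yV 0 ≡ toℕ y → x ≡ y → (B : Branches {u₀} {v₀} x y) → let open Branches B in
                  Prefix (nats υ vertO) 0 (u₀ ∷ ys) → Prefix (nats υ edgeO) 0 (e₀ ∷ es) →
                  nats υ jV 0 ≡ length (u₀ ∷ ys) → nats υ jV 0 ≡ length (e₀ ∷ es) →
                  Pile (nats υ tmpV) (nats υ tV 0) xs → Pile (nats υ tmpE) (nats υ tV 0) (edges X) →
                  j₁ + (5 * (Λ.dep (toℕ x) + Λ.dep (toℕ y)) + 2 * length xs) ≤ suc (D + 0) →
                  Run (vertO [ var jV ]≔ var yV ⨾ (while one ≤ⁿ var tV loop unwindBody) ⨾ countO ≔ var jV) υ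
                      (λ j φ → Extracted b φ × suc (1 + (j₁ + j)) ≤ 6 + 10 * n)
        climbed {j₁} {υ} {w} x≡ y≡ refl B vs es₀ j≡ys j≡es pv pe le = run-seq (block _ (_ , run-seq (run-map
            (λ { {j₂} {φ} (_ , record { vs₂ = [] ; es₂ = [] ; vs₁ = vs₁ ; es₁ = es₁ ; vs≡ = vs≡ ; es≡ = es≡ ; verts = verts ; edgs = edgs ; j≡es = j≡ ; k≡ = refl } , _ , le′) →
                 let vertices≡ = trans (sym (++-identityʳ vs₁)) (trans vs≡ (sym (cycle-vertices j₀ wrong B)))
                     edges≡ = trans (sym (++-identityʳ es₁)) (trans es≡ (sym (cycle-edges j₀ wrong B))) in
                 block _ (_ , record
                   { C = cycle j₀ wrong B
                   ; isCycle = cycle-IsCycle j₀ wrong B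
                   ; nonzero = cycle-NonZero j₀ wrong B
                   ; length≤ = ≤ˡ-trans (cycle-length j₀ wrong B) (≤ˡ-reflexive (L.reflexive (sym
                       (cong₂ L._+_ wgt≡ (cong₂ L._+_ (cong Λ.dist to≡) (cong Λ.dist from≡))))))
                   ; count≡ = trans j≡ (cong length edges≡)
                   ; verts = subst (Lists G ℓ (nats φ vertO)) vertices≡ (prefix-lookup 0 vs₁ verts)
                   ; edgs = subst (Lists G ℓ (nats φ edgeO)) edges≡ (prefix-lookup 0 es₁ edgs)
                   } , cost {j₂} le′)
               ; (_ , record { vs₂ = _ ∷ _ ; pile-v = _ , t≡ , _ } , done , _) →
                   ⊥-elim (does-false (1 ≤? _) done (subst (1 ≤_) (sym t≡) (s≤s z≤n)))
               ; (_ , record { es₂ = _ ∷ _ ; pile-e = _ , t≡ , _ } , done , _) →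
                   ⊥-elim (does-false (1 ≤? _) done (subst (1 ≤_) (sym t≡) (s≤s z≤n))) })
            (run-while (Unwinding (u₀ ∷ ys ++ w ∷ xs) (e₀ ∷ es ++ edges X)) (λ go u → run-unwindBody (does-true (1 ≤? _) go) u) record
              { vs₁ = (u₀ ∷ ys) ++ w ∷ [] ; vs₂ = xs ; es₁ = e₀ ∷ es ; es₂ = edges X
              ; vs≡ = ++-assoc (u₀ ∷ ys) (w ∷ []) xs
              ; es≡ = refl
              ; verts = prefix-write vertO (u₀ ∷ ys) j≡ys y≡ vs
              ; edgs = es₀
              ; j≡vs = trans (cong suc j≡ys) (sym (trans (length-++ (u₀ ∷ ys)) (+-comm (length (u₀ ∷ ys)) 1)))
              ; j≡es = j≡es
              ; pile-v = pv
              ; pile-e = pe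
              ; k≡ = refl }))))
          where
          open Branches B
          cost : ∀ {j₂} → j₂ + 2 * 0 ≤ suc (2 * length xs) → suc (1 + (j₁ + (1 + (j₂ + 1)))) ≤ 6 + 10 * n
          cost {j₂} le′ = begin
            suc (1 + (j₁ + (1 + (j₂ + 1)))) ≡⟨ solved j₁ j₂ ⟩
            4 + (j₁ + (j₂ + 0)) ≤⟨ +-monoʳ-≤ 4 (+-monoʳ-≤ j₁ le′) ⟩
            4 + (j₁ + suc (2 * length xs)) ≡⟨ solved′ j₁ (length xs) ⟩
            5 + (j₁ + 2 * length xs) ≤⟨ +-monoʳ-≤ 5 (+-monoʳ-≤ j₁ (m≤n+m (2 * length xs) (5 * (Λ.dep (toℕ w) + Λ.dep (toℕ w))))) ⟩
            5 + (j₁ + (5 * (Λ.dep (toℕ w) + Λ.dep (toℕ w)) + 2 * length xs)) ≤⟨ +-monoʳ-≤ 5 le ⟩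
            5 + suc (D + 0) ≡⟨ cong (6 +_) (+-identityʳ D) ⟩
            6 + D ≤⟨ +-monoʳ-≤ 6 (*-monoʳ-≤ 5 (+-mono-≤ (dep<n u₀ seen-u) (dep<n v₀ seen-v))) ⟩
            6 + 5 * (n + n) ≡⟨ solved″ n ⟩
            6 + 10 * n ∎
            where
            open ≤-Reasoning
            solved : ∀ j j′ → suc (1 + (j + (1 + (j′ + 1)))) ≡ 4 + (j + (j′ + 0))
            solved = solve-∀
            solved′ : ∀ j l → 4 + (j + suc (2 * l)) ≡ 5 + (j + 2 * l)
            solved′ = solve-∀
            solved″ : ∀ n → 6 + 5 * (n + n) ≡ 6 + 10 * n
            solved″ = solve-∀

  -- Iteration over all sources

  module Sources (G : LabeledGraph Γ) (ℓ : Fin (LabeledGraph.m G) → L.Carrier) (N : Network) (eid : ℕ → ℕ) (R : Represents G ℓ N eid)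
                 (rank≤ : ℕ) (rank-bound : ∀ r → pow r ≤ 2 + Network.na N → r ≤ rank≤) where
    open Network N
    open Walks G
    private module D s = Search N s rank≤ rank-bound

    -- The cycle may be shorter than the candidate in `minV`, whose two paths can share a part, so
    -- only an inequality holds here. Since `Global` bounds `minV` by the length of each cycle seen,
    -- it makes C shortest at the end.
    record Result (τ : Store) : Set (a₂ ⊔ ℓ₂) where
      field
        {v}     : Vertex
        C       : Walk v v
        isCycle : IsCycle C
        nonzero : NonZero C
        length≤ : walkLength L ℓ C L.≤ lens τ minV 0
        count≡  : nats τ countO 0 ≡ length (edges C)
        verts   : Lists G ℓ (nats τ vertO) (vertices C)
        edgs    : Lists G ℓ (nats τ edgeO) (edges C)

    result-cong : ∀ {σ τ} → nats τ countO ≡ nats σ countO → nats τ vertO ≡ nats σ vertO → nats τ edgeO ≡ nats σ edgeO →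
                  lens τ minV 0 ≡ lens σ minV 0 → Result σ → Result τ
    result-cong {σ} {τ} c≡ v≡ e≡ m≡ r = record
      { C = C ; isCycle = isCycle ; nonzero = nonzero
      ; length≤ = subst (walkLength L ℓ C L.≤_) (sym m≡) length≤
      ; count≡ = trans (cong-app c≡ 0) count≡
      ; verts = λ i → trans (cong-app v≡ (toℕ i)) (verts i)
      ; edgs = λ i → trans (cong-app e≡ (toℕ i)) (edgs i)
      }
      where open Result r

    Output : Store → Set (a₂ ⊔ ℓ₂)
    Output τ = nats τ foundV 0 ≡ 0 × nats τ countO 0 ≡ 0 ⊎ nats τ foundV 0 ≡ 1 × Result τ

    -- Walks are covered according to their end vertex: a closed walk is accounted for by the search
    -- from that vertex, so after all sources every cycle is.
    record Global (i : ℕ) (τ : Store) : Set (a₁ ⊔ a₂ ⊔ ℓ₀ ⊔ ℓ₂) where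
      field
        static  : Static N τ
        eid≡    : nats τ edgeA ≡ eid
        slots   : ∀ r → nats τ slotA r ≡ 0
        s≡      : nats τ sV 0 ≡ i
        output  : Output τ
        covered : ∀ {w} (D : Walk w w) → toℕ w < i → NonZero D → nats τ foundV 0 ≡ 1 × lens τ minV 0 L.≤ walkLength L ℓ D

    iterationTime : ℕ
    iterationTime = 50 + 10 * rank≤ + (60 * n + 30 * (n * rank≤) + 55 * na)

    run-source : ∀ {i τ} → i < n → Global i τ → Run sourceBody τ (λ j υ → Global (suc i) υ × suc j ≤ iterationTime)
    run-source {i} {τ} i<n g = run-seq (run-map (λ { {j₁} {υ} ((d , le₁) , fr) → searched {j₁} d le₁ fr }) (run-framed (D.run-dijkstra i i<n static s≡ slots)))
      where
      open Global g
      found≤1 : Output τ → nats τ foundV 0 ≤ 1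
      found≤1 (inj₁ (f , _)) = ≤-trans (≤-reflexive f) z≤n
      found≤1 (inj₂ (f , _)) = ≤-reflexive f
      bound : ∀ {j₁ j₂ j₃} → j₁ ≤ D.dijkstraTime i → j₂ ≤ 2 + 10 * na → j₃ ≤ 6 + 10 * n → suc (j₁ + (j₂ + (j₃ + 1))) ≤ iterationTime
      bound {j₁} {j₂} {j₃} le₁ le₂ le₃ = begin
        suc (j₁ + (j₂ + (j₃ + 1))) ≤⟨ s≤s (+-mono-≤ le₁ (+-mono-≤ le₂ (+-monoˡ-≤ 1 le₃))) ⟩
        suc (40 + 10 * rank≤ + (n * (50 + 30 * rank≤) + 45 * na) + (2 + 10 * na + (6 + 10 * n + 1))) ≡⟨ solved n na rank≤ ⟩
        iterationTime ∎
        where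
        open ≤-Reasoning
        solved : ∀ n a r → suc (40 + 10 * r + (n * (50 + 30 * r) + 45 * a) + (2 + 10 * a + (6 + 10 * n + 1))) ≡ 50 + 10 * r + (60 * n + 30 * (n * r) + 55 * a)
        solved = solve-∀

      searched : ∀ {j₁ υ} → D.Done i υ → j₁ ≤ D.dijkstraTime i → Framed dijkstra τ υ →
                 Run (scan ⨾ extract ⨾ sV ≔ var sV +ⁿ one) υ (λ j φ → Global (suc i) φ × suc (j₁ + j) ≤ iterationTime)
      searched {j₁} {υ} d le₁ fr₁ = run-seq (run-map (λ { {j₂} {φ} ((sc , le₂) , fr₂) → scanned {j₂} sc le₂ fr₂ })
          (run-framed (X.run-scan fixed (subst (_≤ 1) (sym found≡) (found≤1 output)))))
        where
        module X = D.Potential i G ℓ eid R (D.Done.tree-s d) (D.Done.settled d)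
        open X using (bad-cycle)
        found≡ : nats υ foundV 0 ≡ nats τ foundV 0
        found≡ = cong-app (Framed.nats≡ fr₁ foundV) 0
        min≡ : lens υ minV 0 ≡ lens τ minV 0
        min≡ = cong-app (Framed.lens≡ fr₁ minV) 0
        fixed : X.Fixed υ
        fixed = record { static = D.Done.static d ; eid≡ = trans (Framed.nats≡ fr₁ edgeA) eid≡ ; labels≡ = refl }

        scanned : ∀ {j₂ φ} → X.Scanning (nats υ foundV 0) (lens υ minV 0) na φ → j₂ ≤ 2 + 10 * na → Framed scan υ φ →
                  Run (extract ⨾ sV ≔ var sV +ⁿ one) φ (λ j χ → Global (suc i) χ × suc (j₁ + (j₂ + j)) ≤ iterationTime)
        scanned {j₂} {φ} sc le₂ fr₂ = run-seq (run-map (λ { {j₃} {χ} ((out , le₃) , fr₃) →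
            let φτ≡ : ∀ k {_ : T (keeps nat k dijkstra)} {_ : T (keeps nat k scan)} → nats φ k ≡ nats τ k
                φτ≡ k {p} {q} = trans (Framed.nats≡ fr₂ k {q}) (Framed.nats≡ fr₁ k {p})
                st = static-frame fr₃ (X.Fixed.static (X.Scanning.fixed sc)) in
            block _ (_ , record
              { static = record { n≡ = Static.n≡ st ; na≡ = Static.na≡ st ; from≡ = Static.from≡ st ; to≡ = Static.to≡ st
                                ; next≡ = Static.next≡ st ; first≡ = Static.first≡ st ; lab≡ = Static.lab≡ st ; wgt≡ = Static.wgt≡ st }
              ; eid≡ = trans (Framed.nats≡ fr₃ edgeA) (X.Fixed.eid≡ (X.Scanning.fixed sc))
              ; slots = λ r → trans (cong-app (Framed.nats≡ fr₃ slotA) r) (trans (cong-app (Framed.nats≡ fr₂ slotA) r) (D.Done.slots d r))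
              ; s≡ = trans (cong (_+ 1) (trans (cong-app (Framed.nats≡ fr₃ sV) 0) (trans (cong-app (φτ≡ sV) 0) s≡))) (+-comm i 1)
              ; output = output-copy out
              ; covered = λ D w≤i nz → let f , le = cover D (m≤n⇒m<n∨m≡n (≤-pred w≤i)) nz in
                  trans (cong-app (Framed.nats≡ fr₃ foundV) 0) f ,
                  subst (L._≤ walkLength L ℓ D) (sym (cong-app (Framed.lens≡ fr₃ minV) 0)) le
              } , bound {j₁} {j₂} {j₃} le₁ le₂ le₃) })
          (run-framed (extracted source)))
          where
          open X.Scanned (X.Scanning.scanned sc) using (source; earlier) renaming (covered to covered-i)
          output-copy : ∀ {χ w} → Output χ → Output (write nat sV 0 w χ)
          output-copy (inj₁ p) = inj₁ p
          output-copy (inj₂ (f , r)) = inj₂ (f , result-cong refl refl refl refl r)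
          cover : ∀ {w} (D : Walk w w) → toℕ w < i ⊎ toℕ w ≡ i → NonZero D → nats φ foundV 0 ≡ 1 × lens φ minV 0 L.≤ walkLength L ℓ D
          cover D (inj₁ w<i) nz =
            let f , le = covered D w<i nz
                f′ , le′ = earlier (trans found≡ f)
            in f′ , ≤ˡ-trans le′ (subst (L._≤ walkLength L ℓ D) (sym min≡) le)
          cover D (inj₂ w≡i) nz =
            let b , b<na , bad-b , le = bad-cycle D w≡i nz
                f , le′ = covered-i b b<na bad-b
            in f , ≤ˡ-trans le′ le
          extracted : _ → Run extract φ (λ j χ → Output χ × j ≤ 6 + 10 * n)
          extracted (inj₁ (barc≡0 , f≡ , m≡)) = run-if
            (λ _ → block skip (_ , kept output , s≤s (s≤s z≤n)))
            (λ gt → ⊥-elim (does-false (nats φ barcV 0 ≤? 0) gt (≤-reflexive barc≡0)))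
            where
            kept : Output τ → Output φ
            kept (inj₁ (f , c)) = inj₁ (trans f≡ (trans found≡ f) ,
              trans (cong-app (Framed.nats≡ fr₂ countO) 0) (trans (cong-app (Framed.nats≡ fr₁ countO) 0) c))
            kept (inj₂ (f , r)) = inj₂ (trans f≡ (trans found≡ f) ,
              result-cong (trans (Framed.nats≡ fr₂ countO) (Framed.nats≡ fr₁ countO)) (trans (Framed.nats≡ fr₂ vertO) (Framed.nats≡ fr₁ vertO))
                          (trans (Framed.nats≡ fr₂ edgeO) (Framed.nats≡ fr₁ edgeO)) (trans m≡ min≡) r)
          extracted (inj₂ (b , barc≡ , b<na , bad-b , m≡ , f≡)) = run-map
            (λ { {_} {χ} ((x , le) , fr) → inj₂ (trans (cong-app (Framed.nats≡ fr foundV) 0) f≡ , record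
                  { C = X.Extracted.C x ; isCycle = X.Extracted.isCycle x ; nonzero = X.Extracted.nonzero x
                  ; length≤ = subst (walkLength L ℓ (X.Extracted.C x) L.≤_) (sym (trans (cong-app (Framed.lens≡ fr minV) 0) m≡)) (X.Extracted.length≤ x)
                  ; count≡ = X.Extracted.count≡ x ; verts = X.Extracted.verts x ; edgs = X.Extracted.edgs x }) , le })
            (run-framed (X.run-extract (X.Scanning.fixed sc) barc≡ b<na bad-b))

    run-sources : ∀ {τ} → Global 0 τ → Run (while one +ⁿ var sV ≤ⁿ nN loop sourceBody) τ
                    (λ j υ → Global n υ × j ≤ 1 + n * iterationTime)
    run-sources g = run-map
        (λ { {j} {υ} (_ , (i , g , i≤n , refl) , done , le) →
             subst (λ i → Global i υ) (≤-antisym i≤n (≮⇒≥ (λ i<n → does-false (suc (nats υ sV 0) ≤? nats υ 0 0) done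
               (subst₂ (λ i n → suc i ≤ n) (sym (Global.s≡ g)) (sym (Static.n≡ (Global.static g))) i<n)))) g ,
             ≤-trans (m≤m+n j _) le })
        (run-while Inv body (0 , g , z≤n , refl))
      where
      Inv : ℕ → Store → Set _
      Inv k τ = ∃[ i ] (Global i τ × i ≤ n × k ≡ (n ∸ i) * iterationTime)
      body : ∀ {k τ} → test (one +ⁿ var sV ≤ⁿ nN) τ ≡ true → Inv k τ → Run sourceBody τ (λ j υ → ∃[ k′ ] (Inv k′ υ × suc (j + k′) ≤ k))
      body {τ = τ} go (i , g , _ , refl) = run-map (λ { {j} (g′ , le) → _ , (suc i , g′ , i<n , refl) ,
          ≤-trans (+-monoˡ-≤ ((n ∸ suc i) * iterationTime) le) (≤-reflexive (cong (_* iterationTime) (sym (+-∸-assoc 1 {n} {suc i} i<n)))) }) (run-source i<n g)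
        where
        i<n : i < n
        i<n = subst₂ (λ i n → suc i ≤ n) (Global.s≡ g) (Static.n≡ (Global.static g)) (does-true (suc (nats τ sV 0) ≤? nats τ 0 0) go)

  module _ (G : LabeledGraph Γ) (ℓ : Fin (LabeledGraph.m G) → L.Carrier) (ℓ≥0 : ∀ e → L.0# L.≤ ℓ e) where
    open LabeledGraph G
    open Walks G

    -- Adjacency lists

    record ArcAt (τ : Store) (b : ℕ) {e u v} (j : Joins e u v) : Set (a₁ ⊔ ℓ₀) where
      constructor arcAt
      field
        from≡ : nats τ fromA b ≡ toℕ u
        to≡   : nats τ toA b ≡ toℕ v
        edge≡ : nats τ edgeA b ≡ toℕ e
        lab≡  : grps τ labA b ≡ ψₑ e j
        wgt≡  : lens τ lenA b ≡ ℓ e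

    record Input (τ : Store) : Set (a₁ ⊔ ℓ₀) where
      field
        n≡      : nats τ 0 0 ≡ n
        m≡      : nats τ 0 1 ≡ m
        tail≡   : ∀ e → nats τ tailA (toℕ e) ≡ toℕ (tail e)
        head≡   : ∀ e → nats τ headA (toℕ e) ≡ toℕ (head e)
        label≡  : ∀ e → grps τ labelA (toℕ e) ≡ label e
        length≡ : ∀ e → lens τ lengthA (toℕ e) ≡ ℓ e

    record Arcs (na : ℕ) (τ : Store) : Set (a₁ ⊔ ℓ₀) where
      field
        adj      : ℕ → List ℕ
        na≡      : nats τ naV 0 ≡ na
        chained  : ∀ {v} → v < n → Chained (nats τ nextA) (nats τ firstA v) (adj v)
        sound    : ∀ {v b} → v < n → b ∈ adj v → b < na × nats τ fromA b ≡ v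
        complete : ∀ {b} → b < na → b ∈ adj (nats τ fromA b)
        total    : sumTo n (λ v → length (adj v)) ≡ na
        arcs     : ∀ {b} → b < na → ∃[ e ] ∃[ u ] ∃[ v ] Σ[ j ∈ Joins e u v ] ArcAt τ b j

    Kept : ℕ → Store → Store → Set (a₁ ⊔ ℓ₀)
    Kept na σ τ = ∀ {b e u v} {j : Joins e u v} → b < na → ArcAt σ b j → ArcAt τ b j

    record Filled (na : ℕ) {e u v} (j : Joins e u v) (σ τ : Store) : Set (a₁ ⊔ ℓ₀) where
      field
        filled : Arcs na τ
        kept   : Kept na σ τ
        new    : ArcAt τ na j

    fill : ∀ {na σ τ e u v} {j : Joins e u v} → Arcs na σ → nats τ naV 0 ≡ na →
           nats τ nextA ≡ nats σ nextA → nats τ firstA ≡ nats σ firstA → ArcAt τ na j →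
           (∀ b → b ≢ na → nats τ fromA b ≡ nats σ fromA b) → (∀ b → b ≢ na → nats τ toA b ≡ nats σ toA b) →
           (∀ b → b ≢ na → nats τ edgeA b ≡ nats σ edgeA b) → (∀ b → b ≢ na → grps τ labA b ≡ grps σ labA b) →
           (∀ b → b ≢ na → lens τ lenA b ≡ lens σ lenA b) → Filled na j σ τ
    fill {na} {σ} {τ} A na≡′ next≡ first≡ new f t e l w = record
      { filled = record
        { adj      = adj
        ; na≡      = na≡′
        ; chained  = λ {v} v<n → subst₂ (λ next first → Chained next (first v) (adj v)) (sym next≡) (sym first≡) (chained v<n)
        ; sound    = λ v<n b∈ → let b<na , eq = sound v<n b∈ in b<na , trans (f _ (<⇒≢ b<na)) eq
        ; complete = λ b<na → subst (λ v → _ ∈ adj v) (sym (f _ (<⇒≢ b<na))) (complete b<na)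
        ; total    = total
        ; arcs     = λ b<na → let e , u , v , j , a = arcs b<na in e , u , v , j , kept′ b<na a
        }
      ; kept = kept′
      ; new  = new
      }
      where
      open Arcs A
      kept′ : Kept na σ τ
      kept′ b<na (arcAt a b c d g) = arcAt (trans (f _ (<⇒≢ b<na)) a) (trans (t _ (<⇒≢ b<na)) b) (trans (e _ (<⇒≢ b<na)) c)
                                       (trans (l _ (<⇒≢ b<na)) d) (trans (w _ (<⇒≢ b<na)) g)

    -- The new arc is put before the list of u. Every other link followed belongs to an arc below
    -- `na`, by `sound`, so no list is disturbed by the write at `na`.
    chain : ∀ {na σ τ e u v} {j : Joins e u v} → Arcs na σ → ArcAt σ na j → nats τ naV 0 ≡ suc na →
            nats τ nextA na ≡ nats σ firstA (toℕ u) → (∀ b → b ≢ na → nats τ nextA b ≡ nats σ nextA b) →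
            nats τ firstA (toℕ u) ≡ suc na → (∀ w → w ≢ toℕ u → nats τ firstA w ≡ nats σ firstA w) →
            nats τ fromA ≡ nats σ fromA → (∀ {b e u v} {j : Joins e u v} → ArcAt σ b j → ArcAt τ b j) → Arcs (suc na) τ
    chain {na} {σ} {τ} {e} {u} {v} {j} A new na≡′ next-na next-off first-u first-off from≡ keep = record
      { adj      = adj′
      ; na≡      = na≡′
      ; chained  = λ {w} w<n → chained′ w w<n (w ≟ toℕ u)
      ; sound    = λ {w} w<n → sound′ w w<n (w ≟ toℕ u)
      ; complete = λ {b} b≤na → subst (λ f → b ∈ adj′ (f b)) (sym from≡) (complete′ b (m≤n⇒m<n∨m≡n (≤-pred b≤na)))
      ; total    = total′
      ; arcs     = λ {b} b≤na → arcs′ b (m≤n⇒m<n∨m≡n (≤-pred b≤na))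
      }
      where
      open Arcs A
      adj′ : ℕ → List ℕ
      adj′ = upd adj (toℕ u) (na ∷ adj (toℕ u))
      adj-u : ∀ {w} → w ≡ toℕ u → adj′ w ≡ na ∷ adj (toℕ u)
      adj-u refl = override-same 0 (toℕ u)
      adj-off : ∀ {w} → w ≢ toℕ u → adj′ w ≡ adj w
      adj-off w≢u = override-other 0 (toℕ u) _ w≢u
      same-next : ∀ {w b} → w < n → b ∈ adj w → nats τ nextA b ≡ nats σ nextA b
      same-next w<n b∈ = next-off _ (<⇒≢ (proj₁ (sound w<n b∈)))
      chained′ : ∀ w → w < n → Dec (w ≡ toℕ u) → Chained (nats τ nextA) (nats τ firstA w) (adj′ w)
      chained′ w w<n (yes refl) = subst (Chained (nats τ nextA) (nats τ firstA w)) (sym (adj-u refl))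
        (first-u , subst (λ p → Chained (nats τ nextA) p (adj w)) (sym next-na) (chained-cong (adj w) (same-next w<n) (chained w<n)))
      chained′ w w<n (no w≢u) = subst₂ (Chained (nats τ nextA)) (sym (first-off w w≢u)) (sym (adj-off w≢u))
        (chained-cong (adj w) (same-next w<n) (chained w<n))
      from-τ : ∀ {b w} → nats σ fromA b ≡ w → nats τ fromA b ≡ w
      from-τ {b} {w} = subst (λ f → f b ≡ w) (sym from≡)
      sound′ : ∀ w {b} → w < n → Dec (w ≡ toℕ u) → b ∈ adj′ w → b < suc na × nats τ fromA b ≡ w
      sound′ w {b} w<n (yes eq) b∈ with subst (b ∈_) (adj-u eq) b∈
      ... | here refl = n<1+n na , from-τ (trans (ArcAt.from≡ new) (sym eq))
      ... | there b∈′ = let b<na , f = sound w<n (subst (λ w → b ∈ adj w) (sym eq) b∈′) in m<n⇒m<1+n b<na , from-τ f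
      sound′ w {b} w<n (no w≢u) b∈ = let b<na , f = sound w<n (subst (b ∈_) (adj-off w≢u) b∈) in m<n⇒m<1+n b<na , from-τ f
      complete′ : ∀ b → b < na ⊎ b ≡ na → b ∈ adj′ (nats σ fromA b)
      complete′ b (inj₁ b<na) with nats σ fromA b ≟ toℕ u
      ... | yes eq = subst (b ∈_) (sym (adj-u eq)) (there (subst (λ w → b ∈ adj w) eq (complete b<na)))
      ... | no neq = subst (b ∈_) (sym (adj-off neq)) (complete b<na)
      complete′ b (inj₂ refl) = subst (b ∈_) (sym (adj-u (ArcAt.from≡ new))) (here refl)
      total′ : sumTo n (λ w → length (adj′ w)) ≡ suc na
      total′ = +-cancelʳ-≡ (length (adj (toℕ u))) _ _ (begin
        sumTo n (λ w → length (adj′ w)) + length (adj (toℕ u))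
          ≡⟨ sumTo-change n (toℕ u) (toℕ<n u) (λ w u≢w → cong length (adj-off (λ eq → u≢w (sym eq)))) ⟩
        sumTo n (λ w → length (adj w)) + length (adj′ (toℕ u)) ≡⟨ cong₂ (λ s as → s + length as) total (adj-u refl) ⟩
        na + suc (length (adj (toℕ u))) ≡⟨ +-suc na _ ⟩
        suc na + length (adj (toℕ u)) ∎)
        where open ≡-Reasoning
      arcs′ : ∀ b → b < na ⊎ b ≡ na → ∃[ e ] ∃[ u ] ∃[ v ] Σ[ j ∈ Joins e u v ] ArcAt τ b j
      arcs′ b (inj₁ b<na) = let e , u , v , j , a = arcs b<na in e , u , v , j , keep a
      arcs′ b (inj₂ refl) = e , u , v , j , keep new

    record Added (na : ℕ) {e u v} (j : Joins e u v) (σ τ : Store) : Set (a₁ ⊔ ℓ₀) where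
      field
        added : Arcs (suc na) τ
        kept  : Kept na σ τ
        new   : ArcAt τ na j
        inputs : Input τ
        e≡    : nats τ eV 0 ≡ nats σ eV 0

    run-addForward : ∀ {na τ} (e : Edge) → Input τ → Arcs na τ → nats τ eV 0 ≡ toℕ e →
                 Run (addArc tailA headA (labelA ‼ᵍ var eV)) τ
                     (λ i υ → Added na {e} {tail e} {head e} (inj₁ (refl , refl)) τ υ × i ≡ 2)
    run-addForward {na} {τ} e I A e≡ = run-seq (run-map (λ { (f , (b≡ , e≡′ , I′) , refl) → filled f b≡ e≡′ I′ }) filling)
      where
      open Arcs A
      open Input I
      j : Joins e (tail e) (head e)
      j = inj₁ (refl , refl)
      at : ∀ {a} {A : Set a} k {v : A} {f : ℕ → ℕ → A} {w} → v ≡ w → override k (nats τ naV 0) v f k na ≡ w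
      at k {v} {f} eq = trans (override-at k {f = f} na≡) eq
      off : ∀ {a} {A : Set a} k {v : A} {f : ℕ → ℕ → A} b → b ≢ na → override k (nats τ naV 0) v f k b ≡ f k b
      off k b b≢na = override-other k (nats τ naV 0) b (λ eq → b≢na (trans eq na≡))
      filling : Run (fillArc tailA headA (labelA ‼ᵍ var eV)) τ (λ i υ → Filled na j τ υ × (nats υ naV 0 ≡ na × nats υ eV 0 ≡ toℕ e × Input υ) × i ≡ 1)
      filling = block _ (_ , fill A na≡ refl refl
          (arcAt (at fromA (trans (cong (nats τ tailA) e≡) (tail≡ e))) (at toA (trans (cong (nats τ headA) e≡) (head≡ e))) (at edgeA e≡)
               (at labA (trans (cong (grps τ labelA) e≡) (label≡ e))) (at lenA (trans (cong (lens τ lengthA) e≡) (length≡ e))))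
          (off fromA) (off toA) (off edgeA) (off labA) (off lenA) ,
        (na≡ , e≡ , record { n≡ = n≡ ; m≡ = m≡ ; tail≡ = tail≡ ; head≡ = head≡ ; label≡ = label≡ ; length≡ = length≡ }) , refl)
      filled : ∀ {υ} → Filled na j τ υ → nats υ naV 0 ≡ na → nats υ eV 0 ≡ toℕ e → Input υ →
               Run (chainArc tailA) υ (λ i φ → Added na j τ φ × 1 + i ≡ 2)
      filled {υ} f b≡ e≡′ I′ = block _ (_ , record
        { added = chain (Filled.filled f) (Filled.new f) (trans (+-comm _ 1) (cong suc b≡))
                    (trans (override-at nextA b≡) (cong (nats υ firstA) u≡)) (λ b b≢ → override-other nextA (nats υ naV 0) b (λ eq → b≢ (trans eq b≡)))
                    (trans (override-at firstA u≡) (trans (+-comm _ 1) (cong suc b≡)))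
                    (λ w w≢ → override-other firstA (nats υ tailA (nats υ eV 0)) w (λ eq → w≢ (trans eq u≡))) refl
                    (λ (arcAt a b c d g) → arcAt a b c d g)
        ; kept  = λ b<na a → let arcAt a b c d g = Filled.kept f b<na a in arcAt a b c d g
        ; new   = let arcAt a b c d g = Filled.new f in arcAt a b c d g
        ; inputs = record { n≡ = Input.n≡ I′ ; m≡ = Input.m≡ I′ ; tail≡ = Input.tail≡ I′ ; head≡ = Input.head≡ I′
                         ; label≡ = Input.label≡ I′ ; length≡ = Input.length≡ I′ }
        ; e≡    = trans e≡′ (sym e≡)
        } , refl)
        where
        u≡ : nats υ tailA (nats υ eV 0) ≡ toℕ (tail e)
        u≡ = trans (cong (nats υ tailA) e≡′) (Input.tail≡ I′ e)

    run-addBackward : ∀ {na τ} (e : Edge) → Input τ → Arcs na τ → nats τ eV 0 ≡ toℕ e →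
                 Run (addArc headA tailA (labelA ‼ᵍ var eV ⁻¹ᵍ)) τ
                     (λ i υ → Added na {e} {head e} {tail e} (inj₂ (refl , refl)) τ υ × i ≡ 2)
    run-addBackward {na} {τ} e I A e≡ = run-seq (run-map (λ { (f , (b≡ , e≡′ , I′) , refl) → filled f b≡ e≡′ I′ }) filling)
      where
      open Arcs A
      open Input I
      j : Joins e (head e) (tail e)
      j = inj₂ (refl , refl)
      at : ∀ {a} {A : Set a} k {v : A} {f : ℕ → ℕ → A} {w} → v ≡ w → override k (nats τ naV 0) v f k na ≡ w
      at k {v} {f} eq = trans (override-at k {f = f} na≡) eq
      off : ∀ {a} {A : Set a} k {v : A} {f : ℕ → ℕ → A} b → b ≢ na → override k (nats τ naV 0) v f k b ≡ f k b
      off k b b≢na = override-other k (nats τ naV 0) b (λ eq → b≢na (trans eq na≡))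
      filling : Run (fillArc headA tailA (labelA ‼ᵍ var eV ⁻¹ᵍ)) τ (λ i υ → Filled na j τ υ × (nats υ naV 0 ≡ na × nats υ eV 0 ≡ toℕ e × Input υ) × i ≡ 1)
      filling = block _ (_ , fill A na≡ refl refl
          (arcAt (at fromA (trans (cong (nats τ headA) e≡) (head≡ e))) (at toA (trans (cong (nats τ tailA) e≡) (tail≡ e))) (at edgeA e≡)
               (at labA (cong Γ._⁻¹ (trans (cong (grps τ labelA) e≡) (label≡ e)))) (at lenA (trans (cong (lens τ lengthA) e≡) (length≡ e))))
          (off fromA) (off toA) (off edgeA) (off labA) (off lenA) ,
        (na≡ , e≡ , record { n≡ = n≡ ; m≡ = m≡ ; tail≡ = tail≡ ; head≡ = head≡ ; label≡ = label≡ ; length≡ = length≡ }) , refl)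
      filled : ∀ {υ} → Filled na j τ υ → nats υ naV 0 ≡ na → nats υ eV 0 ≡ toℕ e → Input υ →
               Run (chainArc headA) υ (λ i φ → Added na j τ φ × 1 + i ≡ 2)
      filled {υ} f b≡ e≡′ I′ = block _ (_ , record
        { added = chain (Filled.filled f) (Filled.new f) (trans (+-comm _ 1) (cong suc b≡))
                    (trans (override-at nextA b≡) (cong (nats υ firstA) u≡)) (λ b b≢ → override-other nextA (nats υ naV 0) b (λ eq → b≢ (trans eq b≡)))
                    (trans (override-at firstA u≡) (trans (+-comm _ 1) (cong suc b≡)))
                    (λ w w≢ → override-other firstA (nats υ headA (nats υ eV 0)) w (λ eq → w≢ (trans eq u≡))) refl
                    (λ (arcAt a b c d g) → arcAt a b c d g)
        ; kept  = λ b<na a → let arcAt a b c d g = Filled.kept f b<na a in arcAt a b c d g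
        ; new   = let arcAt a b c d g = Filled.new f in arcAt a b c d g
        ; inputs = record { n≡ = Input.n≡ I′ ; m≡ = Input.m≡ I′ ; tail≡ = Input.tail≡ I′ ; head≡ = Input.head≡ I′
                         ; label≡ = Input.label≡ I′ ; length≡ = Input.length≡ I′ }
        ; e≡    = trans e≡′ (sym e≡)
        } , refl)
        where
        u≡ : nats υ headA (nats υ eV 0) ≡ toℕ (head e)
        u≡ = trans (cong (nats υ headA) e≡′) (Input.head≡ I′ e)

    -- By recursion, so that `double (suc i)` reduces to two successors, one for each of the two
    -- arcs added for an edge.
    double : ℕ → ℕ
    double zero    = 0
    double (suc i) = suc (suc (double i))

    double≡ : ∀ i → double i ≡ 2 * i
    double≡ zero    = refl
    double≡ (suc i) = trans (cong (λ k → suc (suc k)) (double≡ i)) (sym (*-suc 2 i))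

    record Built (i : ℕ) (τ : Store) : Set (a₁ ⊔ ℓ₀) where
      field
        inputs : Input τ
        arcs   : Arcs (double i) τ
        e≡     : nats τ eV 0 ≡ i
        joins  : ∀ {e u v} (j : Joins e u v) → toℕ e < i → ∃[ b ] (b < double i × ArcAt τ b j)

    run-buildBody : ∀ {i τ} → i < m → Built i τ → Run buildBody τ (λ j υ → Built (suc i) υ × j ≡ 5)
    run-buildBody {i} {τ} i<m record { inputs = I ; arcs = A ; e≡ = e≡ ; joins = joins } =
      run-seq (run-map (λ { (a₁ , refl) → run-seq (run-map (λ { (a₂ , refl) → block _ (_ , record
        { inputs = record { Input (Added.inputs a₂) }
        ; arcs   = Arcs-copy (Added.added a₂)
        ; e≡     = trans (cong (_+ 1) (trans (Added.e≡ a₂) (trans (Added.e≡ a₁) e≡))) (+-comm i 1)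
        ; joins  = λ j e≤i → let b , b< , a = joined a₁ a₂ j (m≤n⇒m<n∨m≡n (≤-pred e≤i)) in b , b< , copy a
        } , refl) })
        (run-addBackward e (Added.inputs a₁) (Added.added a₁) (trans (Added.e≡ a₁) e≡′))) })
      (run-addForward e I A e≡′))
      where
      e : Edge
      e = fromℕ< i<m
      e≡′ : nats τ eV 0 ≡ toℕ e
      e≡′ = trans e≡ (sym (toℕ-fromℕ< i<m))
      copy : ∀ {φ b e′ u v w} {j : Joins e′ u v} → ArcAt φ b j → ArcAt (write nat eV 0 w φ) b j
      copy (arcAt a b c d g) = arcAt a b c d g
      Arcs-copy : ∀ {na φ w} → Arcs na φ → Arcs na (write nat eV 0 w φ)
      Arcs-copy A = record
        { adj = Arcs.adj A ; na≡ = Arcs.na≡ A ; chained = Arcs.chained A ; sound = Arcs.sound A ; complete = Arcs.complete A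
        ; total = Arcs.total A ; arcs = λ b< → let e , u , v , j , a = Arcs.arcs A b< in e , u , v , j , copy a }
      joined : ∀ {υ φ} → Added (double i) (inj₁ (refl , refl)) τ υ → Added (suc (double i)) (inj₂ (refl , refl)) υ φ →
               ∀ {e′ u v} (j : Joins e′ u v) → toℕ e′ < i ⊎ toℕ e′ ≡ i → ∃[ b ] (b < double (suc i) × ArcAt φ b j)
      joined a₁ a₂ j (inj₁ e<i) =
        let b , b< , a = joins j e<i in b , m<n⇒m<1+n (m<n⇒m<1+n b<) , Added.kept a₂ (m<n⇒m<1+n b<) (Added.kept a₁ b< a)
      joined a₁ a₂ {e′} j (inj₂ e≡i) with toℕ-injective (trans e≡i (sym (toℕ-fromℕ< i<m)))
      joined a₁ a₂ (inj₁ (refl , refl)) (inj₂ _) | refl = double i , m<n⇒m<1+n ≤-refl , Added.kept a₂ ≤-refl (Added.new a₁)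
      joined a₁ a₂ (inj₂ (refl , refl)) (inj₂ _) | refl = suc (double i) , ≤-refl , Added.new a₂

    run-build : Run build (input G ℓ) (λ j τ → Built m τ × j ≤ 1 + 6 * m)
    run-build = run-map
        (λ { {j} {τ} (_ , (i , B , i≤m , refl) , done , le) →
             subst (λ i → Built i τ) (≤-antisym i≤m (≮⇒≥ (λ i<m → does-false (suc (nats τ eV 0) ≤? nats τ 0 1) done
               (subst₂ (λ i m → suc i ≤ m) (sym (Built.e≡ B)) (sym (Input.m≡ (Built.inputs B))) i<m)))) B ,
             ≤-trans (m≤m+n j _) le })
        (run-while Inv body (0 , start , z≤n , refl))
      where
      Inv : ℕ → Store → Set _
      Inv k τ = ∃[ i ] (Built i τ × i ≤ m × k ≡ 6 * (m ∸ i))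
      start : Built 0 (input G ℓ)
      start = record
        { inputs = record
          { n≡ = refl ; m≡ = refl
          ; tail≡ = table-toℕ 0 (λ e → toℕ (tail e)) ; head≡ = table-toℕ 0 (λ e → toℕ (head e))
          ; label≡ = table-toℕ Γ.ε label ; length≡ = table-toℕ L.0# ℓ }
        ; arcs = record
          { adj = λ _ → [] ; na≡ = refl ; chained = λ _ → refl ; sound = λ _ () ; complete = λ ()
          ; total = sumTo-zero n (λ _ _ → refl) ; arcs = λ () }
        ; e≡ = refl
        ; joins = λ _ ()
        }
      body : ∀ {k τ} → test (one +ⁿ var eV ≤ⁿ mN) τ ≡ true → Inv k τ → Run buildBody τ (λ j υ → ∃[ k′ ] (Inv k′ υ × suc (j + k′) ≤ k))
      body {τ = τ} go (i , B , _ , refl) = run-map (λ { (B′ , refl) → _ , (suc i , B′ , i<m , refl) ,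
          ≤-reflexive (trans (sym (*-suc 6 (m ∸ suc i))) (cong (6 *_) (sym (+-∸-assoc 1 i<m)))) }) (run-buildBody i<m B)
        where
        i<m : i < m
        i<m = subst₂ (λ i m → suc i ≤ m) (Built.e≡ B) (Input.m≡ (Built.inputs B)) (does-true (suc (nats τ eV 0) ≤? nats τ 0 1) go)

    -- From the adjacency lists to the whole program

    module _ {τ : Store} (B : Built m τ) where
      open Built B
      open Arcs arcs using (adj; na≡; chained; sound; complete; total) renaming (arcs to arcs-at)

      network : Network
      network = record
        { n = n
        ; na = double m
        ; from = nats τ fromA
        ; to = nats τ toA
        ; next = nats τ nextA
        ; first = nats τ firstA
        ; lab = grps τ labA
        ; wgt = lens τ lenA
        ; adj = adj
        ; from< = λ b< → let _ , u , _ , _ , arcAt f _ _ _ _ = arcs-at b< in subst (_< n) (sym f) (toℕ<n u)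
        ; to< = λ b< → let _ , _ , v , _ , arcAt _ t _ _ _ = arcs-at b< in subst (_< n) (sym t) (toℕ<n v)
        ; wgt≥0 = λ b< → let e , _ , _ , _ , arcAt _ _ _ _ w = arcs-at b< in subst (L.0# L.≤_) (sym w) (ℓ≥0 e)
        ; chained = chained
        ; adj-sound = sound
        ; adj-complete = complete
        ; adj-total = total
        }

      represents : Represents G ℓ network (nats τ edgeA)
      represents = record
        { order≡ = refl
        ; arcs = λ b< → let e , u , v , j , arcAt f t i l w = arcs-at b< in e , u , v , j , arc f t i l w
        ; joins = λ {e} j → let b , b< , arcAt f t i l w = joins j (toℕ<n e) in b , b< , arc f t i l w
        }

    programTime : ℕ
    programTime = 2 + 6 * m + n * sourceTime n m (maxRank n (2 + 2 * m))

    run-program : Run program (input G ℓ) (λ j τ → CorrectOutput G ℓ τ × j ≤ programTime)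
    run-program = run-seq (run-map (λ { {j₁} {τ} ((B , le₁) , fr) → built {j₁} B le₁ fr }) (run-framed run-build))
      where
      rank≤ = maxRank n (2 + 2 * m)
      built : ∀ {j₁ τ} → Built m τ → j₁ ≤ 1 + 6 * m → Framed build (input G ℓ) τ →
              Run (while one +ⁿ var sV ≤ⁿ nN loop sourceBody) τ (λ j υ → CorrectOutput G ℓ υ × j₁ + j ≤ programTime)
      built {j₁} {τ} B le₁ fr = run-map (λ { {j₂} {υ} (g , le₂) → correct (Global.output g) (Global.covered g) , bound {j₂} le₂ })
        (run-sources record
          { static = record { n≡ = Input.n≡ (Built.inputs B) ; na≡ = Arcs.na≡ (Built.arcs B) ; from≡ = refl ; to≡ = refl
                            ; next≡ = refl ; first≡ = refl ; lab≡ = refl ; wgt≡ = refl }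
          ; eid≡ = refl
          ; slots = λ r → cong-app (Framed.nats≡ fr slotA) r
          ; s≡ = cong-app (Framed.nats≡ fr sV) 0
          ; output = inj₁ (cong-app (Framed.nats≡ fr foundV) 0 , cong-app (Framed.nats≡ fr countO) 0)
          ; covered = λ _ ()
          })
        where
        open Sources G ℓ (network B) (nats τ edgeA) (represents B) rank≤
               (λ r p → rank-bounded n (2 + 2 * m) r (≤-trans p (≤-reflexive (cong (2 +_) (double≡ m)))))
        correct : ∀ {υ} → Output υ → (∀ {w} (D : Walk w w) → toℕ w < n → NonZero D →
                    nats υ foundV 0 ≡ 1 × OrderedField._≤_ L (lens υ minV 0) (walkLength L ℓ D)) → CorrectOutput G ℓ υ
        correct (inj₁ (f , c)) covered = none c (λ {v} C _ nz → 0≢1 (trans (sym f) (proj₁ (covered C (toℕ<n v) nz))))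
          where
          0≢1 : 0 ≢ 1
          0≢1 ()
        correct (inj₂ (_ , r)) covered = found C
            (isCycle , nonzero , λ {w} D _ nz → IsDecTotalOrder.trans (OrderedField.isDecTotalOrder L) length≤ (proj₂ (covered D (toℕ<n w) nz)))
            count≡ verts edgs
          where open Result r
        bound : ∀ {j₂} → j₂ ≤ 1 + n * iterationTime → j₁ + j₂ ≤ programTime
        bound {j₂} le₂ = begin
          j₁ + j₂ ≤⟨ +-mono-≤ le₁ le₂ ⟩
          (1 + 6 * m) + (1 + n * iterationTime) ≡⟨ cong (λ a → (1 + 6 * m) + (1 + n * (50 + 10 * rank≤ + (60 * n + 30 * (n * rank≤) + 55 * a)))) (double≡ m) ⟩
          (1 + 6 * m) + (1 + n * (50 + 10 * rank≤ + (60 * n + 30 * (n * rank≤) + 55 * (2 * m)))) ≡⟨ solved n m rank≤ ⟩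
          programTime ∎
          where
          open ≤-Reasoning
          solved : ∀ n m r → (1 + 6 * m) + (1 + n * (50 + 10 * r + (60 * n + 30 * (n * r) + 55 * (2 * m)))) ≡
                   2 + 6 * m + n * (50 + 10 * r + (60 * n + 30 * (n * r) + 110 * m))
          solved = solve-∀

open LabeledGraph using (n; m)

theorem1p2 : ∀ {a b c ℓ₁ ℓ₂} (Γ : Group a b) (_≟ᵍ_ : Decidable (Group._≈_ Γ)) (L : OrderedField c ℓ₁ ℓ₂) →
    let open Machine Γ _≟ᵍ_ L
        module L = OrderedField L in
    Σ[ P ∈ Program ] Σ[ K ∈ ℕ ]
    ((G : LabeledGraph Γ) (ℓ : Fin (m G) → L.Carrier) → (∀ e → L.0# L.≤ ℓ e) →
    ∃[ t ] ∃[ τ ]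
    (⟨ P , input G ℓ ⟩⇓⟨ t , τ ⟩ ×
    t ≤ K * suc (n G * (m G + n G * ⌈log₂ n G ⌉)) ×
    CorrectOutput G ℓ τ))
theorem1p2 Γ _≟ᵍ_ L = program , tick * 440 , λ G ℓ ℓ≥0 →
  let run j exec time≤ (correct , j≤) = run-program Γ _≟ᵍ_ L G ℓ ℓ≥0
  in _ , _ , exec ,
     ≤-trans time≤ (≤-trans (*-monoʳ-≤ tick (≤-trans j≤ (time-bound (n G) (m G) (edgeless G))))
                            (≤-reflexive (sym (*-assoc tick 440 (suc (n G * (m G + n G * ⌈log₂ n G ⌉))))))) ,
     correct
  where
  no-vertex : ∀ {k} → Fin k → k ≢ 0
  no-vertex () refl
  -- For n = 0 the bound is a constant, whereas reading the edges takes time proportional to m; but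
  -- an edge would have a tail.
  edgeless : ∀ G → n G ≡ 0 → m G ≡ 0
  edgeless G n≡0 with m G in eq
  ... | zero  = refl
  ... | suc _ = ⊥-elim (no-vertex (LabeledGraph.tail G (subst Fin (sym eq) fzero)) n≡0)
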